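{- Let $n\geq 6$ be an integer, and regard $\tilde{J}(n,3)$ as a subset of the $(n-1)$-dimensional Euclidean space $H_{n,3}=\{(x_1,\dots,x_n)\in\mathbb{R}^n:\sum_i x_i=3\}\simeq\mathbb{R}^{n-1}$. (1) If $n\neq 8,9$, then $\tilde{J}(n,3)$ is maximal as a three-distance set in $H_{n,3}$. (2) If $n=8$, then the maximal three-distance set in $H_{8,3}$ which contains $\tilde{J}(8,3)$ is (uniquely) $$\tilde{J}(8,3)\ \cup\ \left(\left(\tfrac12\right)^7,\,-\tfrac12\right)^P,$$ which has $64$ vectors. (3) If $n=9$, let $x_0=\left(\left(\tfrac13\right)^9\right)$ and $Y=\left(\tfrac43,\,\left(\tfrac13\right)^7,\,-\tfrac23\right)^P$. The map $y\mapsto 2x_0-y$ partitions $Y$ into pairs $\{y,2x_0-y\}$. The maximal three-distance sets in $H_{9,3}$ which contain $\tilde{J}(9,3)$ are exactly the sets $$\tilde{J}(9,3)\cup\{x_0\}\cup Y',$$ where $Y'\subset Y$ contains exactly one vector from each pair $\{y,2x_0-y\}$. Each of these sets has $121$ vectors.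
   Context: Notation: $(a_1^{r_1},\dots,a_t^{r_t})^P$ denotes the set of all vectors obtained by permuting the coordinates of the vector in which $a_i$ occurs $r_i$ times; inside the parentheses exponents are multiplicities, not powers. $((a)^n)$ is the constant vector $(a,\dots,a)\in\mathbb{R}^n$. $\tilde{J}(n,3)=(1^3,0^{n-3})^P\subset\mathbb{R}^n$ is the set of all $0/1$ vectors of length $n$ with exactly three ones (the representation of the Johnson graph $J(n,3)$). A finite subset of a Euclidean space is an $s$-distance set if exactly $s$ distinct values occur as Euclidean distances between distinct points of it. An $s$-distance set is maximal in a given space if no other $s$-distance set in that space contains it. -}

module Defs where

open import Algebra.Apartness.Bundles using (HeytingField)
import Algebra.Apartness.Properties.HeytingCommutativeRing as HeytingProperties
open import Algebra.Bundles using (CommutativeRing)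
import Algebra.Definitions.RawMonoid as RawMonoidDefinitions
import Algebra.Properties.Ring as RingProperties
open import Data.Fin.Permutation using (Permutation; _⟨$⟩ʳ_)
open import Data.List.Base using (List; []; _∷_; length; lookup; concatMap; replicate)
import Data.List.Membership.Setoid as Membership
import Data.List.Relation.Unary.Unique.Setoid as UniqueList
open import Data.Nat.Base using (ℕ; zero; suc; _∸_; NonZero)
open import Data.Product.Base using (_×_; _,_; proj₁; proj₂; ∃-syntax; Σ-syntax)
open import Data.Sum.Base using (_⊎_; inj₁; inj₂; [_,_]′)
open import Data.Vec.Functional using (Vector)
import Data.Vec.Functional.Relation.Binary.Equality.Setoid as VectorEquality
open import Function.Bundles using (_⇔_)
open import Level using (0ℓ)
open import Relation.Binary.Bundles using (Setoid)
open import Relation.Binary.Core using (Rel)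
open import Relation.Binary.Definitions using (_Respects_)
open import Relation.Binary.PropositionalEquality using (_≡_)
open import Relation.Binary.Structures using (IsStrictPartialOrder)
open import Relation.Nullary.Negation using (¬_)
open import Relation.Unary using (Pred)

-- The real numbers, axiomatised as a complete ordered field.  The axioms are
-- phrased so that they also hold constructively (e.g. for the Bishop reals):
-- the order is total only in the sense of the cotransitive apartness _#_, and
-- suprema are required of located sets.  Classically _#_ is the negation of
-- _≈_ and every set is located, so this is the usual notion, whose only model
-- up to isomorphism is ℝ.
record CompleteOrderedField : Set₁ where
  field
    heytingField : HeytingField 0ℓ 0ℓ 0ℓ

  open HeytingField heytingField public

  commutativeRing : CommutativeRing 0ℓ 0ℓ
  commutativeRing = record { isCommutativeRing = isCommutativeRing }

  infix 4 _<_ _≤_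

  field
    _<_                  : Rel Carrier 0ℓ
    isStrictPartialOrder : IsStrictPartialOrder _≈_ _<_
    <⇒#                  : ∀ {x y} → x < y → x # y
    #⇒<⊎>                : ∀ {x y} → x # y → x < y ⊎ y < x
    +-monoˡ-<            : ∀ z {x y} → x < y → x + z < y + z
    *-pos                : ∀ {x y} → 0# < x → 0# < y → 0# < x * y

  _≤_ : Rel Carrier 0ℓ
  x ≤ y = ¬ (y < x)

  UpperBound : Pred Carrier 0ℓ → Pred Carrier 0ℓ
  UpperBound P b = ∀ {x} → P x → x ≤ b

  Located : Pred Carrier 0ℓ → Set
  Located P = ∀ {a b} → a < b → (∃[ x ] P x × a < x) ⊎ UpperBound P b

  IsSupremum : Pred Carrier 0ℓ → Pred Carrier 0ℓ
  IsSupremum P s = UpperBound P s × (∀ {a} → a < s → ∃[ x ] P x × a < x)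

  field
    supremum : ∀ (P : Pred Carrier 0ℓ) →
               (∃[ x ] P x) → (∃[ b ] UpperBound P b) → Located P →
               ∃[ s ] IsSupremum P s

module _ (S : Setoid 0ℓ 0ℓ) where
  open Setoid S using (Carrier)
  open Membership S using (_∈_)
  open UniqueList S using (Unique)

  Enumerates : List Carrier → Pred Carrier 0ℓ → Set
  Enumerates xs P = Unique xs × (∀ x → P x ⇔ x ∈ xs)

  Finite : Pred Carrier 0ℓ → Set
  Finite P = ∃[ xs ] Enumerates xs P

  HasSize : Pred Carrier 0ℓ → ℕ → Set
  HasSize P k = ∃[ xs ] Enumerates xs P × length xs ≡ k

module Euclidean (R : CompleteOrderedField) where
  open CompleteOrderedField R
  open HeytingProperties heytingCommutativeRing using (1#0)

  private
    module R = CommutativeRing commutativeRing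

  open RingProperties R.ring using (-‿distribˡ-*; -‿involutive)
  open IsStrictPartialOrder isStrictPartialOrder
    using (<-resp-≈) renaming (trans to <-trans)
  open RawMonoidDefinitions R.+-rawMonoid using (sum) renaming (_×_ to _·_)
  open VectorEquality R.setoid using (≋-setoid; ≋-sym; ≋-trans; foldr-cong)
  open VectorEquality R.setoid public using (_≋_)

  fromℕ : ℕ → Carrier
  fromℕ k = k · 1#

  0<1 : 0# < 1#
  0<1 = [ (λ 1<0 → proj₁ <-resp-≈ -1*-1≈1 (*-pos (0<-1 1<0) (0<-1 1<0)))
        , (λ 0<1 → 0<1) ]′ (#⇒<⊎> 1#0)
    where
    0<-1 : 1# < 0# → 0# < - 1#
    0<-1 1<0 = proj₁ <-resp-≈ (R.+-identityˡ (- 1#))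
                 (proj₂ <-resp-≈ (R.-‿inverseʳ 1#) (+-monoˡ-< (- 1#) 1<0))

    -1*-1≈1 : - 1# * - 1# ≈ 1#
    -1*-1≈1 = R.trans (R.sym (-‿distribˡ-* 1# (- 1#)))
             (R.trans (R.-‿cong (R.*-identityˡ (- 1#))) (-‿involutive 1#))

  0<fromℕ : ∀ k → 0# < fromℕ (suc k)
  0<fromℕ zero    = proj₁ <-resp-≈ (R.sym (R.+-identityʳ 1#)) 0<1
  0<fromℕ (suc k) = <-trans (0<fromℕ k)
    (proj₂ <-resp-≈ (R.+-identityˡ _) (+-monoˡ-< (fromℕ (suc k)) 0<1))

  infixl 7 _/_

  _/_ : ℕ → (k : ℕ) .{{_ : NonZero k}} → Carrier
  -- The inverse is that of fromℕ (suc k) - 0#, as #⇒invertible inverts differences.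
  m / suc k = fromℕ m * proj₁ (#⇒invertible (#-sym (<⇒# (0<fromℕ k))))

  Point : ℕ → Set
  Point n = Vector Carrier n

  IsDistance : ∀ {n} → Point n → Point n → Carrier → Set
  IsDistance x y d = 0# ≤ d × d * d ≈ sum (λ i → (x i - y i) * (x i - y i))

  record Subset (n : ℕ) : Set₁ where
    field
      member : Pred (Point n) 0ℓ
      resp   : member Respects _≋_

  open Subset

  infix 4 _∈_ _∉_ _⊆_ _≐_
  infixr 6 _∪_

  _∈_ _∉_ : ∀ {n} → Point n → Subset n → Set
  x ∈ A = member A x
  x ∉ A = ¬ (x ∈ A)

  _⊆_ _≐_ : ∀ {n} → Subset n → Subset n → Set
  A ⊆ B = ∀ {x} → x ∈ A → x ∈ B
  A ≐ B = A ⊆ B × B ⊆ A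

  _∪_ : ∀ {n} → Subset n → Subset n → Subset n
  (A ∪ B) .member x = x ∈ A ⊎ x ∈ B
  (A ∪ B) .resp x≋y = [ (λ p → inj₁ (resp A x≋y p)) , (λ q → inj₂ (resp B x≋y q)) ]′

  ｛_｝ : ∀ {n} → Point n → Subset n
  ｛ a ｝ .member x = x ≋ a
  ｛ a ｝ .resp x≋y x≋a = ≋-trans (≋-sym x≋y) x≋a

  infix 4 ∣_∣≡_

  ∣_∣≡_ : ∀ {n} → Subset n → ℕ → Set
  ∣_∣≡_ {n} A k = HasSize (≋-setoid n) (member A) k

  Distances : ∀ {n} → Subset n → Pred Carrier 0ℓ
  Distances A d = ∃[ x ] ∃[ y ] x ∈ A × y ∈ A × ¬ (x ≋ y) × IsDistance x y d

  IsDistanceSet : ∀ {n} → ℕ → Subset n → Set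
  IsDistanceSet {n} s A =
    Finite (≋-setoid n) (member A) × HasSize R.setoid (Distances A) s

  IsMaximalDistanceSet : ∀ {n} → ℕ → Subset n → Subset n → Set₁
  IsMaximalDistanceSet s E A =
    A ⊆ E × IsDistanceSet s A ×
    (∀ B → B ⊆ E → IsDistanceSet s B → A ⊆ B → B ⊆ A)

  -- (a₁^r₁,…,aₜ^rₜ)ᴾ.  The set is empty if r₁ + ⋯ + rₜ differs from the
  -- dimension n, since then there is no bijection between the index sets.
  _ᴾ : ∀ {n} → List (Carrier × ℕ) → Subset n
  _ᴾ {n} as .member x =
    let coords = concatMap (λ (a , r) → replicate r a) as in
    Σ[ σ ∈ Permutation n (length coords) ] ∀ i → x i ≈ lookup coords (σ ⟨$⟩ʳ i)
  _ᴾ as .resp x≋y (σ , eq) = σ , λ i → R.trans (R.sym (x≋y i)) (eq i)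

  H : (n k : ℕ) → Subset n
  H n k .member x = sum x ≈ fromℕ k
  H n k .resp x≋y eq = R.trans (R.sym (foldr-cong R.+-cong R.refl x≋y)) eq

  J̃ : (n k : ℕ) → Subset n
  J̃ n k = ((1# , k) ∷ (0# , n ∸ k) ∷ []) ᴾ

  -- The point reflection y ↦ 2c - y.
  reflect : ∀ {n} → Point n → Point n → Point n
  reflect c y i = fromℕ 2 * c i - y i

  -- Y' contains exactly one point of each pair {y , reflect c y} with y ∈ Y.
  IsTransversal : ∀ {n} → Point n → Subset n → Subset n → Set
  IsTransversal c Y Y' =
    Y' ⊆ Y ×
    (∀ {y} → y ∈ Y → (y ∈ Y' × reflect c y ∉ Y') ⊎ (y ∉ Y' × reflect c y ∈ Y'))

{-# OPTIONS --safe #-}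

-- A point at allowed distances √2, 2, √6 from all of J̃(n,3) has triple sums of coordinates taking
-- only three values, in arithmetic progression of difference 1.  Hence its coordinates differ by
-- integers of absolute value at most 2, and two triple sums differ by at most 2.  Three disjoint
-- pairs of distinct coordinates would violate the latter, so the vector is constant up to two
-- coordinates: x = a + α e_p + β e_q.  Together with Σ xᵢ = 3 the triple sums give a Diophantine
-- condition on α, β and n, whose only solutions with n ≥ 6 are the vectors (½⁷, -½) for n = 8 and
-- x₀ and Y for n = 9.  All their mutual distances are again √2, 2 or √6, except that antipodal
-- vectors of Y are at distance √8.  Decidability of equality, which is needed throughout, comes
-- from the enumerations that finiteness provides.
module Submission where

open import Defs

import Algebra.Apartness.Properties.HeytingCommutativeRing as HeytingProperties
open import Algebra.Bundles using (CommutativeRing)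
open import Algebra.Bundles.Raw using (RawRing)
import Algebra.Properties.Ring as RingProperties
import Algebra.Properties.Semiring.Mult as SemiringMult
import Algebra.Properties.Semiring.Sum as SemiringSum
import Algebra.Solver.Ring as RingSolver
open import Algebra.Solver.Ring.AlmostCommutativeRing using (fromCommutativeRing; _-Raw-AlmostCommutative⟶_)
open import Data.Bool.Base using (if_then_else_)
open import Data.Empty using (⊥; ⊥-elim)
open import Data.Fin.Base using (Fin; zero; suc; toℕ; fromℕ<; punchIn; punchOut) renaming (_<_ to _<ᶠ_)
open import Data.Fin.Patterns
open import Data.Fin.Permutation as Perm using (Permutation; _⟨$⟩ʳ_; _⟨$⟩ˡ_; insert; cast-id)
open import Data.Fin.Properties as Fin
  using (pigeonhole; toℕ-fromℕ<; punchInᵢ≢i; punchIn-punchOut; punchIn-injective)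
  renaming (_≟_ to _≟ᶠ_)
open import Data.Integer.Base as ℤ using (ℤ; +_; -[1+_]; 0ℤ; 1ℤ; -1ℤ; ∣_∣)
import Data.Integer.Properties as ℤ
open import Data.Integer.Solver using (module +-*-Solver)
open import Data.List.Base
  using (List; []; _∷_; _++_; map; filter; cartesianProduct; allFin; length; lookup; replicate)
import Data.List.Membership.DecPropositional as DecMembership
import Data.List.Membership.Propositional as List
open import Data.List.Membership.Propositional.Properties
  using (∈-filter⁺; ∈-filter⁻; ∈-cartesianProduct⁺; ∈-allFin)
import Data.List.Membership.Setoid as Membership
import Data.List.Membership.Setoid.Properties as Membershipₚ
open import Data.List.Properties using (length-++; length-replicate)
open import Data.List.Relation.Unary.All as All using (All; []; _∷_)
open import Data.List.Relation.Unary.All.Properties using (¬Any⇒All¬)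
open import Data.List.Relation.Unary.AllPairs using ([]; _∷_)
open import Data.List.Relation.Unary.Any as Any using (Any; here; there; index)
import Data.List.Relation.Unary.Any.Properties as Anyₚ
open import Data.List.Relation.Unary.Unique.Propositional using () renaming (Unique to Unique≡)
import Data.List.Relation.Unary.Unique.Propositional.Properties as Unique≡
import Data.List.Relation.Unary.Unique.Setoid as UniqueList
import Data.List.Relation.Unary.Unique.Setoid.Properties as Uniqueₚ
open import Data.Maybe.Base as Maybe using (Maybe)
open import Data.Nat.Base as ℕ using (ℕ; zero; suc; s≤s; z≤n)
import Data.Nat.Properties as ℕ
open import Data.Product.Base using (_×_; _,_; ∃-syntax; proj₁; proj₂)
open import Data.Sum.Base as Sum using (_⊎_; inj₁; inj₂; [_,_]′)
open import Data.Vec.Functional using (Vector)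
open import Data.Vec.Functional.Relation.Binary.Equality.Setoid using (≋-setoid)
open import Function.Base using (_∘_)
open import Function.Bundles using (_⇔_; mk⇔; Equivalence)
open import Level using (0ℓ)
open import Relation.Binary.Bundles using (Setoid)
open import Relation.Binary.Definitions using (DecidableEquality; _Respects_; tri<; tri≈; tri>)
open import Relation.Binary.PropositionalEquality as ≡ using (_≡_; _≢_; refl; cong; cong₂; subst; ≢-sym)
import Relation.Binary.Reasoning.Setoid as ≈-Reasoning
open import Relation.Binary.Structures using (IsStrictPartialOrder)
open import Relation.Nullary.Decidable
  using (Dec; does; yes; no; _×-dec_; _⊎-dec_; _→-dec_; ¬?; from-yes; dec-yes; dec-no; dec⇒maybe;
         decidable-stable; map′)
open import Relation.Nullary.Negation using (¬_; contradiction)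
open import Relation.Unary using (Pred; Decidable)

-- Vectors that are constant up to two coordinates

-- For n ≥ 6 the set J̃(n,3) alone realises √2, 2 and √6. A three-distance set containing it is
-- therefore the same as a finite superset whose distinct points are pairwise at these distances,
-- and everything is reduced to this pairwise condition. The identity 2(xᵢ + xⱼ + xₗ) = |x|² + 3 -
-- d² loses its unknown |x|² when two triples are compared. As d² is 2, 4 or 6, what remains is an
-- even integer, and triples sharing two indices pass the integrality on to single coordinates. From
-- there the argument runs in ℤ, apart from one real number a, which the coordinate sum 3
-- determines. The obstacle is that neither equality nor order of reals is decidable. Case
-- distinctions on points go through positions in duplicate-free lists, and comparisons through
-- cotransitivity. Moreover the definition counts distances, not their squares, so square roots have
-- to exist in the field; this is where completeness enters. For n = 9 the differences of Y to x₀
-- are the 72 roots of A₈, and the choice of Y' is the choice of one root from each opposite pair.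

fresh : ∀ {n} (is : List (Fin n)) → length is ℕ.< n → ∃[ i ] All (i ≢_) is
fresh {n} is |is|<n with Fin.any? (λ i → ¬? (i ∈? is))
  where
  open DecMembership (_≟ᶠ_ {n}) using (_∈?_)
... | yes (i , i∉is) = i , ¬Any⇒All¬ is i∉is
-- If every index were listed, its position would map `Fin n` into fewer than n places.
... | no ∄i = ⊥-elim (Fin.<⇒≢ i<j (≡.trans (Anyₚ.lookup-index (covered i))
                (≡.trans (cong (lookup is) same) (≡.sym (Anyₚ.lookup-index (covered j))))))
  where
  open DecMembership (_≟ᶠ_ {n}) using (_∈?_)
  covered : ∀ i → i List.∈ is
  covered i = decidable-stable (i ∈? is) (λ i∉ → ∄i (i , i∉))
  clash = pigeonhole |is|<n (λ i → index (covered i))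
  i = proj₁ clash
  j = proj₁ (proj₂ clash)
  i<j = proj₁ (proj₂ (proj₂ clash))
  same = proj₂ (proj₂ (proj₂ clash))

Apart : ∀ {n} → Fin n × Fin n → Fin n × Fin n → Set
Apart (i , j) (u , v) = (i ≢ u × i ≢ v) × (j ≢ u × j ≢ v)

module _ {n} {A : Set} (_≟_ : DecidableEquality A) (k : Fin n → A) where

  Unequal : Fin n × Fin n → Set
  Unequal (i , j) = k i ≢ k j

  -- The graph whose edges are the unequal pairs is complete multipartite; three disjoint edges of
  -- it are excluded.
  NoUnequalMatching : Set
  NoUnequalMatching = ∀ {a b c} → Apart a b → Apart a c → Apart b c →
                      Unequal a → Unequal b → Unequal c → ⊥

  private
    unequalPair : ∀ is → (∃[ i ] ∃[ j ] All (i ≢_) is × All (j ≢_) is × k i ≢ k j) ⊎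
                         (∀ {i j} → All (i ≢_) is → All (j ≢_) is → k i ≡ k j)
    unequalPair is with Fin.any? (λ i → Fin.any? (λ j → avoids i ×-dec avoids j ×-dec ¬? (k i ≟ k j)))
      where
      avoids : ∀ i → Dec (All (i ≢_) is)
      avoids i = All.all? (λ j → ¬? (i ≟ᶠ j)) is
    ... | yes pair = inj₁ pair
    ... | no ∄pair = inj₂ λ {i} {j} i∉ j∉ →
      decidable-stable (k i ≟ k j) (λ ki≢kj → ∄pair (i , j , i∉ , j∉ , ki≢kj))

    module _ (no₃ : NoUnequalMatching) {r₁ r₂} (r₁≢r₂ : r₁ ≢ r₂) (kr₂≡kr₁ : k r₂ ≡ k r₁) where

      ordinary : ∀ {i j u v} → Apart (i , j) (u , v) →
                 All (r₁ ≢_) (i ∷ j ∷ u ∷ v ∷ []) → All (r₂ ≢_) (i ∷ j ∷ u ∷ v ∷ []) →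
                 k i ≢ k j → k u ≢ k v → k u ≡ k r₁ ⊎ k v ≡ k r₁
      ordinary {i} {j} {u} {v} ((i≢u , i≢v) , (j≢u , j≢v))
               (r₁≢i ∷ r₁≢j ∷ r₁≢u ∷ r₁≢v ∷ []) (r₂≢i ∷ r₂≢j ∷ r₂≢u ∷ r₂≢v ∷ []) ki≢kj ku≢kv
        with k u ≟ k r₁ | k v ≟ k r₁
      ... | yes ku≡c | _        = inj₁ ku≡c
      ... | no _     | yes kv≡c = inj₂ kv≡c
      ... | no ku≢c  | no kv≢c  = ⊥-elim (no₃ {i , j} {u , r₁} {v , r₂}
        ((i≢u , ≢-sym r₁≢i) , (j≢u , ≢-sym r₁≢j))
        ((i≢v , ≢-sym r₂≢i) , (j≢v , ≢-sym r₂≢j))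
        (((λ { refl → ku≢kv refl }) , ≢-sym r₂≢u) , (r₁≢v , r₁≢r₂))
        ki≢kj ku≢c (λ kv≡kr₂ → kv≢c (≡.trans kv≡kr₂ kr₂≡kr₁)))

  -- Away from two disjoint unequal pairs k is constant.  If both members of
  -- one of these pairs were exceptional, pairing them with ordinary
  -- coordinates would produce a third disjoint unequal pair.
  constantOffTwo : 6 ℕ.≤ n → NoUnequalMatching →
                   ∃[ p ] ∃[ q ] ∃[ c ] p ≢ q × (∀ i → i ≢ p → i ≢ q → k i ≡ c)
  constantOffTwo 6≤n no₃ with unequalPair []
  ... | inj₂ const
    with p , _      ← fresh []       (ℕ.≤-trans (s≤s z≤n) 6≤n)
    with q , q≢p ∷ [] ← fresh (p ∷ []) (ℕ.≤-trans (s≤s (s≤s z≤n)) 6≤n)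
    = p , q , k p , ≢-sym q≢p , λ i _ _ → const [] []
  ... | inj₁ (i₁ , j₁ , _ , _ , ki₁≢kj₁) with unequalPair (i₁ ∷ j₁ ∷ [])
  ...   | inj₂ const
    with r , r∉ ← fresh (i₁ ∷ j₁ ∷ []) (ℕ.≤-trans (s≤s (s≤s (s≤s z≤n))) 6≤n)
    = i₁ , j₁ , k r , (λ { refl → ki₁≢kj₁ refl }) ,
      λ i i≢i₁ i≢j₁ → const (i≢i₁ ∷ i≢j₁ ∷ []) r∉
  ...   | inj₁ (i₂ , j₂ , i₂≢i₁ ∷ i₂≢j₁ ∷ [] , j₂≢i₁ ∷ j₂≢j₁ ∷ [] , ki₂≢kj₂)
    with unequalPair (i₁ ∷ j₁ ∷ i₂ ∷ j₂ ∷ [])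
  ...     | inj₁ (i₃ , j₃ , i₃≢i₁ ∷ i₃≢j₁ ∷ i₃≢i₂ ∷ i₃≢j₂ ∷ [] ,
                            j₃≢i₁ ∷ j₃≢j₁ ∷ j₃≢i₂ ∷ j₃≢j₂ ∷ [] , ki₃≢kj₃) =
    ⊥-elim (no₃ ((i₃≢i₂ , i₃≢j₂) , (j₃≢i₂ , j₃≢j₂)) ((i₃≢i₁ , i₃≢j₁) , (j₃≢i₁ , j₃≢j₁))
                ((i₂≢i₁ , i₂≢j₁) , (j₂≢i₁ , j₂≢j₁)) ki₃≢kj₃ ki₂≢kj₂ ki₁≢kj₁)
  ...     | inj₂ const
    with r₁ , r₁∉@(r₁≢i₁ ∷ r₁≢j₁ ∷ r₁≢i₂ ∷ r₁≢j₂ ∷ []) ←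
           fresh (i₁ ∷ j₁ ∷ i₂ ∷ j₂ ∷ []) (ℕ.≤-trans (s≤s (s≤s (s≤s (s≤s (s≤s z≤n))))) 6≤n)
    with r₂ , r₂≢r₁ ∷ r₂∉@(r₂≢i₁ ∷ r₂≢j₁ ∷ r₂≢i₂ ∷ r₂≢j₂ ∷ []) ←
           fresh (r₁ ∷ i₁ ∷ j₁ ∷ i₂ ∷ j₂ ∷ []) 6≤n
    = conclude
        (ordinary no₃ (≢-sym r₂≢r₁) (const r₂∉ r₁∉) ((i₂≢i₁ , i₂≢j₁) , (j₂≢i₁ , j₂≢j₁))
          (r₁≢i₂ ∷ r₁≢j₂ ∷ r₁≢i₁ ∷ r₁≢j₁ ∷ []) (r₂≢i₂ ∷ r₂≢j₂ ∷ r₂≢i₁ ∷ r₂≢j₁ ∷ []) ki₂≢kj₂ ki₁≢kj₁)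
        (ordinary no₃ (≢-sym r₂≢r₁) (const r₂∉ r₁∉)
          ((≢-sym i₂≢i₁ , ≢-sym j₂≢i₁) , (≢-sym i₂≢j₁ , ≢-sym j₂≢j₁)) r₁∉ r₂∉ ki₁≢kj₁ ki₂≢kj₂)
    where
    Off : Fin n → Fin n → Set
    Off p q = ∀ i → i ≢ p → i ≢ q → k i ≡ k r₁

    off : ∀ {p q u v} → k u ≡ k r₁ → k v ≡ k r₁ →
          (∀ {i} → i ≢ p → i ≢ q → i ≢ u → i ≢ v → All (i ≢_) (i₁ ∷ j₁ ∷ i₂ ∷ j₂ ∷ [])) → Off p q
    off {u = u} {v} ku≡c kv≡c avoid i i≢p i≢q with i ≟ᶠ u | i ≟ᶠ v
    ... | yes refl | _        = ku≡c
    ... | no _     | yes refl = kv≡c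
    ... | no i≢u   | no i≢v   = const (avoid i≢p i≢q i≢u i≢v) r₁∉

    conclude : k i₁ ≡ k r₁ ⊎ k j₁ ≡ k r₁ → k i₂ ≡ k r₁ ⊎ k j₂ ≡ k r₁ →
               ∃[ p ] ∃[ q ] ∃[ c ] p ≢ q × (∀ i → i ≢ p → i ≢ q → k i ≡ c)
    conclude (inj₁ ki₁) (inj₁ ki₂) =
      j₁ , j₂ , _ , ≢-sym j₂≢j₁ , off ki₁ ki₂ (λ j₁ j₂ i₁ i₂ → i₁ ∷ j₁ ∷ i₂ ∷ j₂ ∷ [])
    conclude (inj₁ ki₁) (inj₂ kj₂) =
      j₁ , i₂ , _ , ≢-sym i₂≢j₁ , off ki₁ kj₂ (λ j₁ i₂ i₁ j₂ → i₁ ∷ j₁ ∷ i₂ ∷ j₂ ∷ [])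
    conclude (inj₂ kj₁) (inj₁ ki₂) =
      i₁ , j₂ , _ , ≢-sym j₂≢i₁ , off kj₁ ki₂ (λ i₁ j₂ j₁ i₂ → i₁ ∷ j₁ ∷ i₂ ∷ j₂ ∷ [])
    conclude (inj₂ kj₁) (inj₂ kj₂) =
      i₁ , i₂ , _ , ≢-sym i₂≢i₁ , off kj₁ kj₂ (λ i₁ i₂ j₁ j₂ → i₁ ∷ j₁ ∷ i₂ ∷ j₂ ∷ [])

-- Triple sums of integer vectors

Distinct₃ : ∀ {n} → Fin n → Fin n → Fin n → Set
Distinct₃ i j l = i ≢ j × i ≢ l × j ≢ l

sum₃ : ∀ {n} → (Fin n → ℤ) → Fin n → Fin n → Fin n → ℤ
sum₃ k i j l = k i ℤ.+ k j ℤ.+ k l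

private
  -- Over the integers each strict inequality is worth a full unit, so three of them open a gap of
  -- 3, one more than two triple sums may differ by.
  gap : ∀ {x₁ y₁ x₂ y₂ x₃ y₃} → x₁ ℤ.< y₁ → x₂ ℤ.< y₂ → x₃ ℤ.< y₃ →
        x₁ ℤ.+ x₂ ℤ.+ x₃ ℤ.+ + 2 ℤ.< y₁ ℤ.+ y₂ ℤ.+ y₃
  gap {x₁} {x₂ = x₂} {x₃ = x₃} x₁<y₁ x₂<y₂ x₃<y₃ = ℤ.suc[i]≤j⇒i<j
    (subst (ℤ._≤ _) (solve 3 (λ a b c → (con (+ 1) :+ a) :+ (con (+ 1) :+ b) :+ (con (+ 1) :+ c)
                                   := con (+ 1) :+ (a :+ b :+ c :+ con (+ 2))) refl x₁ x₂ x₃)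
      (ℤ.+-mono-≤ (ℤ.+-mono-≤ (ℤ.i<j⇒suc[i]≤j x₁<y₁) (ℤ.i<j⇒suc[i]≤j x₂<y₂)) (ℤ.i<j⇒suc[i]≤j x₃<y₃)))
    where
    open +-*-Solver

  module _ {n} (k : Fin n → ℤ) where
    Oriented : Fin n × Fin n → Fin n → Fin n → Set
    Oriented (i , j) lo hi = (lo ≡ i × hi ≡ j) ⊎ (lo ≡ j × hi ≡ i)

    oriented : ∀ p → Unequal ℤ._≟_ k p → ∃[ lo ] ∃[ hi ] k lo ℤ.< k hi × Oriented p lo hi
    oriented (i , j) ki≢kj with ℤ.<-cmp (k i) (k j)
    ... | tri< ki<kj _ _ = i , j , ki<kj , inj₁ (refl , refl)
    ... | tri≈ _ ki≡kj _ = contradiction ki≡kj ki≢kj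
    ... | tri> _ _ kj<ki = j , i , kj<ki , inj₂ (refl , refl)

    apart : ∀ {p q lo hi lo′ hi′} → Oriented p lo hi → Oriented q lo′ hi′ →
            Apart p q → lo ≢ lo′ × hi ≢ hi′
    apart (inj₁ (refl , refl)) (inj₁ (refl , refl)) ((iu , _) , (_ , jv)) = iu , jv
    apart (inj₁ (refl , refl)) (inj₂ (refl , refl)) ((_ , iv) , (ju , _)) = iv , ju
    apart (inj₂ (refl , refl)) (inj₁ (refl , refl)) ((_ , iv) , (ju , _)) = ju , iv
    apart (inj₂ (refl , refl)) (inj₂ (refl , refl)) ((iu , _) , (_ , jv)) = jv , iu

-- Orienting three disjoint unequal pairs gives two triples whose sums differ by at least 3.
noUnequalMatching : ∀ {n} (k : Fin n → ℤ) →
  (∀ {i j l i′ j′ l′} → Distinct₃ i j l → Distinct₃ i′ j′ l′ →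
     sum₃ k i′ j′ l′ ℤ.≤ sum₃ k i j l ℤ.+ + 2) →
  NoUnequalMatching ℤ._≟_ k
noUnequalMatching {n} k window {a} {b} {c} ab ac bc a≢ b≢ c≢
  with lo₁ , hi₁ , lo₁<hi₁ , in₁ ← oriented k a a≢
     | lo₂ , hi₂ , lo₂<hi₂ , in₂ ← oriented k b b≢
     | lo₃ , hi₃ , lo₃<hi₃ , in₃ ← oriented k c c≢
  = ℤ.<⇒≱ (gap lo₁<hi₁ lo₂<hi₂ lo₃<hi₃) (window
      (apart k in₁ in₂ ab .proj₁ , apart k in₁ in₃ ac .proj₁ , apart k in₂ in₃ bc .proj₁)
      (apart k in₁ in₂ ab .proj₂ , apart k in₁ in₃ ac .proj₂ , apart k in₂ in₃ bc .proj₂))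

-- If x is at an allowed distance from J̃(n,3), then 2(xᵢ + xⱼ + xₗ) = |x|² + c with c an offset.
-- For x = a + α e_p + β e_q with K = α + β and Q = α² + β², a triple sum 3a + s and n a + K = 3
-- give, after eliminating a, (3 - K)² = n (Q - 2s + c); here s runs over 0, α, β and α + β.
offsets : List ℤ
offsets = + 1 ∷ -[1+ 0 ] ∷ -[1+ 2 ] ∷ []

-- The halves (c - c′)/2 for two offsets c and c′: the possible differences of two triple sums, and
-- hence of two coordinates.
steps : List ℤ
steps = -[1+ 1 ] ∷ -[1+ 0 ] ∷ + 0 ∷ + 1 ∷ + 2 ∷ []

squareGap : ℤ → ℤ → ℤ
squareGap α β = (+ 3 ℤ.- (α ℤ.+ β)) ℤ.* (+ 3 ℤ.- (α ℤ.+ β))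

cofactor : ℤ → ℤ → ℤ → ℤ → ℤ
cofactor α β s c = α ℤ.* α ℤ.+ β ℤ.* β ℤ.- + 2 ℤ.* s ℤ.+ c

Balanced : ℕ → ℤ → ℤ → ℤ → Set
Balanced n α β s = Any (λ c → squareGap α β ≡ + n ℤ.* cofactor α β s c) offsets

AllBalanced : ℕ → ℤ → ℤ → Set
AllBalanced n α β = All (Balanced n α β) (0ℤ ∷ α ∷ β ∷ α ℤ.+ β ∷ [])

-- The solutions (n, α, β). Those with α ≢ β come in both orders because p and q are not ordered.
data Shape : ℕ → ℤ → ℤ → Set where
  lowered₁ : Shape 8 -1ℤ 0ℤ
  lowered₂ : Shape 8 0ℤ -1ℤ
  centre   : Shape 9 0ℤ 0ℤ
  raised₁  : Shape 9 1ℤ -1ℤ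
  raised₂  : Shape 9 -1ℤ 1ℤ

private
  shapes : List (ℕ × ℤ × ℤ)
  shapes = (8 , -1ℤ , 0ℤ) ∷ (8 , 0ℤ , -1ℤ) ∷ (9 , 0ℤ , 0ℤ) ∷ (9 , 1ℤ , -1ℤ) ∷ (9 , -1ℤ , 1ℤ) ∷ []

  _≟³_ : (x y : ℕ × ℤ × ℤ) → Dec (x ≡ y)
  (n , α , β) ≟³ (n′ , α′ , β′) =
    map′ (λ { (refl , refl , refl) → refl }) (λ { refl → refl , refl , refl })
         (n ℕ.≟ n′ ×-dec α ℤ.≟ α′ ×-dec β ℤ.≟ β′)

  toShape : ∀ {n α β} → (n , α , β) List.∈ shapes → Shape n α β
  toShape (here refl)                                 = lowered₁
  toShape (there (here refl))                         = lowered₂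
  toShape (there (there (here refl)))                 = centre
  toShape (there (there (there (here refl))))         = raised₁
  toShape (there (there (there (there (here refl))))) = raised₂

  allBalanced? : ∀ n α β → Dec (AllBalanced n α β)
  allBalanced? n α β = All.all? (λ s → Any.any? (λ c → squareGap α β ℤ.≟ + n ℤ.* cofactor α β s c) offsets)
                            (0ℤ ∷ α ∷ β ∷ α ℤ.+ β ∷ [])

  -- n divides (3 - K)² ≤ 49, so only finitely many n matter unless K = 3; then the equation
  -- does not depend on n and fails already for n = 6.
  SmallShape : ℤ → ℤ → Set
  SmallShape α β = squareGap α β ≡ 0ℤ × ¬ AllBalanced 6 α β ⊎
    squareGap α β ≢ 0ℤ × ∣ squareGap α β ∣ ℕ.< 50 ×
      (∀ (n : Fin 50) → 6 ℕ.≤ toℕ n → AllBalanced (toℕ n) α β → (toℕ n , α , β) List.∈ shapes)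

  smallShape? : ∀ α β → Dec (SmallShape α β)
  smallShape? α β =
    squareGap α β ℤ.≟ 0ℤ ×-dec ¬? (allBalanced? 6 α β) ⊎-dec
    ¬? (squareGap α β ℤ.≟ 0ℤ) ×-dec ∣ squareGap α β ∣ ℕ.<? 50 ×-dec
      Fin.all? (λ n → (6 ℕ.≤? toℕ n) →-dec (allBalanced? (toℕ n) α β →-dec Any.any? ((toℕ n , α , β) ≟³_) shapes))

  abstract
    smallShapes : All (λ α → All (SmallShape α) steps) steps
    smallShapes = from-yes (All.all? (λ α → All.all? (smallShape? α) steps) steps)

factor≤ : ∀ {i n m} → i ≡ + n ℤ.* m → i ≢ 0ℤ → n ℕ.≤ ∣ i ∣
factor≤ {i} {n} {m} refl i≢0 = subst (n ℕ.≤_) (≡.sym (ℤ.∣i*j∣≡∣i∣*∣j∣ (+ n) m)) (ℕ.m≤m*n n ∣ m ∣)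
  where
  instance
    m≢0 : ℕ.NonZero ∣ m ∣
    m≢0 = ℕ.≢-nonZero (λ ∣m∣≡0 → i≢0 (≡.trans (cong (+ n ℤ.*_) (ℤ.∣i∣≡0⇒i≡0 ∣m∣≡0)) (ℤ.*-zeroʳ (+ n))))

shape : ∀ {n α β} → 6 ℕ.≤ n → α List.∈ steps → β List.∈ steps → AllBalanced n α β → Shape n α β
shape {suc n} {α} {β} 6≤n α∈ β∈ balanced with All.lookup (All.lookup smallShapes α∈) β∈
... | inj₁ (gap≡0 , unbalanced) = ⊥-elim (unbalanced (All.map (Any.map anySize) balanced))
  where
  -- The left side is 0, which forces the cofactor to be 0 for every positive n; the equation then
  -- holds for 6 as well.
  anySize : ∀ {m} → squareGap α β ≡ + suc n ℤ.* m → squareGap α β ≡ + 6 ℤ.* m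
  anySize {m} eq with ℤ.i*j≡0⇒i≡0∨j≡0 (+ suc n) (≡.trans (≡.sym eq) gap≡0)
  ... | inj₂ refl = ≡.trans gap≡0 refl
... | inj₂ (gap≢0 , gap<50 , check) =
  toShape (subst (λ k → (k , α , β) List.∈ shapes) n≡ (check (fromℕ< n<50)
    (subst (6 ℕ.≤_) (≡.sym n≡) 6≤n) (subst (λ k → AllBalanced k α β) (≡.sym n≡) balanced)))
  where
  size≤gap : Balanced (suc n) α β 0ℤ → suc n ℕ.≤ ∣ squareGap α β ∣
  size≤gap p with _ , eq ← Any.satisfied p = factor≤ {n = suc n} {m = cofactor α β 0ℤ _} eq gap≢0
  n<50 : suc n ℕ.< 50
  n<50 = ℕ.≤-<-trans (size≤gap (All.head balanced)) gap<50
  n≡ : toℕ (fromℕ< n<50) ≡ suc n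
  n≡ = toℕ-fromℕ< n<50

-- Integers in an ordered field

module IntegerEmbedding (R : CompleteOrderedField) where
  open CompleteOrderedField R hiding (zero; refl; sym; trans)
  open Euclidean R using (fromℕ; 0<fromℕ)
  private module R = CommutativeRing commutativeRing
  open RingProperties R.ring using (-‿distribˡ-*; -‿distribʳ-*; -‿involutive; -0#≈0#; -‿+-comm)
  open SemiringMult R.semiring using (×1-homo-*; ×-homo-+)
  open ≈-Reasoning R.setoid
  open IsStrictPartialOrder isStrictPartialOrder using () renaming (irrefl to <-irrefl)

  ι : ℤ → Carrier
  ι (+ n)    = fromℕ n
  ι -[1+ n ] = - fromℕ (suc n)

  ι-⊖ : ∀ m n → ι (m ℤ.⊖ n) ≈ fromℕ m - fromℕ n
  ι-⊖ m zero = R.sym (R.trans (R.+-congˡ -0#≈0#) (R.+-identityʳ _))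
  ι-⊖ zero (suc n) = R.sym (R.+-identityˡ _)
  ι-⊖ (suc m) (suc n) = begin
    ι (suc m ℤ.⊖ suc n)                    ≡⟨ ≡.cong ι (ℤ.[1+m]⊖[1+n]≡m⊖n m n) ⟩
    ι (m ℤ.⊖ n)                            ≈⟨ ι-⊖ m n ⟩
    fromℕ m - fromℕ n                      ≈⟨ R.+-congʳ (R.+-identityʳ _) ⟨
    fromℕ m + 0# - fromℕ n                 ≈⟨ R.+-congʳ (R.+-congˡ (R.-‿inverseʳ 1#)) ⟨
    fromℕ m + (1# - 1#) - fromℕ n          ≈⟨ R.+-congʳ (R.+-assoc _ _ _) ⟨
    (fromℕ m + 1#) - 1# - fromℕ n          ≈⟨ R.+-assoc _ _ _ ⟩
    (fromℕ m + 1#) + (- 1# - fromℕ n)      ≈⟨ R.+-cong (R.+-comm _ _) (-‿+-comm 1# (fromℕ n)) ⟩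
    fromℕ (suc m) - fromℕ (suc n)          ∎

  ι-+ : ∀ i j → ι (i ℤ.+ j) ≈ ι i + ι j
  ι-+ (+ m)    (+ n)    = ×-homo-+ 1# m n
  ι-+ (+ m)    -[1+ n ] = ι-⊖ m (suc n)
  ι-+ -[1+ m ] (+ n)    = R.trans (ι-⊖ n (suc m)) (R.+-comm _ _)
  ι-+ -[1+ m ] -[1+ n ] = begin
    - fromℕ (suc (suc (m ℕ.+ n)))       ≡⟨ ≡.cong (λ k → - fromℕ (suc k)) (ℕ.+-suc m n) ⟨
    - fromℕ (suc m ℕ.+ suc n)           ≈⟨ R.-‿cong (×-homo-+ 1# (suc m) (suc n)) ⟩
    - (fromℕ (suc m) + fromℕ (suc n))   ≈⟨ -‿+-comm _ _ ⟨
    - fromℕ (suc m) - fromℕ (suc n)     ∎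

  ι-neg : ∀ i → ι (ℤ.- i) ≈ - ι i
  ι-neg (+ zero)    = R.sym -0#≈0#
  ι-neg (+ (suc n)) = R.refl
  ι-neg -[1+ n ]    = R.sym (-‿involutive _)

  ι-*-nonneg : ∀ m n → ι (+ m ℤ.* + n) ≈ ι (+ m) * ι (+ n)
  ι-*-nonneg m n = R.trans (R.reflexive (≡.cong ι (≡.sym (ℤ.pos-* m n)))) (×1-homo-* m n)

  ι-*-pos : ∀ m j → ι (+ m ℤ.* j) ≈ ι (+ m) * ι j
  ι-*-pos m (+ n)    = ι-*-nonneg m n
  ι-*-pos m -[1+ n ] = begin
    ι (+ m ℤ.* -[1+ n ])         ≡⟨ ≡.cong ι (ℤ.neg-distribʳ-* (+ m) (+ suc n)) ⟨
    ι (ℤ.- (+ m ℤ.* + suc n))    ≈⟨ ι-neg (+ m ℤ.* + suc n) ⟩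
    - ι (+ m ℤ.* + suc n)        ≈⟨ R.-‿cong (ι-*-nonneg m (suc n)) ⟩
    - (ι (+ m) * ι (+ suc n))    ≈⟨ -‿distribʳ-* _ _ ⟩
    ι (+ m) * ι -[1+ n ]         ∎

  ι-* : ∀ i j → ι (i ℤ.* j) ≈ ι i * ι j
  ι-* (+ m)    j = ι-*-pos m j
  ι-* -[1+ m ] j = begin
    ι (-[1+ m ] ℤ.* j)           ≡⟨ ≡.cong ι (ℤ.neg-distribˡ-* (+ suc m) j) ⟨
    ι (ℤ.- (+ suc m ℤ.* j))      ≈⟨ ι-neg (+ suc m ℤ.* j) ⟩
    - ι (+ suc m ℤ.* j)          ≈⟨ R.-‿cong (ι-*-pos (suc m) j) ⟩
    - (ι (+ suc m) * ι j)        ≈⟨ -‿distribˡ-* _ _ ⟩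
    ι -[1+ m ] * ι j             ∎

  1≈ι1 : 1# ≈ ι 1ℤ
  1≈ι1 = R.sym (R.+-identityʳ 1#)

  -- An ordered field has characteristic zero. This is the way back from field equations to integer
  -- equations, which can be decided.
  ι-zero : ∀ i → ι i ≈ 0# → i ≡ 0ℤ
  ι-zero (+ zero)    _    = ≡.refl
  ι-zero (+ (suc n)) eq   = ⊥-elim (<-irrefl (R.sym eq) (0<fromℕ n))
  ι-zero -[1+ n ]    eq   = ⊥-elim (<-irrefl (R.sym (begin
    fromℕ (suc n)      ≈⟨ -‿involutive _ ⟨
    - - fromℕ (suc n)  ≈⟨ R.-‿cong eq ⟩
    - 0#               ≈⟨ -0#≈0# ⟩
    0#                 ∎)) (0<fromℕ n))

  ι-injective : ∀ {i j} → ι i ≈ ι j → i ≡ j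
  ι-injective {i} {j} eq = ℤ.i-j≡0⇒i≡j i j (ι-zero (i ℤ.- j) (begin
    ι (i ℤ.- j)        ≈⟨ ι-+ i (ℤ.- j) ⟩
    ι i + ι (ℤ.- j)    ≈⟨ R.+-cong eq (ι-neg j) ⟩
    ι j - ι j          ≈⟨ R.-‿inverseʳ (ι j) ⟩
    0#                 ∎))

  private
    ℤ-rawRing : RawRing _ _
    ℤ-rawRing = record
      { Carrier = ℤ ; _≈_ = _≡_ ; _+_ = ℤ._+_ ; _*_ = ℤ._*_ ; -_ = ℤ.-_ ; 0# = 0ℤ ; 1# = 1ℤ }

    -- Equality in the field cannot be decided, so the normal forms of the solver take their
    -- coefficients in ℤ.
    ι-homomorphism : ℤ-rawRing -Raw-AlmostCommutative⟶ fromCommutativeRing commutativeRing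
    ι-homomorphism = record
      { ⟦_⟧ = ι ; +-homo = ι-+ ; *-homo = ι-* ; -‿homo = ι-neg ; 0-homo = R.refl ; 1-homo = R.sym 1≈ι1 }

    ι≟ : ∀ i j → Maybe (ι i ≈ ι j)
    ι≟ i j = Maybe.map (λ i≡j → R.reflexive (≡.cong ι i≡j)) (dec⇒maybe (i ℤ.≟ j))

  open RingSolver ℤ-rawRing (fromCommutativeRing commutativeRing) ι-homomorphism ι≟ public
    using (solve; _:=_; con; _:+_; _:*_; _:-_; :-_)

  zero-difference : ∀ {x y} → x - y ≈ 0# → x ≈ y
  zero-difference {x} {y} eq = begin
    x          ≈⟨ solve 2 (λ x y → x := (x :- y) :+ y) R.refl x y ⟩
    x - y + y  ≈⟨ R.+-congʳ eq ⟩
    0# + y     ≈⟨ R.+-identityˡ y ⟩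
    y          ∎

  difference-zero : ∀ {x y} → x ≈ y → x - y ≈ 0#
  difference-zero {x} {y} eq = R.trans (R.+-congʳ eq) (R.-‿inverseʳ y)

  -- The solver proves identities only. A consequence of a hypothesis `z ≈ 0` is reached through a
  -- certificate: a multiplier `c` that makes `x - y ≈ c * z` an identity.
  linear : ∀ {x y z} c → z ≈ 0# → x - y ≈ c * z → x ≈ y
  linear c z≈0 eq = zero-difference (R.trans eq (R.trans (R.*-congˡ z≈0) (R.zeroʳ c)))

  linear₂ : ∀ {x y z z′} c c′ → z ≈ 0# → z′ ≈ 0# → x - y ≈ c * z + c′ * z′ → x ≈ y
  linear₂ c c′ z≈0 z′≈0 eq = zero-difference (R.trans eq (R.trans
    (R.+-cong (R.trans (R.*-congˡ z≈0) (R.zeroʳ c)) (R.trans (R.*-congˡ z′≈0) (R.zeroʳ c′))) (R.+-identityˡ 0#)))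

  ι-− : ∀ i j → ι (i ℤ.- j) ≈ ι i - ι j
  ι-− i j = R.trans (ι-+ i (ℤ.- j)) (R.+-congˡ (ι-neg j))

-- Order and square roots

module SquareRoots (R : CompleteOrderedField) where
  open CompleteOrderedField R hiding (zero; refl; sym; trans)
  open Euclidean R using (0<1)
  open IntegerEmbedding R
  private module R = CommutativeRing commutativeRing
  open IsStrictPartialOrder isStrictPartialOrder
    using (<-resp-≈) renaming (irrefl to <-irrefl; trans to <-trans)

  abstract
    -- Inherited from the cotransitivity of `_#_`: when `z` lies on the outer side of one endpoint,
    -- transitivity with `x < y` puts it on the inner side of the other. It stands in for
    -- trichotomy.
    <-cotrans : ∀ {x y} → x < y → ∀ z → x < z ⊎ z < y
    <-cotrans x<y z with #-cotrans (<⇒# x<y) z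
    ... | inj₁ x#z with #⇒<⊎> x#z
    ...   | inj₁ x<z = inj₁ x<z
    ...   | inj₂ z<x = inj₂ (<-trans z<x x<y)
    <-cotrans x<y z | inj₂ z#y with #⇒<⊎> z#y
    ...   | inj₁ z<y = inj₂ z<y
    ...   | inj₂ y<z = inj₁ (<-trans x<y y<z)

  <-resp : ∀ {x x′ y y′} → x ≈ x′ → y ≈ y′ → x < y → x′ < y′
  <-resp x≈x′ y≈y′ x<y = proj₁ <-resp-≈ y≈y′ (proj₂ <-resp-≈ x≈x′ x<y)

  positive-difference : ∀ {x y} → x < y → 0# < y - x
  positive-difference {x} x<y = proj₂ <-resp-≈ (R.-‿inverseʳ x) (+-monoˡ-< (- x) x<y)

  <-from-positive : ∀ {x y z} → 0# < z → z ≈ y - x → x < y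
  <-from-positive {x} {y} {z} 0<z eq = <-resp (R.+-identityˡ x)
    (R.trans (R.+-congʳ eq) (solve 2 (λ x y → y :- x :+ x := y) R.refl x y)) (+-monoˡ-< x 0<z)

  nonneg+pos : ∀ {x y} → 0# ≤ x → 0# < y → 0# < x + y
  nonneg+pos {x} {y} 0≤x 0<y with <-cotrans (<-resp (R.+-identityˡ x) (R.+-comm y x) (+-monoˡ-< x 0<y)) 0#
  ... | inj₁ x<0 = ⊥-elim (0≤x x<0)
  ... | inj₂ 0<x+y = 0<x+y

  pos+pos : ∀ {x y} → 0# < x → 0# < y → 0# < x + y
  pos+pos 0<x = nonneg+pos (λ x<0 → <-irrefl R.refl (<-trans x<0 0<x))

  negated : ∀ {x} → x < 0# → 0# < - x
  negated {x} x<0 = <-resp R.refl (R.+-identityˡ (- x)) (positive-difference x<0)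

  nonneg+nonneg : ∀ {x y} → 0# ≤ x → 0# ≤ y → 0# ≤ x + y
  nonneg+nonneg {x} {y} 0≤x 0≤y x+y<0 with <-cotrans x+y<0 y
  ... | inj₁ x+y<y = 0≤x (<-from-positive (positive-difference x+y<y)
                       (solve 2 (λ x y → y :- (x :+ y) := con 0ℤ :- x) R.refl x y))
  ... | inj₂ y<0 = 0≤y y<0

  neither-sign⇒≈0 : ∀ {x} → ¬ (x < 0#) → ¬ (0# < x) → x ≈ 0#
  neither-sign⇒≈0 x≮0 0≮x = proj₁ (tight _ _) (λ x#0 → [ x≮0 , 0≮x ]′ (#⇒<⊎> x#0))

  nonneg*nonneg : ∀ {x y} → 0# ≤ x → 0# ≤ y → 0# ≤ x * y
  nonneg*nonneg {x} {y} 0≤x 0≤y xy<0 = <-irrefl (R.trans (R.*-congʳ x≈0) (R.zeroˡ y)) xy<0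
    where
    x≈0 : x ≈ 0#
    x≈0 = neither-sign⇒≈0 0≤x λ 0<x →
      <-irrefl (R.trans (R.*-congˡ (neither-sign⇒≈0 0≤y λ 0<y →
        <-irrefl R.refl (<-trans xy<0 (*-pos 0<x 0<y)))) (R.zeroʳ x)) xy<0

  square-pos : ∀ {x} → x # 0# → 0# < x * x
  square-pos {x} x#0 with #⇒<⊎> x#0
  ... | inj₂ 0<x = *-pos 0<x 0<x
  ... | inj₁ x<0 = <-resp R.refl (solve 1 (λ x → (:- x) :* (:- x) := x :* x) R.refl x)
                     (*-pos (negated x<0) (negated x<0))

  square-nonneg : ∀ x → 0# ≤ x * x
  square-nonneg x x²<0 = <-irrefl (R.trans (R.*-congʳ x≈0) (R.zeroˡ x)) x²<0
    where
    x≈0 : x ≈ 0#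
    x≈0 = proj₁ (tight _ _) (λ x#0 → <-irrefl R.refl (<-trans x²<0 (square-pos x#0)))

  square≈0 : ∀ {x} → x * x ≈ 0# → x ≈ 0#
  square≈0 x²≈0 = proj₁ (tight _ _) (λ x#0 → <-irrefl (R.sym x²≈0) (square-pos x#0))

  square-mono-< : ∀ {x y} → 0# ≤ x → x < y → x * x < y * y
  square-mono-< {x} {y} 0≤x x<y with <-cotrans x<y 0#
  ... | inj₁ x<0 = ⊥-elim (0≤x x<0)
  ... | inj₂ 0<y = <-from-positive (*-pos (positive-difference x<y) (nonneg+pos 0≤x 0<y))
                     (solve 2 (λ x y → (y :- x) :* (x :+ y) := y :* y :- x :* x) R.refl x y)

  square-injective : ∀ {x y} → 0# ≤ x → 0# ≤ y → x * x ≈ y * y → x ≈ y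
  square-injective 0≤x 0≤y x²≈y² = proj₁ (tight _ _) λ x#y → [
    (λ x<y → <-irrefl x²≈y² (square-mono-< 0≤x x<y)) ,
    (λ y<x → <-irrefl (R.sym x²≈y²) (square-mono-< 0≤y y<x)) ]′ (#⇒<⊎> x#y)

  abstract
    pos-inverse : ∀ {x} → 0# < x → ∃[ y ] 0# < y × x * y ≈ 1#
    pos-inverse {x} 0<x with y , yx≈1 , xy≈1 ← #⇒invertible (#-sym (<⇒# 0<x)) = y , 0<y , xy≈1′
      where
      x-0≈x : ∀ x → x - 0# ≈ x
      x-0≈x = HeytingProperties.x-0≈x heytingCommutativeRing
      xy≈1′ : x * y ≈ 1#
      xy≈1′ = R.trans (R.*-congʳ (R.sym (x-0≈x x))) xy≈1
      y#0 : y # 0#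
      y#0 = HeytingProperties.invertibleʳ⇒# heytingCommutativeRing
              (x , R.trans (R.*-congʳ (x-0≈x y)) (R.trans (R.*-comm y x) xy≈1′))
      0<y : 0# < y
      0<y with #⇒<⊎> y#0
      ... | inj₂ 0<y = 0<y
      -- A negative inverse makes x * (- y) = -1 positive, whence 1 < 0.
      ... | inj₁ y<0 = ⊥-elim (<-irrefl R.refl (<-trans 0<1
        (<-from-positive (*-pos 0<x (negated y<0))
          (linear (- 1#) (difference-zero xy≈1′)
            (R.trans (R.+-congˡ (R.-‿cong (R.+-congˡ (R.-‿cong 1≈ι1))))
            (R.trans (solve 2 (λ x y → x :* (:- y) :- (con 0ℤ :- con 1ℤ) := (:- con 1ℤ) :* (x :* y :- con 1ℤ)) R.refl x y)
              (R.sym (R.*-cong (R.-‿cong 1≈ι1) (R.+-congˡ (R.-‿cong 1≈ι1))))))))))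

  private
    abstract
      0<ι1 : 0# < ι 1ℤ
      0<ι1 = <-resp R.refl 1≈ι1 0<1

      -1<0 : ι -1ℤ < 0#
      -1<0 = <-from-positive 0<ι1 (solve 0 (con 1ℤ := con 0ℤ :- con -1ℤ) R.refl)

      dense : ∀ {x y} → x < y → ∃[ z ] x < z × z < y
      dense {x} {y} x<y with h , 0<h , 2h≈1 ← pos-inverse (pos+pos 0<ι1 0<ι1) =
        (x + y) * h
        , <-from-positive (*-pos (positive-difference x<y) 0<h)
            (linear (- x) (difference-zero (R.trans 2h≈1 1≈ι1))
              (solve 3 (λ x y h → (y :- x) :* h :- ((x :+ y) :* h :- x) :=
                 (:- x) :* ((con 1ℤ :+ con 1ℤ) :* h :- con 1ℤ)) R.refl x y h))
        , <-from-positive (*-pos (positive-difference x<y) 0<h)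
            (linear y (difference-zero (R.trans 2h≈1 1≈ι1))
              (solve 3 (λ x y h → (y :- x) :* h :- (y :- (x :+ y) :* h) :=
                 y :* ((con 1ℤ :+ con 1ℤ) :* h :- con 1ℤ)) R.refl x y h))

    <-asym : ∀ {x y} → x < y → ¬ (y < x)
    <-asym x<y y<x = <-irrefl R.refl (<-trans x<y y<x)

    0<1+ : ∀ {a} → 0# ≤ a → 0# < a + ι 1ℤ
    0<1+ 0≤a = nonneg+pos 0≤a 0<ι1

    a<[1+a]² : ∀ {a} → 0# ≤ a → a < (a + ι 1ℤ) * (a + ι 1ℤ)
    a<[1+a]² {a} 0≤a = <-from-positive (nonneg+pos (square-nonneg a) (0<1+ 0≤a))
      (solve 1 (λ a → a :* a :+ (a :+ con 1ℤ) := (a :+ con 1ℤ) :* (a :+ con 1ℤ) :- a) R.refl a)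

    -- The secant step t = (a + s k) / (k + s), where k² > a, lies between s and √a, since
    -- t² - a = (k² - a)(s² - a) / (k + s)²  and  t - s = (a - s²) / (k + s).
    record SecantStep (a s : Carrier) : Set where
      field
        t       : Carrier
        0≤t     : 0# ≤ t
        upwards   : s * s < a → s < t × t * t < a
        downwards : a < s * s → t < s × a < t * t

    module _ (a k s w : Carrier) (1/ : (k + s) * w - ι 1ℤ ≈ 0#) where
      secant-difference : (a - s * s) * w ≈ (a + s * k) * w - s
      secant-difference = linear (- s) 1/
        (solve 4 (λ a k s w → (a :- s :* s) :* w :- ((a :+ s :* k) :* w :- s) :=
           (:- s) :* ((k :+ s) :* w :- con 1ℤ)) R.refl a k s w)

      secant-square : (k * k - a) * (a - s * s) * (w * w) ≈ a - ((a + s * k) * w) * ((a + s * k) * w)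
      secant-square = linear (a * ((k + s) * w + ι 1ℤ)) 1/
        (solve 4 (λ a k s w → (k :* k :- a) :* (a :- s :* s) :* (w :* w) :-
             (a :- ((a :+ s :* k) :* w) :* ((a :+ s :* k) :* w)) :=
             (a :* ((k :+ s) :* w :+ con 1ℤ)) :* ((k :+ s) :* w :- con 1ℤ)) R.refl a k s w)

    negate-difference : ∀ {x y z} → z ≈ x - y → - z ≈ y - x
    negate-difference {x} {y} eq = R.trans (R.-‿cong eq) (solve 2 (λ x y → :- (x :- y) := y :- x) R.refl x y)

    abstract
      secantStep : ∀ {a s} → 0# ≤ a → 0# ≤ s → SecantStep a s
      -- The value k = a + 1 has k² > a uniformly in a, since k² - a = a² + a + 1.
      secantStep {a} {s} 0≤a 0≤s = step (a + ι 1ℤ) (0<1+ 0≤a) (a<[1+a]² 0≤a)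
        where
        step : ∀ k → 0# < k → a < k * k → SecantStep a s
        step k 0<k a<k² with w , 0<w , eq ← pos-inverse (<-resp R.refl (R.+-comm s k) (nonneg+pos 0≤s 0<k)) = record
          { t = (a + s * k) * w
          ; 0≤t = nonneg*nonneg (nonneg+nonneg 0≤a (nonneg*nonneg 0≤s (<-asym 0<k))) (<-asym 0<w)
          ; upwards = λ s²<a →
              <-from-positive (*-pos (positive-difference s²<a) 0<w) (secant-difference a k s w 1/)
            , <-from-positive (*-pos (*-pos (positive-difference a<k²) (positive-difference s²<a)) (*-pos 0<w 0<w))
                              (secant-square a k s w 1/)
          ; downwards = λ a<s² →
              <-from-positive (*-pos (positive-difference a<s²) 0<w)
                (R.trans (solve 3 (λ a s w → (s :* s :- a) :* w := :- ((a :- s :* s) :* w)) R.refl a s w)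
                  (negate-difference (secant-difference a k s w 1/)))
            , <-from-positive (*-pos (*-pos (positive-difference a<k²) (positive-difference a<s²)) (*-pos 0<w 0<w))
                (R.trans (solve 4 (λ a k s w → (k :* k :- a) :* (s :* s :- a) :* (w :* w) :=
                    :- ((k :* k :- a) :* (a :- s :* s) :* (w :* w))) R.refl a k s w)
                  (negate-difference (secant-square a k s w 1/)))
          }
          where
          1/ : (k + s) * w - ι 1ℤ ≈ 0#
          1/ = difference-zero (R.trans eq 1≈ι1)

  module _ {a} (0≤a : 0# ≤ a) where

    private
      -- For a = 0 no square lies below a; the negative numbers keep the set inhabited without
      -- shifting its supremum.
      BelowRoot : Pred Carrier 0ℓ
      BelowRoot x = x < 0# ⊎ x * x < a

      upper : ∀ {b} → 0# ≤ b → a < b * b → UpperBound BelowRoot b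
      upper 0≤b a<b² (inj₁ x<0)  b<x = 0≤b (<-trans b<x x<0)
      upper 0≤b a<b² (inj₂ x²<a) b<x = <-asym (square-mono-< 0≤b b<x) (<-trans x²<a a<b²)

      located : Located BelowRoot
      -- An intermediate point c leaves room for an undecided comparison: from c² < v², either c² <
      -- a and c is a member above u, or a < v² and v is an upper bound.
      located {u} {v} u<v with c , u<c , c<v ← dense u<v with <-cotrans c<v 0#
      ... | inj₁ c<0 = inj₁ (c , inj₁ c<0 , u<c)
      ... | inj₂ 0<v with <-cotrans u<c 0#
      ...   | inj₁ u<0 with w , u<w , w<0 ← dense u<0 = inj₁ (w , inj₁ w<0 , u<w)
      ...   | inj₂ 0<c with <-cotrans (square-mono-< (<-asym 0<c) c<v) a
      ...     | inj₁ c²<a = inj₁ (c , inj₂ c²<a , u<c)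
      ...     | inj₂ a<v² = inj₂ (upper (<-asym 0<v) a<v²)

      module _ {s} (supr : IsSupremum BelowRoot s) where

        0≤sup : 0# ≤ s
        0≤sup s<0 with w , s<w , w<0 ← dense s<0 = proj₁ supr (inj₁ w<0) s<w

        open SecantStep (secantStep 0≤a 0≤sup)

        sup² : s * s ≈ a
        sup² = proj₁ (tight _ _) λ s²#a → [
          -- If s² < a, the secant step from s is a larger member; if a < s², it is a smaller upper
          -- bound.
          (λ s²<a → proj₁ supr (inj₂ (proj₂ (upwards s²<a))) (proj₁ (upwards s²<a))) ,
          (λ a<s² → let y , y∈ , t<y = proj₂ supr (proj₁ (downwards a<s²)) in
                    upper 0≤t (proj₂ (downwards a<s²)) y∈ t<y) ]′ (#⇒<⊎> s²#a)

      root : ∃[ s ] IsSupremum BelowRoot s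
      root = supremum BelowRoot (_ , inj₁ -1<0)
               (a + ι 1ℤ , upper (<-asym (0<1+ 0≤a)) (a<[1+a]² 0≤a)) located

    abstract
      squareRoot : ∃[ s ] 0# ≤ s × s * s ≈ a
      squareRoot = let s , supr = root in s , 0≤sup supr , sup² supr

-- Inner products and distances

δ : ∀ {n} → Fin n → Fin n → ℤ
δ i j = if does (i ≟ᶠ j) then 1ℤ else 0ℤ

δ-refl : ∀ {n} (i : Fin n) → δ i i ≡ 1ℤ
δ-refl i rewrite proj₂ (dec-yes (i ≟ᶠ i) refl) = refl

δ-≢ : ∀ {n} {i j : Fin n} → i ≢ j → δ i j ≡ 0ℤ
δ-≢ {i = i} {j} i≢j rewrite dec-no (i ≟ᶠ j) i≢j = refl

-- For distinct indices this is the characteristic function of {i, j, l}; `Indicator` ties its value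
-- to the reason for it.
δ³ : ∀ {n} → Fin n → Fin n → Fin n → Fin n → ℤ
δ³ i j l t = δ i t ℤ.+ δ j t ℤ.+ δ l t

data Indicator {n} (i j l t : Fin n) : Set where
  inside    : t ≡ i ⊎ t ≡ j ⊎ t ≡ l → δ³ i j l t ≡ 1ℤ → Indicator i j l t
  outside : t ≢ i → t ≢ j → t ≢ l → δ³ i j l t ≡ 0ℤ → Indicator i j l t

indicator : ∀ {n} {i j l : Fin n} → Distinct₃ i j l → ∀ t → Indicator i j l t
indicator {i = i} {j} {l} (i≢j , i≢l , j≢l) t with t ≟ᶠ i | t ≟ᶠ j | t ≟ᶠ l
... | yes refl | _ | _ = inside (inj₁ refl)
  (cong₂ ℤ._+_ (cong₂ ℤ._+_ (δ-refl t) (δ-≢ (≢-sym i≢j))) (δ-≢ (≢-sym i≢l)))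
... | no t≢i | yes refl | _ = inside (inj₂ (inj₁ refl))
  (cong₂ ℤ._+_ (cong₂ ℤ._+_ (δ-≢ (≢-sym t≢i)) (δ-refl t)) (δ-≢ (≢-sym j≢l)))
... | no t≢i | no t≢j | yes refl = inside (inj₂ (inj₂ refl))
  (cong₂ ℤ._+_ (cong₂ ℤ._+_ (δ-≢ (≢-sym t≢i)) (δ-≢ (≢-sym t≢j))) (δ-refl t))
... | no t≢i | no t≢j | no t≢l = outside t≢i t≢j t≢l
  (cong₂ ℤ._+_ (cong₂ ℤ._+_ (δ-≢ (≢-sym t≢i)) (δ-≢ (≢-sym t≢j))) (δ-≢ (≢-sym t≢l)))

module Coordinates (R : CompleteOrderedField) where
  open CompleteOrderedField R hiding (zero; refl; sym; trans)
  open Euclidean R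
  open IntegerEmbedding R
  private module R = CommutativeRing commutativeRing
  open SemiringSum R.semiring using (sum; sum-cong-≋)
  open ≈-Reasoning R.setoid

  infix 8 _∙_

  _∙_ : ∀ {n} → Point n → Point n → Carrier
  x ∙ y = sum (λ t → x t * y t)

  dist² : ∀ {n} → Point n → Point n → Carrier
  dist² x y = sum (λ t → (x t - y t) * (x t - y t))

  e : ∀ {n} → Fin n → Point n
  e i t = ι (δ i t)

  -- The vector a + α e_p + β e_q. The deviation stays an integer under one `ι`, so that it can be
  -- evaluated in ℤ; p and q may coincide.
  twoOff : ∀ {n} → Carrier → ℤ → Fin n → ℤ → Fin n → Point n
  twoOff a α p β q t = a + ι (α ℤ.* δ p t ℤ.+ β ℤ.* δ q t)

  -- The vertex e_i + e_j + e_l of J̃(n,3), named after what the inner product with it computes.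
  tripleSum : ∀ {n} → Fin n → Fin n → Fin n → Point n
  tripleSum i j l t = ι (δ³ i j l t)

  ≡⇒ι≈ : ∀ {i j} → i ≡ j → ι i ≈ ι j
  ≡⇒ι≈ i≡j = R.reflexive (cong ι i≡j)

  abstract
    ∙-congˡ : ∀ {n} (x : Point n) {y z} → y ≋ z → x ∙ y ≈ x ∙ z
    ∙-congˡ x y≋z = sum-cong-≋ (λ t → R.*-congˡ (y≋z t))

    ∙-comm : ∀ {n} (x y : Point n) → x ∙ y ≈ y ∙ x
    ∙-comm x y = sum-cong-≋ (λ t → R.*-comm (x t) (y t))

    dist²-cong : ∀ {n} {x x′ y y′ : Point n} → x ≋ x′ → y ≋ y′ → dist² x y ≈ dist² x′ y′
    dist²-cong x≋x′ y≋y′ = sum-cong-≋ λ t →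
      let eq = R.+-cong (x≋x′ t) (R.-‿cong (y≋y′ t)) in R.*-cong eq eq

    dist²-sym : ∀ {n} (x y : Point n) → dist² x y ≈ dist² y x
    dist²-sym x y = sum-cong-≋ λ t →
      solve 2 (λ x y → (x :- y) :* (x :- y) := (y :- x) :* (y :- x)) R.refl (x t) (y t)

    ∙-zero : ∀ {n} (x : Point n) → x ∙ (λ _ → 0#) ≈ 0#
    ∙-zero {zero}  x = R.refl
    ∙-zero {suc n} x = R.trans (R.+-cong (R.zeroʳ _) (∙-zero (x ∘ suc))) (R.+-identityˡ _)

    ∙-e : ∀ {n} (x : Point n) i → x ∙ e i ≈ x i
    ∙-e x zero    = R.trans (R.+-cong (R.trans (R.*-congˡ (R.sym 1≈ι1)) (R.*-identityʳ _)) (∙-zero (x ∘ suc)))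
                            (R.+-identityʳ _)
    ∙-e x (suc i) = R.trans (R.+-cong (R.zeroʳ _) (∙-e (x ∘ suc) i)) (R.+-identityˡ _)

    ∙-ones : ∀ {n} (x : Point n) → x ∙ (λ _ → ι 1ℤ) ≈ sum x
    ∙-ones x = sum-cong-≋ (λ t → R.trans (R.*-congˡ (R.sym 1≈ι1)) (R.*-identityʳ (x t)))

    sum-ones : ∀ n → sum {n} (λ _ → ι 1ℤ) ≈ ι (+ n)
    sum-ones zero    = R.refl
    sum-ones (suc n) = R.+-cong (R.sym 1≈ι1) (sum-ones n)

    -- Three terms cover both uses: `twoOff` combines the all-ones vector with two unit vectors, and
    -- `tripleSum` combines three unit vectors.
    ∙-linear : ∀ {n} (x u v w : Point n) a b c →
               x ∙ (λ t → a * u t + b * v t + c * w t) ≈ a * x ∙ u + b * x ∙ v + c * x ∙ w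
    ∙-linear {zero} x u v w a b c =
      solve 3 (λ a b c → con 0ℤ := a :* con 0ℤ :+ b :* con 0ℤ :+ c :* con 0ℤ) R.refl a b c
    ∙-linear {suc n} x u v w a b c = R.trans
      (R.+-congˡ (∙-linear (x ∘ suc) (u ∘ suc) (v ∘ suc) (w ∘ suc) a b c))
      (solve 10 (λ x₀ u₀ v₀ w₀ a b c u v w →
          x₀ :* (a :* u₀ :+ b :* v₀ :+ c :* w₀) :+ (a :* u :+ b :* v :+ c :* w) :=
          a :* (x₀ :* u₀ :+ u) :+ b :* (x₀ :* v₀ :+ v) :+ c :* (x₀ :* w₀ :+ w)) R.refl
        (x zero) (u zero) (v zero) (w zero) a b c
        ((x ∘ suc) ∙ (u ∘ suc)) ((x ∘ suc) ∙ (v ∘ suc)) ((x ∘ suc) ∙ (w ∘ suc)))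

    dist²-expand : ∀ {n} (x y : Point n) → dist² x y ≈ x ∙ x - ι (+ 2) * x ∙ y + y ∙ y
    dist²-expand {zero}  x y = solve 0 (con 0ℤ := con 0ℤ :- con (+ 2) :* con 0ℤ :+ con 0ℤ) R.refl
    dist²-expand {suc n} x y = R.trans
      (R.+-congˡ (dist²-expand (x ∘ suc) (y ∘ suc)))
      (solve 5 (λ x y xx xy yy →
          (x :- y) :* (x :- y) :+ (xx :- con (+ 2) :* xy :+ yy) :=
          (x :* x :+ xx) :- con (+ 2) :* (x :* y :+ xy) :+ (y :* y :+ yy)) R.refl
        (x zero) (y zero) ((x ∘ suc) ∙ (x ∘ suc)) ((x ∘ suc) ∙ (y ∘ suc)) ((y ∘ suc) ∙ (y ∘ suc)))

    ∙-twoOff : ∀ {n} (x : Point n) a α p β q →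
               x ∙ twoOff a α p β q ≈ a * sum x + ι α * x p + ι β * x q
    ∙-twoOff x a α p β q = begin
      x ∙ twoOff a α p β q
        ≈⟨ ∙-congˡ x (λ t → R.trans
             (R.+-cong (R.trans (R.sym (R.*-identityʳ a)) (R.*-congˡ 1≈ι1))
               (R.trans (ι-+ (α ℤ.* δ p t) (β ℤ.* δ q t)) (R.+-cong (ι-* α (δ p t)) (ι-* β (δ q t)))))
             (R.sym (R.+-assoc _ _ _))) ⟩
      x ∙ (λ t → a * ι 1ℤ + ι α * e p t + ι β * e q t)
        ≈⟨ ∙-linear x (λ _ → ι 1ℤ) (e p) (e q) a (ι α) (ι β) ⟩
      a * x ∙ (λ _ → ι 1ℤ) + ι α * x ∙ e p + ι β * x ∙ e q
        ≈⟨ R.+-cong (R.+-cong (R.*-congˡ (∙-ones x)) (R.*-congˡ (∙-e x p))) (R.*-congˡ (∙-e x q)) ⟩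
      a * sum x + ι α * x p + ι β * x q ∎

    ∙-tripleSum : ∀ {n} (x : Point n) i j l → x ∙ tripleSum i j l ≈ x i + x j + x l
    ∙-tripleSum x i j l = begin
      x ∙ tripleSum i j l
        ≈⟨ ∙-congˡ x (λ t → R.trans (ι-+ (δ i t ℤ.+ δ j t) (δ l t)) (R.trans (R.+-congʳ (ι-+ (δ i t) (δ j t)))
            (solve 3 (λ a b c → a :+ b :+ c := con 1ℤ :* a :+ con 1ℤ :* b :+ con 1ℤ :* c) R.refl _ _ _))) ⟩
      x ∙ (λ t → ι 1ℤ * e i t + ι 1ℤ * e j t + ι 1ℤ * e l t)
        ≈⟨ ∙-linear x (e i) (e j) (e l) (ι 1ℤ) (ι 1ℤ) (ι 1ℤ) ⟩
      ι 1ℤ * x ∙ e i + ι 1ℤ * x ∙ e j + ι 1ℤ * x ∙ e l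
        ≈⟨ R.+-cong (R.+-cong (R.*-congˡ (∙-e x i)) (R.*-congˡ (∙-e x j))) (R.*-congˡ (∙-e x l)) ⟩
      ι 1ℤ * x i + ι 1ℤ * x j + ι 1ℤ * x l
        ≈⟨ solve 3 (λ a b c → con 1ℤ :* a :+ con 1ℤ :* b :+ con 1ℤ :* c := a :+ b :+ c) R.refl _ _ _ ⟩
      x i + x j + x l ∎

    sum-tripleSum : ∀ {n} (i j l : Fin n) → sum (tripleSum i j l) ≈ ι (+ 3)
    sum-tripleSum i j l = begin
      sum (tripleSum i j l)                     ≈⟨ ∙-ones (tripleSum i j l) ⟨
      tripleSum i j l ∙ (λ _ → ι 1ℤ)            ≈⟨ ∙-comm (tripleSum i j l) _ ⟩
      (λ _ → ι 1ℤ) ∙ tripleSum i j l            ≈⟨ ∙-tripleSum (λ _ → ι 1ℤ) i j l ⟩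
      ι 1ℤ + ι 1ℤ + ι 1ℤ                        ≈⟨ solve 0 (con 1ℤ :+ con 1ℤ :+ con 1ℤ := con (+ 3)) R.refl ⟩
      ι (+ 3)                                   ∎

    sum-twoOff : ∀ {n} a α (p : Fin n) β q → sum (twoOff a α p β q) ≈ ι (+ n) * a + ι (α ℤ.+ β)
    sum-twoOff {n} a α p β q = begin
      sum (twoOff a α p β q)                              ≈⟨ ∙-ones (twoOff a α p β q) ⟨
      twoOff a α p β q ∙ (λ _ → ι 1ℤ)                     ≈⟨ ∙-comm (twoOff a α p β q) _ ⟩
      (λ _ → ι 1ℤ) ∙ twoOff a α p β q                     ≈⟨ ∙-twoOff (λ _ → ι 1ℤ) a α p β q ⟩
      a * sum {n} (λ _ → ι 1ℤ) + ι α * ι 1ℤ + ι β * ι 1ℤ  ≈⟨ R.+-congʳ (R.+-congʳ (R.*-congˡ (sum-ones n))) ⟩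
      a * ι (+ n) + ι α * ι 1ℤ + ι β * ι 1ℤ
        ≈⟨ solve 4 (λ a n α β → a :* n :+ α :* con 1ℤ :+ β :* con 1ℤ := n :* a :+ (α :+ β)) R.refl _ _ _ _ ⟩
      ι (+ n) * a + (ι α + ι β)                           ≈⟨ R.+-congˡ (ι-+ α β) ⟨
      ι (+ n) * a + ι (α ℤ.+ β)                           ∎

    sum₃-indicator : ∀ {n} {i j l : Fin n} → Distinct₃ i j l → sum₃ (δ³ i j l) i j l ≡ + 3
    sum₃-indicator {i = i} {j} {l} ijl =
      cong₂ ℤ._+_ (cong₂ ℤ._+_ (one (inj₁ refl)) (one (inj₂ (inj₁ refl)))) (one (inj₂ (inj₂ refl)))
      where
      one : ∀ {t} → t ≡ i ⊎ t ≡ j ⊎ t ≡ l → δ³ i j l t ≡ 1ℤ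
      one {t} t∈ with indicator ijl t
      ... | inside _ eq = eq
      ... | outside t≢i t≢j t≢l _ = ⊥-elim ([ t≢i , [ t≢j , t≢l ]′ ]′ t∈)

    ι-sum₃ : ∀ {n} (k : Fin n → ℤ) i j l → ι (sum₃ k i j l) ≈ ι (k i) + ι (k j) + ι (k l)
    ι-sum₃ k i j l = R.trans (ι-+ (k i ℤ.+ k j) (k l)) (R.+-congʳ (ι-+ (k i) (k j)))

    tripleSum∙tripleSum : ∀ {n} {i j l : Fin n} → Distinct₃ i j l → tripleSum i j l ∙ tripleSum i j l ≈ ι (+ 3)
    tripleSum∙tripleSum {i = i} {j} {l} ijl = begin
      tripleSum i j l ∙ tripleSum i j l            ≈⟨ ∙-tripleSum (tripleSum i j l) i j l ⟩
      ι (δ³ i j l i) + ι (δ³ i j l j) + ι (δ³ i j l l) ≈⟨ ι-sum₃ (δ³ i j l) i j l ⟨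
      ι (sum₃ (δ³ i j l) i j l)                    ≈⟨ ≡⇒ι≈ (sum₃-indicator ijl) ⟩
      ι (+ 3)                                      ∎

    dist²-tripleSum : ∀ {n} (x : Point n) {i j l} → Distinct₃ i j l →
      dist² x (tripleSum i j l) ≈ x ∙ x - ι (+ 2) * (x i + x j + x l) + ι (+ 3)
    dist²-tripleSum x {i} {j} {l} ijl = R.trans (dist²-expand x (tripleSum i j l))
      (R.+-cong (R.+-congˡ (R.-‿cong (R.*-congˡ (∙-tripleSum x i j l)))) (tripleSum∙tripleSum ijl))

    -- Expanding along the second vector asks only for the coordinate sum of the first and for its
    -- entries at r and s. The δ's are left unevaluated for the later case distinctions.
    twoOff∙twoOff : ∀ {n} a α (p : Fin n) β q γ r ε s →
      twoOff a α p β q ∙ twoOff a γ r ε s ≈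
      a * (ι (+ n) * a + ι (α ℤ.+ β)) + a * ι (γ ℤ.+ ε) +
      ι (γ ℤ.* (α ℤ.* δ p r ℤ.+ β ℤ.* δ q r) ℤ.+ ε ℤ.* (α ℤ.* δ p s ℤ.+ β ℤ.* δ q s))
    twoOff∙twoOff {n} a α p β q γ r ε s = begin
      twoOff a α p β q ∙ twoOff a γ r ε s
        ≈⟨ ∙-twoOff (twoOff a α p β q) a γ r ε s ⟩
      a * sum (twoOff a α p β q) + ι γ * (a + ι A) + ι ε * (a + ι B)
        ≈⟨ R.+-congʳ (R.+-congʳ (R.*-congˡ (sum-twoOff a α p β q))) ⟩
      a * S + ι γ * (a + ι A) + ι ε * (a + ι B)
        ≈⟨ solve 6 (λ a S γ A ε B → a :* S :+ γ :* (a :+ A) :+ ε :* (a :+ B) :=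
             a :* S :+ a :* (γ :+ ε) :+ (γ :* A :+ ε :* B)) R.refl a S (ι γ) (ι A) (ι ε) (ι B) ⟩
      a * S + a * (ι γ + ι ε) + (ι γ * ι A + ι ε * ι B)
        ≈⟨ R.+-cong (R.+-congˡ (R.*-congˡ (ι-+ γ ε)))
             (R.trans (ι-+ (γ ℤ.* A) (ε ℤ.* B)) (R.+-cong (ι-* γ A) (ι-* ε B))) ⟨
      a * S + a * ι (γ ℤ.+ ε) + ι (γ ℤ.* A ℤ.+ ε ℤ.* B) ∎
      where
      A B : ℤ
      A = α ℤ.* δ p r ℤ.+ β ℤ.* δ q r
      B = α ℤ.* δ p s ℤ.+ β ℤ.* δ q s
      S : Carrier
      S = ι (+ n) * a + ι (α ℤ.+ β)

    -- Equal total deviations make all terms containing a cancel, so the squared distance is an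
    -- integer.
    dist²-twoOff : ∀ {n} a α (p : Fin n) β q γ r ε s → α ℤ.+ β ≡ γ ℤ.+ ε →
      dist² (twoOff a α p β q) (twoOff a γ r ε s) ≈
      ι ((α ℤ.* (α ℤ.* δ p p ℤ.+ β ℤ.* δ q p) ℤ.+ β ℤ.* (α ℤ.* δ p q ℤ.+ β ℤ.* δ q q))
         ℤ.- + 2 ℤ.* (γ ℤ.* (α ℤ.* δ p r ℤ.+ β ℤ.* δ q r) ℤ.+ ε ℤ.* (α ℤ.* δ p s ℤ.+ β ℤ.* δ q s))
         ℤ.+ (γ ℤ.* (γ ℤ.* δ r r ℤ.+ ε ℤ.* δ s r) ℤ.+ ε ℤ.* (γ ℤ.* δ r s ℤ.+ ε ℤ.* δ s s)))
    dist²-twoOff {n} a α p β q γ r ε s eq = begin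
      dist² x y                                   ≈⟨ dist²-expand x y ⟩
      x ∙ x - ι (+ 2) * x ∙ y + y ∙ y
        ≈⟨ R.+-cong (R.+-cong (twoOff∙twoOff a α p β q α p β q)
                     (R.-‿cong (R.*-congˡ (twoOff∙twoOff a α p β q γ r ε s))))
                    (twoOff∙twoOff a γ r ε s γ r ε s) ⟩
      T (α ℤ.+ β) + a * ι (α ℤ.+ β) + ι X - ι (+ 2) * (T (α ℤ.+ β) + a * ι (γ ℤ.+ ε) + ι Y)
        + (T (γ ℤ.+ ε) + a * ι (γ ℤ.+ ε) + ι Z)
        ≡⟨ cong (λ u → T u + a * ι u + ι X - ι (+ 2) * (T u + a * ι (γ ℤ.+ ε) + ι Y)
                       + (T (γ ℤ.+ ε) + a * ι (γ ℤ.+ ε) + ι Z)) eq ⟩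
      T u + a * ι u + ι X - ι (+ 2) * (T u + a * ι u + ι Y) + (T u + a * ι u + ι Z)
        ≈⟨ solve 4 (λ T X Y Z → T :+ X :- con (+ 2) :* (T :+ Y) :+ (T :+ Z) := X :+ (:- (con (+ 2) :* Y)) :+ Z)
             R.refl (T u + a * ι u) (ι X) (ι Y) (ι Z) ⟩
      ι X + - (ι (+ 2) * ι Y) + ι Z
        ≈⟨ R.trans (ι-+ (X ℤ.- + 2 ℤ.* Y) Z) (R.+-congʳ (R.trans (ι-+ X (ℤ.- (+ 2 ℤ.* Y)))
             (R.+-congˡ (R.trans (ι-neg (+ 2 ℤ.* Y)) (R.-‿cong (ι-* (+ 2) Y)))))) ⟨
      ι (X ℤ.- + 2 ℤ.* Y ℤ.+ Z)                   ∎
      where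
      x y : Point n
      x = twoOff a α p β q
      y = twoOff a γ r ε s
      u X Y Z : ℤ
      u = γ ℤ.+ ε
      X = α ℤ.* (α ℤ.* δ p p ℤ.+ β ℤ.* δ q p) ℤ.+ β ℤ.* (α ℤ.* δ p q ℤ.+ β ℤ.* δ q q)
      Y = γ ℤ.* (α ℤ.* δ p r ℤ.+ β ℤ.* δ q r) ℤ.+ ε ℤ.* (α ℤ.* δ p s ℤ.+ β ℤ.* δ q s)
      Z = γ ℤ.* (γ ℤ.* δ r r ℤ.+ ε ℤ.* δ s r) ℤ.+ ε ℤ.* (γ ℤ.* δ r s ℤ.+ ε ℤ.* δ s s)
      T : ℤ → Carrier
      T v = a * (ι (+ n) * a + ι v)

    -- The hypotheses say that the coordinates of twoOff a α p β q sum to 3 and fix the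
    -- part 2(α + β - 3) a of the distance that is not visibly an integer.
    dist²-twoOff-tripleSum : ∀ {n} a α (p : Fin n) β q {i j l} c → Distinct₃ i j l →
      ι (+ n) * a + ι (α ℤ.+ β) ≈ ι (+ 3) → a * ι (α ℤ.+ β ℤ.- + 3) ≈ ι c →
      dist² (twoOff a α p β q) (tripleSum i j l) ≈
      ι (c ℤ.+ (α ℤ.* (α ℤ.* δ p p ℤ.+ β ℤ.* δ q p) ℤ.+ β ℤ.* (α ℤ.* δ p q ℤ.+ β ℤ.* δ q q))
         ℤ.- + 2 ℤ.* (α ℤ.* δ³ i j l p ℤ.+ β ℤ.* δ³ i j l q) ℤ.+ + 3)
    dist²-twoOff-tripleSum {n} a α p β q {i} {j} {l} c ijl sum≈3 a* = begin
      dist² x (tripleSum i j l)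
        ≈⟨ dist²-expand x (tripleSum i j l) ⟩
      x ∙ x - ι (+ 2) * x ∙ tripleSum i j l + tripleSum i j l ∙ tripleSum i j l
        ≈⟨ R.+-cong (R.+-cong (R.trans (twoOff∙twoOff a α p β q α p β q)
                      (R.+-congʳ (R.+-congʳ (R.*-congˡ sum≈3))))
                     (R.-‿cong (R.*-congˡ x∙t))) (tripleSum∙tripleSum ijl) ⟩
      a * ι (+ 3) + a * ι (α ℤ.+ β) + ι X - ι (+ 2) * (a * ι (+ 3) + ι Y) + ι (+ 3)
        ≈⟨ solve 4 (λ a u X Y → a :* con (+ 3) :+ a :* u :+ X :- con (+ 2) :* (a :* con (+ 3) :+ Y) :+ con (+ 3)
             := a :* (u :+ con (ℤ.- + 3)) :+ X :+ (:- (con (+ 2) :* Y)) :+ con (+ 3)) R.refl a (ι (α ℤ.+ β)) (ι X) (ι Y) ⟩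
      a * (ι (α ℤ.+ β) + ι (ℤ.- + 3)) + ι X + - (ι (+ 2) * ι Y) + ι (+ 3)
        ≈⟨ R.+-congʳ (R.+-congʳ (R.+-congʳ (R.trans (R.*-congˡ (R.sym (ι-+ (α ℤ.+ β) (ℤ.- + 3)))) a*))) ⟩
      ι c + ι X + - (ι (+ 2) * ι Y) + ι (+ 3)
        ≈⟨ R.trans (ι-+ (c ℤ.+ X ℤ.- + 2 ℤ.* Y) (+ 3)) (R.+-congʳ
             (R.trans (ι-+ (c ℤ.+ X) (ℤ.- (+ 2 ℤ.* Y))) (R.+-cong (ι-+ c X)
               (R.trans (ι-neg (+ 2 ℤ.* Y)) (R.-‿cong (ι-* (+ 2) Y)))))) ⟨
      ι (c ℤ.+ X ℤ.- + 2 ℤ.* Y ℤ.+ + 3) ∎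
      where
      x : Point n
      x = twoOff a α p β q
      X Y : ℤ
      X = α ℤ.* (α ℤ.* δ p p ℤ.+ β ℤ.* δ q p) ℤ.+ β ℤ.* (α ℤ.* δ p q ℤ.+ β ℤ.* δ q q)
      Y = α ℤ.* δ³ i j l p ℤ.+ β ℤ.* δ³ i j l q
      x∙t : x ∙ tripleSum i j l ≈ a * ι (+ 3) + ι Y
      x∙t = begin
        x ∙ tripleSum i j l                       ≈⟨ ∙-comm x (tripleSum i j l) ⟩
        tripleSum i j l ∙ x                       ≈⟨ ∙-twoOff (tripleSum i j l) a α p β q ⟩
        a * sum (tripleSum i j l) + ι α * ι (δ³ i j l p) + ι β * ι (δ³ i j l q)
          ≈⟨ R.trans (R.+-assoc _ _ _) (R.+-cong (R.*-congˡ (sum-tripleSum i j l))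
               (R.sym (R.trans (ι-+ (α ℤ.* δ³ i j l p) (β ℤ.* δ³ i j l q)) (R.+-cong (ι-* α (δ³ i j l p)) (ι-* β (δ³ i j l q)))))) ⟩
        a * ι (+ 3) + ι Y                         ∎

-- Arrangements of a multiset of coordinates

lookup-replicate-++[] : ∀ {A : Set} k {a : A} i → lookup (replicate k a ++ []) i ≡ a
lookup-replicate-++[] (suc k) zero    = refl
lookup-replicate-++[] (suc k) (suc i) = lookup-replicate-++[] k i

length-replicate-++[] : ∀ {A : Set} k {a : A} → length (replicate k a ++ []) ≡ k
length-replicate-++[] k {a} = ≡.trans (length-++ (replicate k a)) (≡.trans (ℕ.+-identityʳ _) (length-replicate k))

skip : ∀ {n} {i j : Fin (suc n)} → i ≢ j → ∃[ j′ ] punchIn i j′ ≡ j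
skip i≢j = punchOut i≢j , punchIn-punchOut i≢j

module Arrangements (R : CompleteOrderedField) where
  open CompleteOrderedField R hiding (zero; refl; sym; trans)
  open Euclidean R
  open IntegerEmbedding R
  open Coordinates R
  private module R = CommutativeRing commutativeRing
  open ≈-Reasoning R.setoid

  ι-cancel : ∀ k {x y} → ι (+ suc k) * x ≈ ι (+ suc k) * y → x ≈ y
  ι-cancel k {x} {y} eq = zero-difference (begin
    x - y                                          ≈⟨ R.*-identityˡ (x - y) ⟨
    1# * (x - y)                                   ≈⟨ R.*-congʳ (proj₂ inverse) ⟨
    (proj₁ inverse * ι (+ suc k)) * (x - y)
      ≈⟨ solve 4 (λ i k x y → (i :* k) :* (x :- y) := i :* (k :* x :- k :* y)) R.refl (proj₁ inverse) (ι (+ suc k)) x y ⟩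
    proj₁ inverse * (ι (+ suc k) * x - ι (+ suc k) * y) ≈⟨ R.*-congˡ (difference-zero eq) ⟩
    proj₁ inverse * 0#                             ≈⟨ R.zeroʳ _ ⟩
    0#                                             ∎)
    where
    inverse : ∃[ z ] z * ι (+ suc k) ≈ 1#
    inverse with z , z*k≈1 , _ ← #⇒invertible (#-sym (<⇒# (0<fromℕ k))) =
      z , R.trans (R.*-congˡ (R.sym (HeytingProperties.x-0≈x heytingCommutativeRing _))) z*k≈1

  /-cancel : ∀ m k → ι (+ suc k) * (m / suc k) ≈ ι (+ m)
  /-cancel m k = begin
    ι (+ suc k) * (ι (+ m) * z)  ≈⟨ solve 3 (λ k m z → k :* (m :* z) := m :* (k :* z)) R.refl (ι (+ suc k)) (ι (+ m)) z ⟩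
    ι (+ m) * (ι (+ suc k) * z)  ≈⟨ R.*-congˡ (R.trans (R.*-congʳ (R.sym (HeytingProperties.x-0≈x heytingCommutativeRing _)))
                                      (proj₂ (proj₂ invertible))) ⟩
    ι (+ m) * 1#                 ≈⟨ R.*-identityʳ _ ⟩
    ι (+ m)                      ∎
    where
    invertible = #⇒invertible (#-sym (<⇒# (0<fromℕ k)))
    z = proj₁ invertible

  quotient-unique : ∀ m k {x} → ι (+ suc k) * x ≈ ι (+ m) → x ≈ m / suc k
  quotient-unique m k eq = ι-cancel k (R.trans eq (R.sym (/-cancel m k)))

  abstract
    -- Sealed so as to be atoms for the solver, governed by the equations `2½≈1` and `3⅓≈1`.
    ½ ⅓ : Carrier
    ½ = 1 / 2
    ⅓ = 1 / 3

    1/2≈½ : 1 / 2 ≈ ½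
    1/2≈½ = R.refl

    1/3≈⅓ : 1 / 3 ≈ ⅓
    1/3≈⅓ = R.refl

    2½≈1 : ι (+ 2) * ½ ≈ ι 1ℤ
    2½≈1 = /-cancel 1 1

    3⅓≈1 : ι (+ 3) * ⅓ ≈ ι 1ℤ
    3⅓≈1 = /-cancel 1 2

  -1/2≈½-1 : - (1 / 2) ≈ ½ + ι -1ℤ
  -1/2≈½-1 = R.trans (R.-‿cong 1/2≈½) (linear (- ι 1ℤ) (difference-zero 2½≈1)
    (solve 1 (λ h → :- h :- (h :+ con -1ℤ) := (:- con 1ℤ) :* (con (+ 2) :* h :- con 1ℤ)) R.refl ½))

  4/3≈⅓+1 : 4 / 3 ≈ ⅓ + ι 1ℤ
  4/3≈⅓+1 = R.sym (quotient-unique 4 2 (linear (ι 1ℤ) (difference-zero 3⅓≈1)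
    (solve 1 (λ t → con (+ 3) :* (t :+ con 1ℤ) :- con (+ 4) := con 1ℤ :* (con (+ 3) :* t :- con 1ℤ)) R.refl ⅓)))

  -2/3≈⅓-1 : - (2 / 3) ≈ ⅓ + ι -1ℤ
  -2/3≈⅓-1 = R.trans (R.-‿cong (R.sym (quotient-unique 2 2 {ι 1ℤ - ⅓} (linear (- ι 1ℤ) (difference-zero 3⅓≈1)
    (solve 1 (λ t → con (+ 3) :* (con 1ℤ :- t) :- con (+ 2) := (:- con 1ℤ) :* (con (+ 3) :* t :- con 1ℤ)) R.refl ⅓)))))
    (solve 1 (λ t → :- (con 1ℤ :- t) := t :+ con -1ℤ) R.refl ⅓)

  -- An arrangement is built one coordinate at a time: match `x i` with `c j`, delete both, and let
  -- `π` match the rest.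
  insert-≋ : ∀ {m n} {x : Vector Carrier (suc m)} (c : Vector Carrier (suc n)) i j (π : Permutation m n) →
             x i ≈ c j → (∀ k → x (punchIn i k) ≈ c (punchIn j (π ⟨$⟩ʳ k))) →
             ∀ t → x t ≈ c (insert i j π ⟨$⟩ʳ t)
  insert-≋ {x = x} c i j π xi≈cj rest t with i ≟ᶠ t
  ... | yes refl = xi≈cj
  ... | no i≢t = begin
    x t                                                   ≡⟨ cong x (punchIn-punchOut i≢t) ⟨
    x (punchIn i (punchOut i≢t))                          ≈⟨ rest (punchOut i≢t) ⟩
    c (punchIn j (π ⟨$⟩ʳ punchOut i≢t))                   ∎

  perm-≢ : ∀ {m n} (σ : Permutation m n) {u v} → u ≢ v → σ ⟨$⟩ˡ u ≢ σ ⟨$⟩ˡ v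
  perm-≢ σ {u} {v} u≢v eq = u≢v (≡.trans (≡.sym (Perm.inverseʳ σ)) (≡.trans (cong (σ ⟨$⟩ʳ_) eq) (Perm.inverseʳ σ)))

  perm-≢ʳ : ∀ {m n} (σ : Permutation m n) {t v} → t ≢ σ ⟨$⟩ˡ v → σ ⟨$⟩ʳ t ≢ v
  perm-≢ʳ σ t≢ refl = t≢ (≡.sym (Perm.inverseˡ σ))

  module _ {m : ℕ} where
    private
      -- In this form n ∸ 3 computes to 3 + m, and the list of coordinates visibly starts with its
      -- three ones.
      n = 6 ℕ.+ m
      coords : List Carrier
      coords = 1# ∷ 1# ∷ 1# ∷ replicate (3 ℕ.+ m) 0# ++ []

    abstract
      ∈J̃⇒tripleSum : ∀ {x : Point n} → x ∈ J̃ n 3 →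
                     ∃[ i ] ∃[ j ] ∃[ l ] Distinct₃ i j l × x ≋ tripleSum i j l
      ∈J̃⇒tripleSum {x} (σ , x≈) = σ ⟨$⟩ˡ 0F , σ ⟨$⟩ˡ 1F , σ ⟨$⟩ˡ 2F , ijl , x≋
        where
        ijl : Distinct₃ (σ ⟨$⟩ˡ 0F) (σ ⟨$⟩ˡ 1F) (σ ⟨$⟩ˡ 2F)
        ijl = perm-≢ σ (λ ()) , perm-≢ σ (λ ()) , perm-≢ σ (λ ())

        at : ∀ {t v} → t ≡ σ ⟨$⟩ˡ v → x t ≈ lookup coords v
        at {v = v} refl = R.trans (x≈ (σ ⟨$⟩ˡ v)) (R.reflexive (cong (lookup coords) (Perm.inverseʳ σ)))

        tail≈0 : ∀ v → v ≢ 0F → v ≢ 1F → v ≢ 2F → lookup coords v ≈ 0#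
        tail≈0 0F v≢0 _ _ = contradiction refl v≢0
        tail≈0 1F _ v≢1 _ = contradiction refl v≢1
        tail≈0 2F _ _ v≢2 = contradiction refl v≢2
        tail≈0 (suc (suc (suc v))) _ _ _ = R.reflexive (lookup-replicate-++[] (3 ℕ.+ m) v)

        x≋ : x ≋ tripleSum (σ ⟨$⟩ˡ 0F) (σ ⟨$⟩ˡ 1F) (σ ⟨$⟩ˡ 2F)
        x≋ t with indicator ijl t
        ... | inside t∈ eq = R.trans ([ at , [ at , at ]′ ]′ t∈) (R.trans 1≈ι1 (≡⇒ι≈ (≡.sym eq)))
        ... | outside t≢i t≢j t≢l eq = R.trans (x≈ t) (R.trans
          (tail≈0 _ (perm-≢ʳ σ t≢i) (perm-≢ʳ σ t≢j) (perm-≢ʳ σ t≢l)) (≡⇒ι≈ (≡.sym eq)))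

    abstract
      tripleSum∈J̃ : ∀ {i j l : Fin n} → Distinct₃ i j l → tripleSum i j l ∈ J̃ n 3
      tripleSum∈J̃ {i} {j} {l} ijl@(i≢j , i≢l , j≢l)
        -- Deletions renumber what remains: `j′` and `l′` are the names of j and l once i is gone,
        -- `l″` that of l once j is gone too. Each one is then matched with the front of the
        -- remaining list.
        with j′ , refl ← skip i≢j | l′ , refl ← skip i≢l
        with l″ , refl ← skip {i = j′} {l′} (λ j′≡l′ → j≢l (cong (punchIn i) j′≡l′))
        = insert i 0F (insert j′ 0F (insert l″ 0F tail))
        , insert-≋ (lookup coords) i 0F (insert j′ 0F (insert l″ 0F tail)) (one (inj₁ refl))
          (insert-≋ (λ v → lookup coords (suc v)) j′ 0F (insert l″ 0F tail) (one (inj₂ (inj₁ refl)))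
            (insert-≋ (λ v → lookup coords (suc (suc v))) l″ 0F tail (one (inj₂ (inj₂ refl))) λ k →
              R.trans (zeros k) (R.reflexive (≡.sym (lookup-replicate-++[] (3 ℕ.+ m) (tail ⟨$⟩ʳ k))))))
        where
        tail : Permutation (3 ℕ.+ m) (length (replicate (3 ℕ.+ m) 0# ++ []))
        tail = cast-id (≡.sym (length-replicate-++[] (3 ℕ.+ m)))

        one : ∀ {t} → t ≡ i ⊎ t ≡ j ⊎ t ≡ l → tripleSum i j l t ≈ 1#
        one {t} t∈ with indicator ijl t
        ... | inside _ eq = R.trans (≡⇒ι≈ eq) (R.sym 1≈ι1)
        ... | outside t≢i t≢j t≢l _ = ⊥-elim ([ t≢i , [ t≢j , t≢l ]′ ]′ t∈)

        zeros : ∀ k → tripleSum i j l (punchIn i (punchIn j′ (punchIn l″ k))) ≈ 0#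
        zeros k with indicator ijl (punchIn i (punchIn j′ (punchIn l″ k)))
        ... | outside _ _ _ eq = ≡⇒ι≈ eq
        ... | inside (inj₁ t≡i) _ = contradiction t≡i (punchInᵢ≢i i _)
        ... | inside (inj₂ (inj₁ t≡j)) _ = contradiction (punchIn-injective i _ _ t≡j) (punchInᵢ≢i j′ _)
        ... | inside (inj₂ (inj₂ t≡l)) _ =
          contradiction (punchIn-injective j′ _ _ (punchIn-injective i _ _ t≡l)) (punchInᵢ≢i l″ k)

  -- The value -½ at p is ½ - 1. There is no second exceptional coordinate; the deviation 0 is
  -- attached to p as a placeholder.
  lowered : Fin 8 → Point 8
  lowered p = twoOff ½ -1ℤ p 0ℤ p

  W : Subset 8
  W = ((1 / 2 , 7) ∷ (- (1 / 2) , 1) ∷ []) ᴾ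

  twoOff-ordinary : ∀ {n} a α {p} β {q t : Fin n} → t ≢ p → t ≢ q → twoOff a α p β q t ≈ a
  twoOff-ordinary a α {p} β {q} {t} t≢p t≢q = R.trans (R.+-congˡ (≡⇒ι≈ zeros)) (R.+-identityʳ a)
    where
    zeros : α ℤ.* δ p t ℤ.+ β ℤ.* δ q t ≡ 0ℤ
    zeros rewrite δ-≢ (≢-sym t≢p) | δ-≢ (≢-sym t≢q) | ℤ.*-zeroʳ α | ℤ.*-zeroʳ β = refl

  lowered-at : ∀ p → lowered p p ≈ - (1 / 2)
  lowered-at p = R.trans (R.+-congˡ (≡⇒ι≈ minus)) (R.sym -1/2≈½-1)
    where
    minus : -1ℤ ℤ.* δ p p ℤ.+ 0ℤ ℤ.* δ p p ≡ -1ℤ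
    minus rewrite δ-refl p = refl

  module _ where
    private
      coords : List Carrier
      coords = replicate 7 (1 / 2) ++ - (1 / 2) ∷ []

    abstract
      ∈W⇒lowered : ∀ {x} → x ∈ W → ∃[ p ] x ≋ lowered p
      ∈W⇒lowered {x} (σ , x≈) = p , x≋
        where
        p : Fin 8
        p = σ ⟨$⟩ˡ 7F

        halves : ∀ v → v ≢ 7F → lookup coords v ≈ ½
        halves 0F _ = 1/2≈½
        halves 1F _ = 1/2≈½
        halves 2F _ = 1/2≈½
        halves 3F _ = 1/2≈½
        halves 4F _ = 1/2≈½
        halves 5F _ = 1/2≈½
        halves 6F _ = 1/2≈½
        halves 7F v≢7 = contradiction refl v≢7

        x≋ : x ≋ lowered p
        x≋ t with t ≟ᶠ p
        ... | yes refl = R.trans (x≈ p) (R.trans (R.reflexive (cong (lookup coords) (Perm.inverseʳ σ))) (R.sym (lowered-at p)))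
        ... | no t≢p = R.trans (x≈ t) (R.trans (halves _ (perm-≢ʳ σ t≢p)) (R.sym (twoOff-ordinary ½ -1ℤ 0ℤ t≢p t≢p)))

    abstract
      lowered∈W : ∀ p → lowered p ∈ W
      lowered∈W p = insert p 7F Perm.id , insert-≋ (lookup coords) p 7F Perm.id (lowered-at p) λ k →
        R.trans (twoOff-ordinary ½ -1ℤ 0ℤ (punchInᵢ≢i p k) (punchInᵢ≢i p k)) (R.sym (halves k))
        where
        halves : ∀ k → lookup coords (punchIn 7F k) ≈ ½
        halves 0F = 1/2≈½
        halves 1F = 1/2≈½
        halves 2F = 1/2≈½
        halves 3F = 1/2≈½
        halves 4F = 1/2≈½
        halves 5F = 1/2≈½
        halves 6F = 1/2≈½

  x₀ : Point 9
  x₀ = λ _ → 1 / 3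

  -- The value ⅓ is raised to 4/3 at p and lowered to -2/3 at q. For p ≢ q the difference to `x₀` is
  -- the root e_p - e_q of A₈.
  shifted : Fin 9 → Fin 9 → Point 9
  shifted p q = twoOff ⅓ 1ℤ p -1ℤ q

  Y : Subset 9
  Y = ((4 / 3 , 1) ∷ (1 / 3 , 7) ∷ (- (2 / 3) , 1) ∷ []) ᴾ

  module _ where
    private
      coords : List Carrier
      coords = 4 / 3 ∷ replicate 7 (1 / 3) ++ - (2 / 3) ∷ []

    shifted-up : ∀ {p q} → p ≢ q → shifted p q p ≈ 4 / 3
    shifted-up {p} {q} p≢q = R.trans (R.+-congˡ (≡⇒ι≈ plus)) (R.sym 4/3≈⅓+1)
      where
      plus : 1ℤ ℤ.* δ p p ℤ.+ -1ℤ ℤ.* δ q p ≡ 1ℤ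
      plus rewrite δ-refl p | δ-≢ (≢-sym p≢q) = refl

    shifted-down : ∀ {p q} → p ≢ q → shifted p q q ≈ - (2 / 3)
    shifted-down {p} {q} p≢q = R.trans (R.+-congˡ (≡⇒ι≈ minus)) (R.sym -2/3≈⅓-1)
      where
      minus : 1ℤ ℤ.* δ p q ℤ.+ -1ℤ ℤ.* δ q q ≡ -1ℤ
      minus rewrite δ-refl q | δ-≢ p≢q = refl

    abstract
      ∈Y⇒shifted : ∀ {x} → x ∈ Y → ∃[ p ] ∃[ q ] p ≢ q × x ≋ shifted p q
      ∈Y⇒shifted {x} (σ , x≈) = p , q , p≢q , x≋
        where
        p q : Fin 9
        p = σ ⟨$⟩ˡ 0F
        q = σ ⟨$⟩ˡ 8F

        p≢q : p ≢ q
        p≢q = perm-≢ σ (λ ())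

        thirds : ∀ v → v ≢ 0F → v ≢ 8F → lookup coords v ≈ ⅓
        thirds 0F v≢0 _ = contradiction refl v≢0
        thirds 1F _ _ = 1/3≈⅓
        thirds 2F _ _ = 1/3≈⅓
        thirds 3F _ _ = 1/3≈⅓
        thirds 4F _ _ = 1/3≈⅓
        thirds 5F _ _ = 1/3≈⅓
        thirds 6F _ _ = 1/3≈⅓
        thirds 7F _ _ = 1/3≈⅓
        thirds (suc 7F) _ v≢8 = contradiction refl v≢8

        x≋ : x ≋ shifted p q
        x≋ t with t ≟ᶠ p | t ≟ᶠ q
        ... | yes refl | _ = R.trans (x≈ p) (R.trans (R.reflexive (cong (lookup coords) (Perm.inverseʳ σ))) (R.sym (shifted-up p≢q)))
        ... | no _ | yes refl = R.trans (x≈ q) (R.trans (R.reflexive (cong (lookup coords) (Perm.inverseʳ σ))) (R.sym (shifted-down p≢q)))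
        ... | no t≢p | no t≢q = R.trans (x≈ t) (R.trans (thirds _ (perm-≢ʳ σ t≢p) (perm-≢ʳ σ t≢q))
                                  (R.sym (twoOff-ordinary ⅓ 1ℤ -1ℤ t≢p t≢q)))

    abstract
      shifted∈Y : ∀ {p q} → p ≢ q → shifted p q ∈ Y
      shifted∈Y {p} {q} p≢q with q′ , refl ← skip p≢q
        -- With 4/3 removed from the front, -2/3 stands last, at position 7, among the remaining
        -- eight coordinates.
        = insert p 0F (insert q′ 7F Perm.id)
        , insert-≋ (lookup coords) p 0F (insert q′ 7F Perm.id) (shifted-up p≢q)
            (insert-≋ (λ v → lookup coords (suc v)) q′ 7F Perm.id (shifted-down p≢q) λ k →
              R.trans (twoOff-ordinary ⅓ 1ℤ -1ℤ (punchInᵢ≢i p _) (λ eq → punchInᵢ≢i q′ k (punchIn-injective p _ _ eq)))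
                      (R.sym (thirds k)))
        where
        thirds : ∀ k → lookup coords (suc (punchIn 7F k)) ≈ ⅓
        thirds 0F = 1/3≈⅓
        thirds 1F = 1/3≈⅓
        thirds 2F = 1/3≈⅓
        thirds 3F = 1/3≈⅓
        thirds 4F = 1/3≈⅓
        thirds 5F = 1/3≈⅓
        thirds 6F = 1/3≈⅓

-- Distances between the points of J̃, W, {x₀} and Y

-- Squared distances: two triples with r common indices have squared distance 6 - 2r, for r = 2, 1,
-- 0.
data Allowed : ℤ → Set where
  two  : Allowed (+ 2)
  four : Allowed (+ 4)
  six  : Allowed (+ 6)

-- The left side has the unevaluated form in which `dist²-twoOff-tripleSum` delivers the squared
-- distance; the parameter `u` stands for the value of `δ³` at p. The following lemmas serve the
-- other pairs of vectors in the same way.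
lowered-triple-δ : ∀ {n} (p : Fin n) u →
  ℤ.- + 2 ℤ.+ (-1ℤ ℤ.* (-1ℤ ℤ.* δ p p ℤ.+ 0ℤ ℤ.* δ p p) ℤ.+ 0ℤ ℤ.* (-1ℤ ℤ.* δ p p ℤ.+ 0ℤ ℤ.* δ p p))
    ℤ.- + 2 ℤ.* (-1ℤ ℤ.* u ℤ.+ 0ℤ ℤ.* u) ℤ.+ + 3 ≡ + 2 ℤ.- + 2 ℤ.* (-1ℤ ℤ.* u ℤ.+ 0ℤ)
lowered-triple-δ p u rewrite δ-refl p =
  solve 1 (λ u → con -1ℤ :- con (+ 2) :* (con -1ℤ :* u :+ con 0ℤ) :+ con (+ 3) :=
                 con (+ 2) :- con (+ 2) :* (con -1ℤ :* u :+ con 0ℤ)) refl u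
  where
  open +-*-Solver

lowered-lowered-δ : ∀ {n} {p q : Fin n} → p ≢ q →
  (-1ℤ ℤ.* (-1ℤ ℤ.* δ p p ℤ.+ 0ℤ ℤ.* δ p p) ℤ.+ 0ℤ ℤ.* (-1ℤ ℤ.* δ p p ℤ.+ 0ℤ ℤ.* δ p p))
    ℤ.- + 2 ℤ.* (-1ℤ ℤ.* (-1ℤ ℤ.* δ p q ℤ.+ 0ℤ ℤ.* δ p q) ℤ.+ 0ℤ ℤ.* (-1ℤ ℤ.* δ p q ℤ.+ 0ℤ ℤ.* δ p q))
    ℤ.+ (-1ℤ ℤ.* (-1ℤ ℤ.* δ q q ℤ.+ 0ℤ ℤ.* δ q q) ℤ.+ 0ℤ ℤ.* (-1ℤ ℤ.* δ q q ℤ.+ 0ℤ ℤ.* δ q q)) ≡ + 2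
lowered-lowered-δ {p = p} {q} p≢q rewrite δ-refl p | δ-refl q | δ-≢ p≢q = refl

shifted-triple-δ : ∀ {n} {p q : Fin n} → p ≢ q → ∀ u v →
  -1ℤ ℤ.+ (1ℤ ℤ.* (1ℤ ℤ.* δ p p ℤ.+ -1ℤ ℤ.* δ q p) ℤ.+ -1ℤ ℤ.* (1ℤ ℤ.* δ p q ℤ.+ -1ℤ ℤ.* δ q q))
    ℤ.- + 2 ℤ.* (1ℤ ℤ.* u ℤ.+ -1ℤ ℤ.* v) ℤ.+ + 3 ≡ + 1 ℤ.- + 2 ℤ.* (1ℤ ℤ.* u ℤ.+ -1ℤ ℤ.* v) ℤ.+ + 3
shifted-triple-δ {p = p} {q} p≢q u v rewrite δ-refl p | δ-refl q | δ-≢ p≢q | δ-≢ (≢-sym p≢q) = refl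

centre-shifted-δ : ∀ {n} {p q : Fin n} → p ≢ q →
  0ℤ ℤ.- + 2 ℤ.* (1ℤ ℤ.* 0ℤ ℤ.+ -1ℤ ℤ.* 0ℤ)
    ℤ.+ (1ℤ ℤ.* (1ℤ ℤ.* δ p p ℤ.+ -1ℤ ℤ.* δ q p) ℤ.+ -1ℤ ℤ.* (1ℤ ℤ.* δ p q ℤ.+ -1ℤ ℤ.* δ q q)) ≡ + 2
centre-shifted-δ {p = p} {q} p≢q rewrite δ-refl p | δ-refl q | δ-≢ p≢q | δ-≢ (≢-sym p≢q) = refl

-- The squared distance of two vectors of Y, in terms of the coincidences of their exceptional coordinates.
shiftedForm : ℤ → ℤ → ℤ → ℤ → ℤ
shiftedForm pr qr ps qs = + 2 ℤ.- + 2 ℤ.* (1ℤ ℤ.* (1ℤ ℤ.* pr ℤ.+ -1ℤ ℤ.* qr) ℤ.+ -1ℤ ℤ.* (1ℤ ℤ.* ps ℤ.+ -1ℤ ℤ.* qs)) ℤ.+ + 2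

shifted-shifted-δ : ∀ {n} {p q r s : Fin n} → p ≢ q → r ≢ s →
  (1ℤ ℤ.* (1ℤ ℤ.* δ p p ℤ.+ -1ℤ ℤ.* δ q p) ℤ.+ -1ℤ ℤ.* (1ℤ ℤ.* δ p q ℤ.+ -1ℤ ℤ.* δ q q))
    ℤ.- + 2 ℤ.* (1ℤ ℤ.* (1ℤ ℤ.* δ p r ℤ.+ -1ℤ ℤ.* δ q r) ℤ.+ -1ℤ ℤ.* (1ℤ ℤ.* δ p s ℤ.+ -1ℤ ℤ.* δ q s))
    ℤ.+ (1ℤ ℤ.* (1ℤ ℤ.* δ r r ℤ.+ -1ℤ ℤ.* δ s r) ℤ.+ -1ℤ ℤ.* (1ℤ ℤ.* δ r s ℤ.+ -1ℤ ℤ.* δ s s))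
  ≡ shiftedForm (δ p r) (δ q r) (δ p s) (δ q s)
shifted-shifted-δ {p = p} {q} {r} {s} p≢q r≢s
  rewrite δ-refl p | δ-refl q | δ-≢ p≢q | δ-≢ (≢-sym p≢q)
        | δ-refl r | δ-refl s | δ-≢ r≢s | δ-≢ (≢-sym r≢s) = refl

module PairwiseDistances (R : CompleteOrderedField) where
  open CompleteOrderedField R hiding (zero; refl; sym; trans)
  open Euclidean R
  open IntegerEmbedding R
  open SquareRoots R
  open Coordinates R
  open Arrangements R
  private module R = CommutativeRing commutativeRing
  open ≈-Reasoning R.setoid
  open IsStrictPartialOrder isStrictPartialOrder using () renaming (irrefl to <-irrefl)

  AllowedPair : ∀ {n} → Point n → Point n → Set
  AllowedPair x y = ∃[ d ] Allowed d × dist² x y ≈ ι d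

  ≋-refl : ∀ {n} {x : Point n} → x ≋ x
  ≋-refl t = R.refl

  ≋-sym : ∀ {n} {x y : Point n} → x ≋ y → y ≋ x
  ≋-sym x≋y t = R.sym (x≋y t)

  ≋-trans : ∀ {n} {x y z : Point n} → x ≋ y → y ≋ z → x ≋ z
  ≋-trans x≋y y≋z t = R.trans (x≋y t) (y≋z t)

  dist²-refl : ∀ {n} (x : Point n) → dist² x x ≈ 0#
  dist²-refl {zero}  x = R.refl
  dist²-refl {suc n} x = R.trans (R.+-cong
    (solve 1 (λ x → (x :- x) :* (x :- x) := con 0ℤ) R.refl (x zero)) (dist²-refl (x ∘ suc))) (R.+-identityˡ _)

  ≋⇒dist²≈0 : ∀ {n} {x y : Point n} → x ≋ y → dist² x y ≈ 0#
  ≋⇒dist²≈0 {y = y} x≋y = R.trans (dist²-cong x≋y ≋-refl) (dist²-refl y)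

  dist²-nonneg : ∀ {n} (x y : Point n) → 0# ≤ dist² x y
  dist²-nonneg {zero}  x y = <-irrefl R.refl
  dist²-nonneg {suc n} x y = nonneg+nonneg (square-nonneg _) (dist²-nonneg (x ∘ suc) (y ∘ suc))

  nonneg+nonneg≈0 : ∀ {x y} → 0# ≤ x → 0# ≤ y → x + y ≈ 0# → x ≈ 0#
  nonneg+nonneg≈0 {x} {y} 0≤x 0≤y x+y≈0 = neither-sign⇒≈0 0≤x λ 0<x →
    <-irrefl (R.sym x+y≈0) (<-resp R.refl (R.+-comm y x) (nonneg+pos 0≤y 0<x))

  dist²≈0⇒≋ : ∀ {n} (x y : Point n) → dist² x y ≈ 0# → x ≋ y
  dist²≈0⇒≋ {suc n} x y eq zero    = zero-difference (square≈0
    (nonneg+nonneg≈0 (square-nonneg _) (dist²-nonneg (x ∘ suc) (y ∘ suc)) eq))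
  dist²≈0⇒≋ {suc n} x y eq (suc t) = dist²≈0⇒≋ (x ∘ suc) (y ∘ suc)
    (nonneg+nonneg≈0 (dist²-nonneg (x ∘ suc) (y ∘ suc)) (square-nonneg _) (R.trans (R.+-comm _ _) eq)) t

  allowed-resp : ∀ {n} {x x′ y y′ : Point n} → x ≋ x′ → y ≋ y′ → AllowedPair x y → AllowedPair x′ y′
  allowed-resp x≋x′ y≋y′ (d , allowed , eq) =
    d , allowed , R.trans (dist²-cong (≋-sym x≋x′) (≋-sym y≋y′)) eq

  allowed-sym : ∀ {n} {x y : Point n} → AllowedPair x y → AllowedPair y x
  allowed-sym {x = x} {y} (d , allowed , eq) = d , allowed , R.trans (dist²-sym y x) eq

  allowed⇒≉ : ∀ {n} {x y : Point n} → AllowedPair x y → ¬ (x ≋ y)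
  allowed⇒≉ (d , allowed , eq) x≋y with ι-zero d (R.trans (R.sym eq) (≋⇒dist²≈0 x≋y)) | allowed
  ... | refl | ()

  tripleForm : ℤ → ℤ → ℤ → ℤ
  tripleForm u v w = + 3 ℤ.- + 2 ℤ.* (u ℤ.+ v ℤ.+ w) ℤ.+ + 3

  triple-triple-dist² : ∀ {n} {a b c i j l : Fin n} → Distinct₃ a b c → Distinct₃ i j l →
    ∀ {u v w} → δ³ a b c i ≡ u → δ³ a b c j ≡ v → δ³ a b c l ≡ w →
    dist² (tripleSum a b c) (tripleSum i j l) ≈ ι (tripleForm u v w)
  triple-triple-dist² {a = a} {b} {c} {i} {j} {l} abc ijl {u} {v} {w} refl refl refl = begin
    dist² (tripleSum a b c) (tripleSum i j l)
      ≈⟨ dist²-tripleSum (tripleSum a b c) ijl ⟩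
    tripleSum a b c ∙ tripleSum a b c - ι (+ 2) * (ι u + ι v + ι w) + ι (+ 3)
      ≈⟨ R.+-congʳ (R.+-cong (tripleSum∙tripleSum abc) (R.-‿cong (R.*-congˡ (R.sym (ι-sum₃ (δ³ a b c) i j l))))) ⟩
    ι (+ 3) - ι (+ 2) * ι (u ℤ.+ v ℤ.+ w) + ι (+ 3)
      ≈⟨ R.trans (ι-+ (+ 3 ℤ.- + 2 ℤ.* (u ℤ.+ v ℤ.+ w)) (+ 3)) (R.+-congʳ
           (R.trans (ι-− (+ 3) (+ 2 ℤ.* (u ℤ.+ v ℤ.+ w))) (R.+-congˡ (R.-‿cong (ι-* (+ 2) (u ℤ.+ v ℤ.+ w)))))) ⟨
    ι (tripleForm u v w) ∎

  triple-triple : ∀ {n} {a b c i j l : Fin n} → Distinct₃ a b c → Distinct₃ i j l →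
                  tripleSum a b c ≋ tripleSum i j l ⊎ AllowedPair (tripleSum a b c) (tripleSum i j l)
  triple-triple {a = a} {b} {c} {i} {j} {l} abc ijl =
    split (indicator abc i) (indicator abc j) (indicator abc l)
    where
    x : Point _
    x = tripleSum a b c

    dist≈ : ∀ {u v w} → δ³ a b c i ≡ u → δ³ a b c j ≡ v → δ³ a b c l ≡ w →
            dist² x (tripleSum i j l) ≈ ι (tripleForm u v w)
    dist≈ = triple-triple-dist² abc ijl

    split : Indicator a b c i → Indicator a b c j → Indicator a b c l →
            x ≋ tripleSum i j l ⊎ AllowedPair x (tripleSum i j l)
    -- Three common indices give distance 0, which identifies the vectors even if the triples are
    -- listed in different orders.
    split (inside _ u)          (inside _ v)          (inside _ w)          =
      inj₁ (dist²≈0⇒≋ x (tripleSum i j l) (dist≈ u v w))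
    split (inside _ u)          (inside _ v)          (outside _ _ _ w)   = inj₂ (_ , two , dist≈ u v w)
    split (inside _ u)          (outside _ _ _ v)   (inside _ w)          = inj₂ (_ , two , dist≈ u v w)
    split (outside _ _ _ u)   (inside _ v)          (inside _ w)          = inj₂ (_ , two , dist≈ u v w)
    split (inside _ u)          (outside _ _ _ v)   (outside _ _ _ w)   = inj₂ (_ , four , dist≈ u v w)
    split (outside _ _ _ u)   (inside _ v)          (outside _ _ _ w)   = inj₂ (_ , four , dist≈ u v w)
    split (outside _ _ _ u)   (outside _ _ _ v)   (inside _ w)          = inj₂ (_ , four , dist≈ u v w)
    split (outside _ _ _ u)   (outside _ _ _ v)   (outside _ _ _ w)   = inj₂ (_ , six , dist≈ u v w)

  -- With `½-cofactor`, the two hypotheses of `dist²-twoOff-tripleSum` for α + β = -1: 8·½ - 1 = 3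
  -- and ½·(-1 - 3) = -2. The versions with ⅓ belong to α + β = 0.
  ½-sum : ι (+ 8) * ½ + ι -1ℤ ≈ ι (+ 3)
  ½-sum = linear (ι (+ 4)) (difference-zero 2½≈1)
    (solve 1 (λ h → con (+ 8) :* h :+ con -1ℤ :- con (+ 3) := con (+ 4) :* (con (+ 2) :* h :- con 1ℤ)) R.refl ½)

  ½-cofactor : ½ * ι (ℤ.- + 4) ≈ ι (ℤ.- + 2)
  ½-cofactor = linear (ι (ℤ.- + 2)) (difference-zero 2½≈1)
    (solve 1 (λ h → h :* con (ℤ.- + 4) :- con (ℤ.- + 2) := con (ℤ.- + 2) :* (con (+ 2) :* h :- con 1ℤ)) R.refl ½)

  ⅓-sum : ι (+ 9) * ⅓ + ι 0ℤ ≈ ι (+ 3)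
  ⅓-sum = linear (ι (+ 3)) (difference-zero 3⅓≈1)
    (solve 1 (λ h → con (+ 9) :* h :+ con 0ℤ :- con (+ 3) := con (+ 3) :* (con (+ 3) :* h :- con 1ℤ)) R.refl ⅓)

  ⅓-cofactor : ⅓ * ι (ℤ.- + 3) ≈ ι -1ℤ
  ⅓-cofactor = linear (ι -1ℤ) (difference-zero 3⅓≈1)
    (solve 1 (λ h → h :* con (ℤ.- + 3) :- con -1ℤ := con -1ℤ :* (con (+ 3) :* h :- con 1ℤ)) R.refl ⅓)

  lowered-triple : ∀ p {i j l} → Distinct₃ i j l → AllowedPair (lowered p) (tripleSum i j l)
  lowered-triple p {i} {j} {l} ijl = split (indicator ijl p)
    where
    dist≈ : ∀ {u} → δ³ i j l p ≡ u → dist² (lowered p) (tripleSum i j l) ≈ ι (+ 2 ℤ.- + 2 ℤ.* (-1ℤ ℤ.* u ℤ.+ 0ℤ))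
    dist≈ refl = R.trans (dist²-twoOff-tripleSum ½ -1ℤ p 0ℤ p (ℤ.- + 2) ijl ½-sum ½-cofactor)
                         (≡⇒ι≈ (lowered-triple-δ p (δ³ i j l p)))

    split : Indicator i j l p → AllowedPair (lowered p) (tripleSum i j l)
    split (inside _ u)        = _ , four , dist≈ u
    split (outside _ _ _ u) = _ , two , dist≈ u

  lowered-lowered : ∀ {p q} → p ≢ q → AllowedPair (lowered p) (lowered q)
  lowered-lowered {p} {q} p≢q = _ , two ,
    R.trans (dist²-twoOff ½ -1ℤ p 0ℤ p -1ℤ q 0ℤ q refl) (≡⇒ι≈ (lowered-lowered-δ p≢q))

  -- Regarding `x₀` as a vector with two zero deviations brings it under the general distance
  -- formulas.
  x₀≋ : ∀ p q → twoOff ⅓ 0ℤ p 0ℤ q ≋ x₀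
  x₀≋ p q t = R.trans (R.+-identityʳ ⅓) (R.sym 1/3≈⅓)

  x₀-triple : ∀ {i j l} → Distinct₃ i j l → AllowedPair x₀ (tripleSum i j l)
  x₀-triple {i} {j} {l} ijl = allowed-resp {y = tripleSum i j l} (x₀≋ i i) ≋-refl
    (_ , two , dist²-twoOff-tripleSum ⅓ 0ℤ i 0ℤ i -1ℤ ijl ⅓-sum ⅓-cofactor)

  shifted-triple : ∀ {p q i j l} → p ≢ q → Distinct₃ i j l → AllowedPair (shifted p q) (tripleSum i j l)
  shifted-triple {p} {q} {i} {j} {l} p≢q ijl = split (indicator ijl p) (indicator ijl q)
    where
    dist≈ : ∀ {u v} → δ³ i j l p ≡ u → δ³ i j l q ≡ v →
            dist² (shifted p q) (tripleSum i j l) ≈ ι (+ 1 ℤ.- + 2 ℤ.* (1ℤ ℤ.* u ℤ.+ -1ℤ ℤ.* v) ℤ.+ + 3)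
    dist≈ refl refl = R.trans (dist²-twoOff-tripleSum ⅓ 1ℤ p -1ℤ q -1ℤ ijl ⅓-sum ⅓-cofactor)
                              (≡⇒ι≈ (shifted-triple-δ p≢q (δ³ i j l p) (δ³ i j l q)))

    split : Indicator i j l p → Indicator i j l q → AllowedPair (shifted p q) (tripleSum i j l)
    split (inside _ u)        (inside _ v)        = _ , four , dist≈ u v
    split (inside _ u)        (outside _ _ _ v) = _ , two , dist≈ u v
    split (outside _ _ _ u) (inside _ v)        = _ , six , dist≈ u v
    split (outside _ _ _ u) (outside _ _ _ v) = _ , four , dist≈ u v

  x₀-shifted : ∀ {p q} → p ≢ q → AllowedPair x₀ (shifted p q)
  x₀-shifted {p} {q} p≢q = allowed-resp {y = shifted p q} (x₀≋ p q) ≋-refl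
    (_ , two , R.trans (dist²-twoOff ⅓ 0ℤ p 0ℤ q 1ℤ p -1ℤ q refl) (≡⇒ι≈ (centre-shifted-δ p≢q)))

  shifted-shifted-dist² : ∀ {p q r s pr qr ps qs} → p ≢ q → r ≢ s →
    δ p r ≡ pr → δ q r ≡ qr → δ p s ≡ ps → δ q s ≡ qs →
    dist² (shifted p q) (shifted r s) ≈ ι (shiftedForm pr qr ps qs)
  shifted-shifted-dist² {p} {q} {r} {s} p≢q r≢s refl refl refl refl =
    R.trans (dist²-twoOff ⅓ 1ℤ p -1ℤ q 1ℤ r -1ℤ s refl) (≡⇒ι≈ (shifted-shifted-δ p≢q r≢s))

  -- The squared distance is 4 minus twice the inner product of the roots e_p - e_q and e_r - e_s.
  -- That product is 2 for equal roots, -2 for opposite ones, and otherwise -1, 0 or 1, which gives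
  -- 6, 4 or 2.
  shifted-shifted : ∀ {p q r s} → p ≢ q → r ≢ s →
    (p ≡ r × q ≡ s) ⊎ AllowedPair (shifted p q) (shifted r s) ⊎ (p ≡ s × q ≡ r)
  shifted-shifted {p} {q} {r} {s} p≢q r≢s with p ≟ᶠ r | q ≟ᶠ s
  ... | yes refl | yes refl = inj₁ (refl , refl)
  ... | yes refl | no q≢s   = inj₂ (inj₁ (_ , two ,
    shifted-shifted-dist² p≢q r≢s (δ-refl p) (δ-≢ (≢-sym p≢q)) (δ-≢ r≢s) (δ-≢ q≢s)))
  ... | no p≢r   | yes refl = inj₂ (inj₁ (_ , two ,
    shifted-shifted-dist² p≢q r≢s (δ-≢ p≢r) (δ-≢ (≢-sym r≢s)) (δ-≢ p≢q) (δ-refl q)))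
  ... | no p≢r   | no q≢s   with p ≟ᶠ s | q ≟ᶠ r
  ...   | yes refl | yes refl = inj₂ (inj₂ (refl , refl))
  ...   | yes refl | no q≢r   = inj₂ (inj₁ (_ , six ,
    shifted-shifted-dist² p≢q r≢s (δ-≢ p≢r) (δ-≢ q≢r) (δ-refl p) (δ-≢ q≢s)))
  ...   | no p≢s   | yes refl = inj₂ (inj₁ (_ , six ,
    shifted-shifted-dist² p≢q r≢s (δ-≢ p≢r) (δ-refl q) (δ-≢ p≢s) (δ-≢ q≢s)))
  ...   | no p≢s   | no q≢r   = inj₂ (inj₁ (_ , four ,
    shifted-shifted-dist² p≢q r≢s (δ-≢ p≢r) (δ-≢ q≢r) (δ-≢ p≢s) (δ-≢ q≢s)))

  antipodal-dist² : ∀ {p q} → p ≢ q → dist² (shifted p q) (shifted q p) ≈ ι (+ 8)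
  antipodal-dist² {p} {q} p≢q =
    shifted-shifted-dist² p≢q (≢-sym p≢q) (δ-≢ p≢q) (δ-refl q) (δ-refl p) (δ-≢ (≢-sym p≢q))

  antipodal-disallowed : ∀ {p q} → p ≢ q → ¬ AllowedPair (shifted p q) (shifted q p)
  antipodal-disallowed p≢q (d , allowed , eq) with ι-injective {d} {+ 8} (R.trans (R.sym eq) (antipodal-dist² p≢q)) | allowed
  ... | refl | ()

  antipodal-≉ : ∀ {p q} → p ≢ q → ¬ (shifted p q ≋ shifted q p)
  antipodal-≉ p≢q eq with ι-zero (+ 8) (R.trans (R.sym (antipodal-dist² p≢q)) (≋⇒dist²≈0 eq))
  ... | ()

-- Points at allowed distances from J̃

-- All offsets are odd, so their differences are even.
halfStep : ∀ {c c′} → c List.∈ offsets → c′ List.∈ offsets →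
           ∃[ d ] d List.∈ steps × + 2 ℤ.* d ≡ c ℤ.- c′
halfStep (here refl)                 (here refl)                 = + 0 , there (there (here refl)) , refl
halfStep (here refl)                 (there (here refl))         = + 1 , there (there (there (here refl))) , refl
halfStep (here refl)                 (there (there (here refl))) = + 2 , there (there (there (there (here refl)))) , refl
halfStep (there (here refl))         (here refl)                 = -[1+ 0 ] , there (here refl) , refl
halfStep (there (here refl))         (there (here refl))         = + 0 , there (there (here refl)) , refl
halfStep (there (here refl))         (there (there (here refl))) = + 1 , there (there (there (here refl))) , refl
halfStep (there (there (here refl))) (here refl)                 = -[1+ 1 ] , here refl , refl
halfStep (there (there (here refl))) (there (here refl))         = -[1+ 0 ] , there (here refl) , refl
halfStep (there (there (here refl))) (there (there (here refl))) = + 0 , there (there (here refl)) , refl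

step≤2 : ∀ {d} → d List.∈ steps → d ℤ.≤ + 2
step≤2 (here refl)                                 = ℤ.-≤+
step≤2 (there (here refl))                         = ℤ.-≤+
step≤2 (there (there (here refl)))                 = ℤ.+≤+ z≤n
step≤2 (there (there (there (here refl))))         = ℤ.+≤+ (s≤s z≤n)
step≤2 (there (there (there (there (here refl))))) = ℤ.+≤+ (s≤s (s≤s z≤n))

module Classification (R : CompleteOrderedField) where
  open CompleteOrderedField R hiding (zero; refl; sym; trans)
  open Euclidean R
  open IntegerEmbedding R
  open Coordinates R
  open Arrangements R
  open PairwiseDistances R
  private module R = CommutativeRing commutativeRing
  open SemiringSum R.semiring using (sum; sum-cong-≋)
  open ≈-Reasoning R.setoid

  data Exceptional : ∀ n → Point n → Set where
    low  : ∀ {x} p → x ≋ lowered p → Exceptional 8 x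
    mid  : ∀ {x} → x ≋ x₀ → Exceptional 9 x
    high : ∀ {x p q} → p ≢ q → x ≋ shifted p q → Exceptional 9 x

  private
    -- The difference of the two sides is n((3 - K)a - (Q - 2s + c)) + (3 - K)(3 - K - na).
    elimination : ∀ n a K Q s c → n * a + K ≈ ι (+ 3) →
      ι (+ 2) * (ι (+ 3) * a + s) ≈ a * ι (+ 3) + a * K + Q + c →
      (ι (+ 3) - K) * (ι (+ 3) - K) ≈ n * (Q - ι (+ 2) * s + c)
    elimination n a K Q s c eq eq′ = linear₂ (K - ι (+ 3)) n (difference-zero eq) (difference-zero eq′)
      (solve 6 (λ n a K Q s c →
        (con (+ 3) :- K) :* (con (+ 3) :- K) :- n :* (Q :- con (+ 2) :* s :+ c) :=
        (K :- con (+ 3)) :* (n :* a :+ K :- con (+ 3)) :+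
        n :* (con (+ 2) :* (con (+ 3) :* a :+ s) :- (a :* con (+ 3) :+ a :* K :+ Q :+ c))) R.refl n a K Q s c)

    ½-unique : ∀ {a} → ι (+ 8) * a + ι -1ℤ ≈ ι (+ 3) → a ≈ ½
    ½-unique {a} eq = ι-cancel 7 (linear (ι 1ℤ) (difference-zero (R.trans eq (R.sym ½-sum)))
      (solve 2 (λ a h → con (+ 8) :* a :- con (+ 8) :* h :=
        con 1ℤ :* (con (+ 8) :* a :+ con -1ℤ :- (con (+ 8) :* h :+ con -1ℤ))) R.refl a ½))

    ⅓-unique : ∀ {a} → ι (+ 9) * a + ι 0ℤ ≈ ι (+ 3) → a ≈ ⅓
    ⅓-unique {a} eq = ι-cancel 8 (linear (ι 1ℤ) (difference-zero (R.trans eq (R.sym ⅓-sum)))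
      (solve 2 (λ a h → con (+ 9) :* a :- con (+ 9) :* h :=
        con 1ℤ :* (con (+ 9) :* a :+ con 0ℤ :- (con (+ 9) :* h :+ con 0ℤ))) R.refl a ⅓))

    -- A shape fixes n and both deviations; the coordinate sum 3 then fixes `a` as ½ or ⅓. In the
    -- mirrored shapes p and q exchange their roles.
    shape⇒exceptional : ∀ {n x a α p β q} → p ≢ q → Shape n α β → x ≋ twoOff a α p β q →
                        ι (+ n) * a + ι (α ℤ.+ β) ≈ ι (+ 3) → Exceptional n x
    shape⇒exceptional {p = p} {q = q} _ lowered₁ x≋ sum-eq = low p λ t → R.trans (x≋ t) (R.+-congʳ (½-unique sum-eq))
    shape⇒exceptional {p = p} {q = q} _ lowered₂ x≋ sum-eq = low q λ t → R.trans (x≋ t)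
      (R.+-cong (½-unique sum-eq) (≡⇒ι≈ (ℤ.+-comm 0ℤ (-1ℤ ℤ.* δ q t))))
    shape⇒exceptional {p = p} {q = q} _ centre x≋ sum-eq = mid λ t → R.trans (x≋ t)
      (R.trans (R.+-congʳ (⅓-unique sum-eq)) (x₀≋ p q t))
    shape⇒exceptional p≢q raised₁ x≋ sum-eq = high p≢q λ t → R.trans (x≋ t) (R.+-congʳ (⅓-unique sum-eq))
    shape⇒exceptional {p = p} {q = q} p≢q raised₂ x≋ sum-eq = high (≢-sym p≢q) λ t → R.trans (x≋ t)
      (R.+-cong (⅓-unique sum-eq) (≡⇒ι≈ (ℤ.+-comm (-1ℤ ℤ.* δ p t) (1ℤ ℤ.* δ q t))))

  module _ {n} (6≤n : 6 ℕ.≤ n) {x : Point n} (sum≈3 : sum x ≈ ι (+ 3))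
           (allowed : ∀ {i j l} → Distinct₃ i j l → AllowedPair x (tripleSum i j l)) where

    private
      abstract
        offset : ∀ {i j l} → Distinct₃ i j l →
                 ∃[ c ] c List.∈ offsets × ι (+ 2) * (x i + x j + x l) ≈ x ∙ x + ι c
        offset {i} {j} {l} ijl = convert (allowed ijl)
          where
          rearranged : ∀ d c → dist² x (tripleSum i j l) ≈ ι d → ι c ≈ ι (+ 3) - ι d →
                       ι (+ 2) * (x i + x j + x l) ≈ x ∙ x + ι c
          rearranged d c dist≈d c≈ = R.trans
            (linear (- ι 1ℤ) (difference-zero (R.trans (R.sym (dist²-tripleSum x ijl)) dist≈d))
              (solve 3 (λ N S d → con (+ 2) :* S :- (N :+ (con (+ 3) :- d)) :=
                 (:- con 1ℤ) :* (N :- con (+ 2) :* S :+ con (+ 3) :- d)) R.refl (x ∙ x) (x i + x j + x l) (ι d)))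
            (R.+-congˡ (R.sym c≈))

          convert : AllowedPair x (tripleSum i j l) →
                    ∃[ c ] c List.∈ offsets × ι (+ 2) * (x i + x j + x l) ≈ x ∙ x + ι c
          convert (_ , two  , eq) = _ , here refl , rearranged (+ 2) 1ℤ eq
            (solve 0 (con 1ℤ := con (+ 3) :- con (+ 2)) R.refl)
          convert (_ , four , eq) = _ , there (here refl) , rearranged (+ 4) -1ℤ eq
            (solve 0 (con -1ℤ := con (+ 3) :- con (+ 4)) R.refl)
          convert (_ , six  , eq) = _ , there (there (here refl)) , rearranged (+ 6) -[1+ 2 ] eq
            (solve 0 (con -[1+ 2 ] := con (+ 3) :- con (+ 6)) R.refl)

        -- Subtracting two instances of `offset` removes the unknown `x ∙ x`.
        difference : ∀ {i j l i′ j′ l′} → Distinct₃ i j l → Distinct₃ i′ j′ l′ →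
                     ∃[ d ] d List.∈ steps × x i + x j + x l ≈ x i′ + x j′ + x l′ + ι d
        difference {i} {j} {l} {i′} {j′} {l′} ijl ijl′ = combine (offset ijl) (offset ijl′)
          where
          S S′ : Carrier
          S  = x i + x j + x l
          S′ = x i′ + x j′ + x l′
          combine : (∃[ c ] c List.∈ offsets × ι (+ 2) * S ≈ x ∙ x + ι c) →
                    (∃[ c ] c List.∈ offsets × ι (+ 2) * S′ ≈ x ∙ x + ι c) →
                    ∃[ d ] d List.∈ steps × S ≈ S′ + ι d
          combine (c , c∈ , eq) (c′ , c′∈ , eq′) = halved (halfStep c∈ c′∈)
            where
            halved : (∃[ d ] d List.∈ steps × + 2 ℤ.* d ≡ c ℤ.- c′) → ∃[ d ] d List.∈ steps × S ≈ S′ + ι d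
            halved (d , d∈ , 2d≡) = d , d∈ , ι-cancel 1 (begin
              ι (+ 2) * S                       ≈⟨ eq ⟩
              x ∙ x + ι c                       ≈⟨ solve 3 (λ N c c′ → N :+ c := N :+ c′ :+ (c :- c′)) R.refl (x ∙ x) (ι c) (ι c′) ⟩
              x ∙ x + ι c′ + (ι c - ι c′)       ≈⟨ R.+-cong (R.sym eq′) (R.sym (R.trans (ι-+ c (ℤ.- c′)) (R.+-congˡ (ι-neg c′)))) ⟩
              ι (+ 2) * S′ + ι (c ℤ.- c′)       ≈⟨ R.+-congˡ (R.trans (≡⇒ι≈ (≡.sym 2d≡)) (ι-* (+ 2) d)) ⟩
              ι (+ 2) * S′ + ι (+ 2) * ι d      ≈⟨ R.distribˡ _ _ _ ⟨
              ι (+ 2) * (S′ + ι d)              ∎)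

        -- Complete i and j by the same two fresh indices: the triple sums then differ exactly as x
        -- i and x j do.
        step : ∀ i j → ∃[ d ] d List.∈ steps × x i ≈ x j + ι d
        step i j with i ≟ᶠ j
        ... | yes refl = 0ℤ , there (there (here refl)) , R.sym (R.+-identityʳ (x i))
        ... | no i≢j
          with u , u≢i ∷ u≢j ∷ [] ← fresh (i ∷ j ∷ []) (ℕ.≤-trans (s≤s (s≤s (s≤s z≤n))) 6≤n)
          with v , v≢u ∷ v≢i ∷ v≢j ∷ [] ← fresh (u ∷ i ∷ j ∷ []) (ℕ.≤-trans (s≤s (s≤s (s≤s (s≤s z≤n)))) 6≤n)
          = strip (difference {i} {u} {v} {j} {u} {v} (≢-sym u≢i , ≢-sym v≢i , ≢-sym v≢u) (≢-sym u≢j , ≢-sym v≢j , ≢-sym v≢u))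
          where
          strip : (∃[ d ] d List.∈ steps × x i + x u + x v ≈ x j + x u + x v + ι d) →
                  ∃[ d ] d List.∈ steps × x i ≈ x j + ι d
          strip (d , d∈ , eq) = d , d∈ , linear (ι 1ℤ) (difference-zero eq)
            (solve 5 (λ i j u v d → i :- (j :+ d) := con 1ℤ :* (i :+ u :+ v :- (j :+ u :+ v :+ d))) R.refl
              (x i) (x j) (x u) (x v) (ι d))

      module _ (o : Fin n) where

        -- Measuring from an arbitrary base coordinate `o` moves the vector into ℤ, where the
        -- matching argument can compare entries.
        k : Fin n → ℤ
        k i = proj₁ (step i o)

        x≈k : ∀ i → x i ≈ x o + ι (k i)
        x≈k i = proj₂ (proj₂ (step i o))

        abstract
          window : ∀ {i j l i′ j′ l′} → Distinct₃ i j l → Distinct₃ i′ j′ l′ →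
                   sum₃ k i′ j′ l′ ℤ.≤ sum₃ k i j l ℤ.+ + 2
          window {i} {j} {l} {i′} {j′} {l′} ijl ijl′ = bound (difference ijl′ ijl)
            where
            tripleSum≈ : ∀ i j l → x i + x j + x l ≈ ι (+ 3) * x o + ι (sum₃ k i j l)
            tripleSum≈ i j l = begin
              x i + x j + x l
                ≈⟨ R.+-cong (R.+-cong (x≈k i) (x≈k j)) (x≈k l) ⟩
              (x o + ι (k i)) + (x o + ι (k j)) + (x o + ι (k l))
                ≈⟨ solve 4 (λ a u v w → (a :+ u) :+ (a :+ v) :+ (a :+ w) := con (+ 3) :* a :+ (u :+ v :+ w)) R.refl
                     (x o) (ι (k i)) (ι (k j)) (ι (k l)) ⟩
              ι (+ 3) * x o + (ι (k i) + ι (k j) + ι (k l))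
                ≈⟨ R.+-congˡ (ι-sum₃ k i j l) ⟨
              ι (+ 3) * x o + ι (sum₃ k i j l) ∎

            bound : (∃[ d ] d List.∈ steps × x i′ + x j′ + x l′ ≈ x i + x j + x l + ι d) →
                    sum₃ k i′ j′ l′ ℤ.≤ sum₃ k i j l ℤ.+ + 2
            bound (d , d∈ , eq) = subst (ℤ._≤ sum₃ k i j l ℤ.+ + 2) (≡.sym k≡) (ℤ.+-monoʳ-≤ (sum₃ k i j l) (step≤2 d∈))
              where
              k≡ : sum₃ k i′ j′ l′ ≡ sum₃ k i j l ℤ.+ d
              k≡ = ι-injective (R.trans (linear (ι 1ℤ)
                (difference-zero (R.trans (R.sym (tripleSum≈ i′ j′ l′)) (R.trans eq (R.+-congʳ (tripleSum≈ i j l)))))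
                (solve 4 (λ a u v d → u :- (v :+ d) := con 1ℤ :* (con (+ 3) :* a :+ u :- (con (+ 3) :* a :+ v :+ d))) R.refl
                  (x o) (ι (sum₃ k i′ j′ l′)) (ι (sum₃ k i j l)) (ι d)))
                (R.sym (ι-+ (sum₃ k i j l) d)))

    -- The index `r` is a specimen of the ordinary coordinates, so `x r` is the common value a; the
    -- base coordinate, which may itself be exceptional, is forgotten.
    record Profile : Set where
      field
        p q   : Fin n
        p≢q   : p ≢ q
        r     : Fin n
        r≢p   : r ≢ p
        r≢q   : r ≢ q
        const : ∀ t → t ≢ p → t ≢ q → x t ≈ x r

    private
      profileAt : Fin n → Profile
      profileAt o
        with p , q , c , p≢q , off ← constantOffTwo ℤ._≟_ (k o) 6≤n (noUnequalMatching (k o) (window o))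
        with r , r≢p ∷ r≢q ∷ [] ← fresh (p ∷ q ∷ []) (ℕ.≤-trans (s≤s (s≤s (s≤s z≤n))) 6≤n)
        = record { p = p ; q = q ; p≢q = p≢q ; r = r ; r≢p = r≢p ; r≢q = r≢q
                 ; const = λ t t≢p t≢q → R.trans (x≈k o t)
                     (R.trans (R.+-congˡ (≡⇒ι≈ (≡.trans (off t t≢p t≢q) (≡.sym (off r r≢p r≢q))))) (R.sym (x≈k o r))) }

    abstract
      profile : Profile
      profile = profileAt (proj₁ (fresh [] (ℕ.≤-trans (s≤s z≤n) 6≤n)))

    module _ where
      open Profile profile

      private
        a : Carrier
        a = x r

        -- Taken relative to `r`, not to the base of the profile: this makes α and β members of
        -- `steps` and leaves deviation 0 elsewhere.
        α β : ℤ
        α = proj₁ (step p r)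
        β = proj₁ (step q r)

        values : Fin n → ℤ
        values t = α ℤ.* δ p t ℤ.+ β ℤ.* δ q t

        value-p : values p ≡ α
        value-p = ≡.trans (cong₂ (λ u v → α ℤ.* u ℤ.+ β ℤ.* v) (δ-refl p) (δ-≢ (≢-sym p≢q)))
                          (weights-p α β)
          where
          open +-*-Solver renaming (solve to solveℤ; con to conℤ; _:*_ to _⊗_; _:+_ to _⊕_; _:=_ to _⊜_)
          weights-p : ∀ α β → α ℤ.* 1ℤ ℤ.+ β ℤ.* 0ℤ ≡ α
          weights-p = solveℤ 2 (λ α β → α ⊗ conℤ 1ℤ ⊕ β ⊗ conℤ 0ℤ ⊜ α) refl

        value-q : values q ≡ β
        value-q = ≡.trans (cong₂ (λ u v → α ℤ.* u ℤ.+ β ℤ.* v) (δ-≢ p≢q) (δ-refl q))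
                          (weights-q α β)
          where
          open +-*-Solver renaming (solve to solveℤ; con to conℤ; _:*_ to _⊗_; _:+_ to _⊕_; _:=_ to _⊜_)
          weights-q : ∀ α β → α ℤ.* 0ℤ ℤ.+ β ℤ.* 1ℤ ≡ β
          weights-q = solveℤ 2 (λ α β → α ⊗ conℤ 0ℤ ⊕ β ⊗ conℤ 1ℤ ⊜ β) refl

        x≋twoOff : x ≋ twoOff a α p β q
        x≋twoOff t with t ≟ᶠ p | t ≟ᶠ q
        ... | yes refl | _        = R.trans (proj₂ (proj₂ (step p r))) (R.+-congˡ (≡⇒ι≈ (≡.sym value-p)))
        ... | no _     | yes refl = R.trans (proj₂ (proj₂ (step q r))) (R.+-congˡ (≡⇒ι≈ (≡.sym value-q)))
        ... | no t≢p   | no t≢q   = R.trans (const t t≢p t≢q) (R.sym (twoOff-ordinary a α β t≢p t≢q))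

        sum-eq : ι (+ n) * a + ι (α ℤ.+ β) ≈ ι (+ 3)
        sum-eq = R.trans (R.sym (sum-twoOff a α p β q)) (R.trans (R.sym (sum-cong-≋ x≋twoOff)) sum≈3)

        squares : x ∙ x ≈ a * ι (+ 3) + a * ι (α ℤ.+ β) + ι (α ℤ.* α ℤ.+ β ℤ.* β)
        squares = begin
          x ∙ x                                     ≈⟨ ∙-congˡ x x≋twoOff ⟩
          x ∙ twoOff a α p β q                      ≈⟨ ∙-comm x _ ⟩
          twoOff a α p β q ∙ x                      ≈⟨ ∙-congˡ (twoOff a α p β q) x≋twoOff ⟩
          twoOff a α p β q ∙ twoOff a α p β q       ≈⟨ twoOff∙twoOff a α p β q α p β q ⟩
          a * (ι (+ n) * a + ι (α ℤ.+ β)) + a * ι (α ℤ.+ β) + ι (α ℤ.* values p ℤ.+ β ℤ.* values q)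
            ≈⟨ R.+-cong (R.+-congʳ (R.*-congˡ sum-eq)) (≡⇒ι≈ (cong₂ (λ u v → α ℤ.* u ℤ.+ β ℤ.* v) value-p value-q)) ⟩
          a * ι (+ 3) + a * ι (α ℤ.+ β) + ι (α ℤ.* α ℤ.+ β ℤ.* β) ∎

        balanced : ∀ {i j l} s → Distinct₃ i j l → x i + x j + x l ≈ ι (+ 3) * a + ι s → Balanced n α β s
        balanced {i} {j} {l} s ijl eq = fromOffset (offset ijl)
          where
          fromOffset : (∃[ c ] c List.∈ offsets × ι (+ 2) * (x i + x j + x l) ≈ x ∙ x + ι c) → Balanced n α β s
          fromOffset (c , c∈ , eq′) = Any.map (λ { refl → ι-injective equation }) c∈
            where
            equation : ι (squareGap α β) ≈ ι (+ n ℤ.* cofactor α β s c)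
            equation = begin
              ι (squareGap α β)
                ≈⟨ R.trans (ι-* (+ 3 ℤ.- (α ℤ.+ β)) (+ 3 ℤ.- (α ℤ.+ β)))
                     (R.*-cong (ι-− (+ 3) (α ℤ.+ β)) (ι-− (+ 3) (α ℤ.+ β))) ⟩
              (ι (+ 3) - ι (α ℤ.+ β)) * (ι (+ 3) - ι (α ℤ.+ β))
                ≈⟨ elimination (ι (+ n)) a (ι (α ℤ.+ β)) (ι (α ℤ.* α ℤ.+ β ℤ.* β)) (ι s) (ι c) sum-eq
                     (R.trans (R.*-congˡ (R.sym eq)) (R.trans eq′ (R.+-congʳ squares))) ⟩
              ι (+ n) * (ι (α ℤ.* α ℤ.+ β ℤ.* β) - ι (+ 2) * ι s + ι c)
                ≈⟨ R.trans (ι-* (+ n) (cofactor α β s c)) (R.*-congˡ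
                     (R.trans (ι-+ (α ℤ.* α ℤ.+ β ℤ.* β ℤ.- + 2 ℤ.* s) c) (R.+-congʳ
                       (R.trans (ι-− (α ℤ.* α ℤ.+ β ℤ.* β) (+ 2 ℤ.* s)) (R.+-congˡ (R.-‿cong (ι-* (+ 2) s))))))) ⟨
              ι (+ n ℤ.* cofactor α β s c) ∎

        allBalanced : AllBalanced n α β
        allBalanced
          -- Two more ordinary indices suffice: the triples {r, u, v}, {p, r, u}, {q, r, u} and {p,
          -- q, r} have the deviations 0, α, β and α + β.
          with u , u≢p ∷ u≢q ∷ u≢r ∷ [] ← fresh (p ∷ q ∷ r ∷ []) (ℕ.≤-trans (s≤s (s≤s (s≤s (s≤s z≤n)))) 6≤n)
          with v , v≢p ∷ v≢q ∷ v≢r ∷ v≢u ∷ [] ← fresh (p ∷ q ∷ r ∷ u ∷ []) (ℕ.≤-trans (s≤s (s≤s (s≤s (s≤s (s≤s z≤n))))) 6≤n)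
          = balanced 0ℤ (≢-sym u≢r , ≢-sym v≢r , ≢-sym v≢u)
              (R.trans (R.+-cong (R.+-cong R.refl (const u u≢p u≢q)) (const v v≢p v≢q))
                (solve 1 (λ a → a :+ a :+ a := con (+ 3) :* a :+ con 0ℤ) R.refl a))
          ∷ balanced α (≢-sym r≢p , ≢-sym u≢p , ≢-sym u≢r)
              (R.trans (R.+-cong (R.+-congʳ (proj₂ (proj₂ (step p r)))) (const u u≢p u≢q))
                (solve 2 (λ a α → (a :+ α) :+ a :+ a := con (+ 3) :* a :+ α) R.refl a (ι α)))
          ∷ balanced β (≢-sym r≢q , ≢-sym u≢q , ≢-sym u≢r)
              (R.trans (R.+-cong (R.+-congʳ (proj₂ (proj₂ (step q r)))) (const u u≢p u≢q))
                (solve 2 (λ a β → (a :+ β) :+ a :+ a := con (+ 3) :* a :+ β) R.refl a (ι β)))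
          ∷ balanced (α ℤ.+ β) (p≢q , ≢-sym r≢p , ≢-sym r≢q)
              (R.trans (R.+-congʳ (R.+-cong (proj₂ (proj₂ (step p r))) (proj₂ (proj₂ (step q r)))))
                (R.trans (solve 3 (λ a α β → (a :+ α) :+ (a :+ β) :+ a := con (+ 3) :* a :+ (α :+ β)) R.refl a (ι α) (ι β))
                  (R.+-congˡ (R.sym (ι-+ α β)))))
          ∷ []

      exceptional : Exceptional n x
      exceptional = shape⇒exceptional p≢q
        (shape 6≤n (proj₁ (proj₂ (step p r))) (proj₁ (proj₂ (step q r))) allBalanced) x≋twoOff sum-eq

-- Enumerations

any-or-all : ∀ {A : Set} {P Q : Pred A 0ℓ} {xs} → All (λ x → P x ⊎ Q x) xs → Any P xs ⊎ All Q xs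
any-or-all []            = inj₂ []
any-or-all (inj₁ p ∷ _)  = inj₁ (here p)
any-or-all (inj₂ q ∷ ps) = Sum.map there (q ∷_) (any-or-all ps)

private
  threeDistinct : ∀ (a b c d : Fin 3) → a ≢ b → a ≢ c → b ≢ c → d ≡ a ⊎ d ≡ b ⊎ d ≡ c
  threeDistinct a b c d = from-yes (Fin.all? {n = 3} λ a → Fin.all? {n = 3} λ b → Fin.all? {n = 3} λ c → Fin.all? {n = 3} λ d →
    ¬? (a ≟ᶠ b) →-dec (¬? (a ≟ᶠ c) →-dec (¬? (b ≟ᶠ c) →-dec
      ((d ≟ᶠ a) ⊎-dec ((d ≟ᶠ b) ⊎-dec (d ≟ᶠ c)))))) a b c d

module _ (S : Setoid 0ℓ 0ℓ) where
  open Setoid S renaming (refl to ≈-refl; sym to ≈-sym; trans to ≈-trans)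
  open Membership S using (_∈_)
  open UniqueList S using (Unique)

  ∉-All : ∀ {x y xs} → All (λ z → ¬ (x ≈ z)) xs → y ∈ xs → ¬ (x ≈ y)
  ∉-All (x≉z ∷ _)  (here y≈z) x≈y = x≉z (≈-trans x≈y y≈z)
  ∉-All (_ ∷ x≉xs) (there y∈) x≈y = ∉-All x≉xs y∈ x≈y

  -- In a list without repetitions equality of members is equality of their positions, and positions
  -- can be compared.
  unique-decides : ∀ {x y xs} → Unique xs → x ∈ xs → y ∈ xs → x ≈ y ⊎ ¬ (x ≈ y)
  unique-decides (_ ∷ _)    (here x≈z) (here y≈z) = inj₁ (≈-trans x≈z (≈-sym y≈z))
  unique-decides (z≉ ∷ _)   (here x≈z) (there y∈) = inj₂ (λ x≈y → ∉-All z≉ y∈ (≈-trans (≈-sym x≈z) x≈y))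
  unique-decides (z≉ ∷ _)   (there x∈) (here y≈z) = inj₂ (λ x≈y → ∉-All z≉ x∈ (≈-trans (≈-sym y≈z) (≈-sym x≈y)))
  unique-decides (_ ∷ xs!)  (there x∈) (there y∈) = unique-decides xs! x∈ y∈

  index-injective : ∀ {x y xs} (x∈ : x ∈ xs) (y∈ : y ∈ xs) → index x∈ ≡ index y∈ → x ≈ y
  index-injective (here x≈z) (here y≈z) _ = ≈-trans x≈z (≈-sym y≈z)
  index-injective (there x∈) (there y∈) eq = index-injective x∈ y∈ (Fin.suc-injective eq)

  -- Three different members occupy all three positions, so a fourth shares a position with one of
  -- them. It will show that √2, 2 and √6 leave no room for another distance.
  three-exhaust : ∀ {a b c d xs} → length xs ≡ 3 → ¬ (a ≈ b) → ¬ (a ≈ c) → ¬ (b ≈ c) →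
                  a ∈ xs → b ∈ xs → c ∈ xs → d ∈ xs → d ≈ a ⊎ d ≈ b ⊎ d ≈ c
  three-exhaust {xs = _ ∷ _ ∷ _ ∷ []} refl a≉b a≉c b≉c a∈ b∈ c∈ d∈ =
    Sum.map (index-injective d∈ a∈) (Sum.map (index-injective d∈ b∈) (index-injective d∈ c∈))
      (threeDistinct (index a∈) (index b∈) (index c∈) (index d∈)
        (a≉b ∘ index-injective a∈ b∈) (a≉c ∘ index-injective a∈ c∈) (b≉c ∘ index-injective b∈ c∈))

  -- Injectivity is asked on `cs` only, because the parametrisations are not injective globally: a
  -- triple and its rearrangements give the same vertex.
  enumerates-map : ∀ {C : Set} {P : Pred Carrier 0ℓ} (f : C → Carrier) {cs} → Unique≡ cs →
    (∀ {c c′} → c List.∈ cs → c′ List.∈ cs → f c ≈ f c′ → c ≡ c′) →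
    (∀ {c x} → c List.∈ cs → x ≈ f c → P x) → (∀ {x} → P x → ∃[ c ] c List.∈ cs × x ≈ f c) →
    Enumerates S (map f cs) P
  enumerates-map {C} {P} f {cs} cs! injective sound complete = unique cs! injective , λ x → mk⇔ (to x) (from x)
    where
    unique : ∀ {cs} → Unique≡ cs → (∀ {c c′} → c List.∈ cs → c′ List.∈ cs → f c ≈ f c′ → c ≡ c′) → Unique (map f cs)
    unique []              inj = []
    unique {c ∷ cs} (c≢ ∷ cs!) inj = distinct c≢ (λ c′∈ → inj (here refl) (there c′∈)) ∷ unique cs! (λ u v → inj (there u) (there v))
      where
      distinct : ∀ {cs} → All (c ≢_) cs → (∀ {c′} → c′ List.∈ cs → f c ≈ f c′ → c ≡ c′) → All (λ y → ¬ (f c ≈ y)) (map f cs)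
      distinct []         _   = []
      distinct (c≢ ∷ c≢s) inj = (λ eq → c≢ (inj (here refl) eq)) ∷ distinct c≢s (λ u → inj (there u))
    to : ∀ x → P x → x ∈ map f cs
    to x Px with c , c∈ , x≈fc ← complete Px = Anyₚ.map⁺ (Any.map (λ { refl → x≈fc }) c∈)
    from : ∀ x → x ∈ map f cs → P x
    from x x∈ = let c , c∈ , x≈fc = List.find (Anyₚ.map⁻ x∈) in sound c∈ x≈fc

  enumerates-⊎ : ∀ {P Q : Pred Carrier 0ℓ} {xs ys} → Enumerates S xs P → Enumerates S ys Q →
                 (∀ {x y} → P x → Q y → ¬ (x ≈ y)) → Enumerates S (xs ++ ys) (λ x → P x ⊎ Q x)
  enumerates-⊎ {xs = xs} (xs! , P⇔) (ys! , Q⇔) disjoint =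
    Uniqueₚ.++⁺ S xs! ys! (λ {x} (x∈xs , x∈ys) →
      disjoint (Equivalence.from (P⇔ x) x∈xs) (Equivalence.from (Q⇔ x) x∈ys) ≈-refl) ,
    λ x → mk⇔ [ (λ Px → Membershipₚ.∈-++⁺ˡ S (Equivalence.to (P⇔ x) Px)) ,
                (λ Qx → Membershipₚ.∈-++⁺ʳ S xs (Equivalence.to (Q⇔ x) Qx)) ]′
              (λ x∈ → Sum.map (Equivalence.from (P⇔ x)) (Equivalence.from (Q⇔ x)) (Membershipₚ.∈-++⁻ S xs x∈))

  enumerates-singleton : ∀ a → Enumerates S (a ∷ []) (_≈ a)
  enumerates-singleton a = [] ∷ [] , λ x → mk⇔ here (λ { (here x≈a) → x≈a ; (there ()) })

  -- Running through the enumeration turns an alternative for each member into a global one; for an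
  -- arbitrary predicate this would be a nonconstructive principle.
  enumerated-any-or-all : ∀ {P A B : Pred Carrier 0ℓ} {xs} → Enumerates S xs P → B Respects _≈_ →
    (∀ {x} → P x → A x ⊎ B x) → (∃[ x ] P x × A x) ⊎ (∀ {x} → P x → B x)
  enumerated-any-or-all {P} {A} {B} {xs} (_ , P⇔) B-resp either =
    Sum.map (λ any → let x , Px = Any.satisfied any in x , Px)
            (λ all {x} Px → All.lookupₛ S B-resp all (Equivalence.to (P⇔ x) Px))
            (any-or-all (All.tabulateₛ S λ {x} x∈ →
              let Px = Equivalence.from (P⇔ x) x∈ in Sum.map₁ (Px ,_) (either Px)))

-- Increasing triples and pairs as normal forms

Triple : ℕ → Set
Triple n = Fin n × Fin n × Fin n

Increasing : ∀ {n} → Triple n → Set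
Increasing (i , j , l) = i <ᶠ j × j <ᶠ l

increasing? : ∀ {n} → Decidable (Increasing {n})
increasing? (i , j , l) = i Fin.<? j ×-dec j Fin.<? l

increasingTriples : ∀ n → List (Triple n)
increasingTriples n = filter increasing? (cartesianProduct (allFin n) (cartesianProduct (allFin n) (allFin n)))

increasingTriples-unique : ∀ n → Unique≡ (increasingTriples n)
increasingTriples-unique n = Unique≡.filter⁺ increasing?
  (Unique≡.cartesianProduct⁺ (Unique≡.allFin⁺ n) (Unique≡.cartesianProduct⁺ (Unique≡.allFin⁺ n) (Unique≡.allFin⁺ n)))

∈-increasingTriples⁺ : ∀ {n} {t : Triple n} → Increasing t → t List.∈ increasingTriples n
∈-increasingTriples⁺ inc = ∈-filter⁺ increasing?
  (∈-cartesianProduct⁺ (∈-allFin _) (∈-cartesianProduct⁺ (∈-allFin _) (∈-allFin _))) inc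

∈-increasingTriples⁻ : ∀ {n} {t : Triple n} → t List.∈ increasingTriples n → Increasing t
∈-increasingTriples⁻ {n} t∈ = proj₂ (∈-filter⁻ increasing? {xs = cartesianProduct (allFin n) (cartesianProduct (allFin n) (allFin n))} t∈)

increasing⇒distinct : ∀ {n} {i j l : Fin n} → Increasing (i , j , l) → Distinct₃ i j l
increasing⇒distinct (i<j , j<l) = Fin.<⇒≢ i<j , Fin.<⇒≢ (Fin.<-trans i<j j<l) , Fin.<⇒≢ j<l

infix 4 _∈₃_

_∈₃_ : ∀ {n} → Fin n → Triple n → Set
t ∈₃ (i , j , l) = t ≡ i ⊎ t ≡ j ⊎ t ≡ l

-- Containment as sets is enough: an increasing map from three elements to three elements is the
-- identity, so every other assignment contradicts the order.
increasing-unique : ∀ {n} {i j l a b c : Fin n} → Increasing (i , j , l) → Increasing (a , b , c) →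
  i ∈₃ (a , b , c) → j ∈₃ (a , b , c) → l ∈₃ (a , b , c) → (i , j , l) ≡ (a , b , c)
increasing-unique {n} (i<j , j<l) (a<b , b<c) = go i<j j<l
  where
  irrefl : ∀ {x : Fin n} → ¬ (x <ᶠ x)
  irrefl = Fin.<-irrefl refl
  go : ∀ {i j l} → i <ᶠ j → j <ᶠ l → i ∈₃ _ → j ∈₃ _ → l ∈₃ _ → (i , j , l) ≡ _
  go i<j j<l (inj₁ refl)        (inj₁ refl)        _                  = contradiction i<j irrefl
  go i<j j<l (inj₁ refl)        (inj₂ (inj₁ refl)) (inj₁ refl)        = contradiction (Fin.<-trans a<b j<l) irrefl
  go i<j j<l (inj₁ refl)        (inj₂ (inj₁ refl)) (inj₂ (inj₁ refl)) = contradiction j<l irrefl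
  go i<j j<l (inj₁ refl)        (inj₂ (inj₁ refl)) (inj₂ (inj₂ refl)) = refl
  go i<j j<l (inj₁ refl)        (inj₂ (inj₂ refl)) (inj₁ refl)        = contradiction (Fin.<-trans i<j j<l) irrefl
  go i<j j<l (inj₁ refl)        (inj₂ (inj₂ refl)) (inj₂ (inj₁ refl)) = contradiction (Fin.<-trans b<c j<l) irrefl
  go i<j j<l (inj₁ refl)        (inj₂ (inj₂ refl)) (inj₂ (inj₂ refl)) = contradiction j<l irrefl
  go i<j j<l (inj₂ (inj₁ refl)) (inj₁ refl)        _                  = contradiction (Fin.<-trans a<b i<j) irrefl
  go i<j j<l (inj₂ (inj₁ refl)) (inj₂ (inj₁ refl)) _                  = contradiction i<j irrefl
  go i<j j<l (inj₂ (inj₁ refl)) (inj₂ (inj₂ refl)) (inj₁ refl)        = contradiction (Fin.<-trans (Fin.<-trans a<b i<j) j<l) irrefl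
  go i<j j<l (inj₂ (inj₁ refl)) (inj₂ (inj₂ refl)) (inj₂ (inj₁ refl)) = contradiction (Fin.<-trans i<j j<l) irrefl
  go i<j j<l (inj₂ (inj₁ refl)) (inj₂ (inj₂ refl)) (inj₂ (inj₂ refl)) = contradiction j<l irrefl
  go i<j j<l (inj₂ (inj₂ refl)) (inj₁ refl)        _                  = contradiction (Fin.<-trans (Fin.<-trans a<b b<c) i<j) irrefl
  go i<j j<l (inj₂ (inj₂ refl)) (inj₂ (inj₁ refl)) _                  = contradiction (Fin.<-trans b<c i<j) irrefl
  go i<j j<l (inj₂ (inj₂ refl)) (inj₂ (inj₂ refl)) _                  = contradiction i<j irrefl

increasingPairs : ∀ n → List (Fin n × Fin n)
increasingPairs n = filter (λ (i , j) → i Fin.<? j) (cartesianProduct (allFin n) (allFin n))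

increasingPairs-unique : ∀ n → Unique≡ (increasingPairs n)
increasingPairs-unique n = Unique≡.filter⁺ (λ (i , j) → i Fin.<? j)
  (Unique≡.cartesianProduct⁺ (Unique≡.allFin⁺ n) (Unique≡.allFin⁺ n))

∈-increasingPairs⁺ : ∀ {n} {i j : Fin n} → i <ᶠ j → (i , j) List.∈ increasingPairs n
∈-increasingPairs⁺ = ∈-filter⁺ (λ (i , j) → i Fin.<? j) (∈-cartesianProduct⁺ (∈-allFin _) (∈-allFin _))

∈-increasingPairs⁻ : ∀ {n} {i j : Fin n} → (i , j) List.∈ increasingPairs n → i <ᶠ j
∈-increasingPairs⁻ {n} p∈ = proj₂ (∈-filter⁻ (λ (i , j) → i Fin.<? j) {xs = cartesianProduct (allFin n) (allFin n)} p∈)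

-- Three-distance sets containing J̃

module DistanceSets (R : CompleteOrderedField) where
  open CompleteOrderedField R hiding (zero; refl; sym; trans)
  open Euclidean R
  open IntegerEmbedding R
  open SquareRoots R
  open Coordinates R
  open Arrangements R
  open PairwiseDistances R
  open Classification R
  private module R = CommutativeRing commutativeRing
  open IsStrictPartialOrder isStrictPartialOrder using () renaming (irrefl to <-irreflᴿ)
  open Subset

  points : ℕ → Setoid 0ℓ 0ℓ
  points = ≋-setoid R.setoid

  ι-nonneg : ∀ k → 0# ≤ ι (+ k)
  ι-nonneg zero    = <-irreflᴿ R.refl
  ι-nonneg (suc k) k<0 = <-irreflᴿ R.refl (IsStrictPartialOrder.trans isStrictPartialOrder k<0 (0<fromℕ k))

  √ : ℕ → Carrier
  √ k = proj₁ (squareRoot (ι-nonneg k))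

  √-nonneg : ∀ k → 0# ≤ √ k
  √-nonneg k = proj₁ (proj₂ (squareRoot (ι-nonneg k)))

  √-square : ∀ k → √ k * √ k ≈ ι (+ k)
  √-square k = proj₂ (proj₂ (squareRoot (ι-nonneg k)))

  √-≉ : ∀ k l → k ≢ l → ¬ (√ k ≈ √ l)
  √-≉ k l k≢l eq = k≢l (ℤ.+-injective (ι-injective
    (R.trans (R.sym (√-square k)) (R.trans (R.*-cong eq eq) (√-square l)))))

  distances : List Carrier
  distances = √ 2 ∷ √ 4 ∷ √ 6 ∷ []

  open Membership R.setoid using () renaming (_∈_ to _∈ₗ_)

  allowed⇒∈distances : ∀ {n} {x y : Point n} {d} → AllowedPair x y → IsDistance x y d → d ∈ₗ distances
  allowed⇒∈distances {d = d} (_ , allowed , eq) (0≤d , d²≈) = locate allowed eq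
    where
    ≈√ : ∀ k {z} → z ≈ ι (+ k) → d * d ≈ z → d ≈ √ k
    ≈√ k z≈ d²≈z = square-injective 0≤d (√-nonneg k) (R.trans d²≈z (R.trans z≈ (R.sym (√-square k))))
    locate : ∀ {i} → Allowed i → _ ≈ ι i → d ∈ₗ distances
    locate two  z≈ = here (≈√ 2 z≈ d²≈)
    locate four z≈ = there (here (≈√ 4 z≈ d²≈))
    locate six  z≈ = there (there (here (≈√ 6 z≈ d²≈)))

  √-distance : ∀ {n} (x y : Point n) k {d} → dist² x y ≈ ι (+ k) → d ≈ √ k → IsDistance x y d
  √-distance x y k eq d≈ =
    (λ d<0 → √-nonneg k (<-resp d≈ R.refl d<0)) , R.trans (R.*-cong d≈ d≈) (R.trans (√-square k) (R.sym eq))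

  -- Pairwise compatibility replaces the counting of distances: for a finite set containing J̃ it is
  -- equivalent to being a three-distance set.
  Compatible : ∀ {n} → Point n → Point n → Set
  Compatible x y = x ≋ y ⊎ AllowedPair x y

  compatible-resp : ∀ {n} {x x′ y y′ : Point n} → x ≋ x′ → y ≋ y′ → Compatible x y → Compatible x′ y′
  compatible-resp x≋x′ y≋y′ = Sum.map (λ x≋y → ≋-trans (≋-sym x≋x′) (≋-trans x≋y y≋y′)) (allowed-resp x≋x′ y≋y′)

  compatible-sym : ∀ {n} {x y : Point n} → Compatible x y → Compatible y x
  compatible-sym {x = x} {y} = Sum.map ≋-sym (allowed-sym {x = x} {y})

  module _ {m : ℕ} where
    private
      n = 6 ℕ.+ m

      realized : ∀ {i j l i′ j′ l′ : Fin n} {u v w} k → Distinct₃ i j l → Distinct₃ i′ j′ l′ →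
        δ³ i j l i′ ≡ u → δ³ i j l j′ ≡ v → δ³ i j l l′ ≡ w → tripleForm u v w ≡ + suc k →
        ∀ {d} → d ≈ √ (suc k) → Distances (J̃ n 3) d
      realized {i} {j} {l} {i′} {j′} {l′} k ijl ijl′ u v w eq d≈ =
        tripleSum i j l , tripleSum i′ j′ l′ , tripleSum∈J̃ ijl , tripleSum∈J̃ ijl′ ,
        (λ x≋y → contradiction (ι-zero (+ suc k) (R.trans (R.sym dist≈) (≋⇒dist²≈0 x≋y))) λ ()) ,
        √-distance (tripleSum i j l) (tripleSum i′ j′ l′) (suc k) dist≈ d≈
        where
        dist≈ : dist² (tripleSum i j l) (tripleSum i′ j′ l′) ≈ ι (+ suc k)
        dist≈ = R.trans (triple-triple-dist² ijl ijl′ u v w) (≡⇒ι≈ eq)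

      -- The witnesses are pairs of triples with two, one and no common indices; the disjoint pair
      -- takes six indices.
      ∈distances⇒Distances-J̃ : ∀ {d} → d ∈ₗ distances → Distances (J̃ n 3) d
      ∈distances⇒Distances-J̃ (here d≈) =
        realized {0F} {1F} {2F} {0F} {1F} {3F} 1 ((λ ()) , (λ ()) , (λ ())) ((λ ()) , (λ ()) , (λ ())) refl refl refl refl d≈
      ∈distances⇒Distances-J̃ (there (here d≈)) =
        realized {0F} {1F} {2F} {0F} {3F} {4F} 3 ((λ ()) , (λ ()) , (λ ())) ((λ ()) , (λ ()) , (λ ())) refl refl refl refl d≈
      ∈distances⇒Distances-J̃ (there (there (here d≈))) =
        realized {0F} {1F} {2F} {3F} {4F} {5F} 5 ((λ ()) , (λ ()) , (λ ())) ((λ ()) , (λ ()) , (λ ())) refl refl refl refl d≈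

      Distances-⊆ : ∀ {A B : Subset n} → A ⊆ B → ∀ {d} → Distances A d → Distances B d
      Distances-⊆ A⊆B (x , y , x∈ , y∈ , rest) = x , y , A⊆B x∈ , A⊆B y∈ , rest

    -- The three distances of `J̃` are already all that `B` may have. For distinct x and y the root
    -- of `dist² x y` is a distance of `B`, hence one of those three.
    distanceSet⇒compatible : ∀ {B : Subset n} → IsDistanceSet 3 B → J̃ n 3 ⊆ B →
                             ∀ {x y} → x ∈ B → y ∈ B → Compatible x y
    distanceSet⇒compatible {B} ((xs , xs! , B⇔) , ds , (ds! , D⇔) , |ds|≡3) J⊆B {x} {y} x∈ y∈ =
      [ inj₁ , (λ x≉y → inj₂ (distinct x≉y)) ]′
        (unique-decides (points n) xs! (Equivalence.to (B⇔ x) x∈) (Equivalence.to (B⇔ y) y∈))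
      where
      √∈ds : ∀ {d} → d ∈ₗ distances → d ∈ₗ ds
      √∈ds {d} d∈ = Equivalence.to (D⇔ d) (Distances-⊆ {J̃ n 3} {B} J⊆B (∈distances⇒Distances-J̃ d∈))

      module _ (x≉y : ¬ (x ≋ y)) where
        root : ∃[ s ] 0# ≤ s × s * s ≈ dist² x y
        root = squareRoot (dist²-nonneg x y)

        s : Carrier
        s = proj₁ root

        square : ∀ k → s ≈ √ k → dist² x y ≈ ι (+ k)
        square k s≈ = R.trans (R.sym (proj₂ (proj₂ root))) (R.trans (R.*-cong s≈ s≈) (√-square k))

        distinct : AllowedPair x y
        distinct = [ (λ s≈ → _ , two , square 2 s≈) , [ (λ s≈ → _ , four , square 4 s≈) , (λ s≈ → _ , six , square 6 s≈) ]′ ]′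
          (three-exhaust R.setoid |ds|≡3 (√-≉ 2 4 λ ()) (√-≉ 2 6 λ ()) (√-≉ 4 6 λ ())
            (√∈ds (here R.refl)) (√∈ds (there (here R.refl))) (√∈ds (there (there (here R.refl))))
            (Equivalence.to (D⇔ s) (x , y , x∈ , y∈ , x≉y , proj₂ root)))

    compatible⇒distanceSet : ∀ {B : Subset n} → Finite (points n) (member B) → J̃ n 3 ⊆ B →
      (∀ {x y} → x ∈ B → y ∈ B → Compatible x y) → IsDistanceSet 3 B
    compatible⇒distanceSet {B} finite J⊆B compatible = finite , distances ,
      ( (√-≉ 2 4 (λ ()) ∷ √-≉ 2 6 (λ ()) ∷ []) ∷ (√-≉ 4 6 (λ ()) ∷ []) ∷ [] ∷ []
      , λ d → mk⇔
          (λ (x , y , x∈ , y∈ , x≉y , isDistance) →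
            [ (λ x≋y → contradiction x≋y x≉y) , (λ allowed → allowed⇒∈distances {x = x} {y} allowed isDistance) ]′ (compatible x∈ y∈))
          (λ d∈ → Distances-⊆ {J̃ n 3} {B} J⊆B (∈distances⇒Distances-J̃ d∈))) , refl

    -- Either z equals a listed point of `X`, or it is at an allowed distance from all of them; then
    -- `X` together with z is a three-distance set, and maximality puts z into `X`.
    maximal-contains : ∀ {X : Subset n} → IsMaximalDistanceSet 3 (H n 3) X → J̃ n 3 ⊆ X →
                       ∀ {z} → z ∈ H n 3 → (∀ {x} → x ∈ X → Compatible x z) → z ∈ X
    maximal-contains {X} (X⊆H , distanceSet@((xs , xs! , X⇔) , _) , maximal) J⊆X {z} z∈H compatible =
      [ present , absent ]′ (any-or-all (All.tabulateₛ (points n) λ x∈ → compatible (Equivalence.from (X⇔ _) x∈)))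
      where
      present : Any (_≋ z) xs → z ∈ X
      present z∈ = Equivalence.from (X⇔ z) (Any.map ≋-sym z∈)

      X+z : Subset n
      X+z = X ∪ ｛ z ｝

      absent : All (λ x → AllowedPair x z) xs → z ∈ X
      -- Allowed distances are nonzero, so z can be put in front of `xs` without creating a
      -- repetition.
      absent allowed = maximal X+z
        (λ { (inj₁ x∈) → X⊆H x∈ ; (inj₂ x≋z) → resp (H n 3) (≋-sym x≋z) z∈H })
        (compatible⇒distanceSet {X+z}
          (z ∷ xs , All.map (λ {x} allowed z≋x → allowed⇒≉ {x = x} {z} allowed (≋-sym z≋x)) allowed ∷ xs! ,
            λ x → mk⇔ [ (λ x∈ → there (Equivalence.to (X⇔ x) x∈)) , here ]′
                      (λ { (here x≋z) → inj₂ x≋z ; (there x∈) → inj₁ (Equivalence.from (X⇔ x) x∈) }))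
          (λ x∈ → inj₁ (J⊆X x∈))
          λ { (inj₁ x∈)  (inj₁ y∈)  → distanceSet⇒compatible {X} distanceSet J⊆X x∈ y∈
            ; (inj₁ x∈)  (inj₂ y≋z) → compatible-resp ≋-refl (≋-sym y≋z) (compatible x∈)
            ; (inj₂ x≋z) (inj₁ y∈)  → compatible-sym (compatible-resp ≋-refl (≋-sym x≋z) (compatible y∈))
            ; (inj₂ x≋z) (inj₂ y≋z) → inj₁ (≋-trans x≋z (≋-sym y≋z)) })
        inj₁ (inj₂ ≋-refl)

-- Sorting a triple without changing its vertex

exchange₁₂ : ∀ {n} (i j l t : Fin n) → δ³ j i l t ≡ δ³ i j l t
exchange₁₂ i j l t = cong (ℤ._+ δ l t) (ℤ.+-comm (δ j t) (δ i t))

exchange₂₃ : ∀ {n} (i j l t : Fin n) → δ³ i l j t ≡ δ³ i j l t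
exchange₂₃ i j l t = solve 3 (λ i j l → i :+ l :+ j := i :+ j :+ l) refl (δ i t) (δ j t) (δ l t)
  where
  open +-*-Solver

sorted : ∀ {n} {i j l : Fin n} → Distinct₃ i j l →
         ∃[ (a , b , c) ] Increasing {n} (a , b , c) × (∀ t → δ³ i j l t ≡ δ³ a b c t)
sorted {n} {i} {j} {l} (i≢j , i≢l , j≢l) with Fin.<-cmp i j | Fin.<-cmp j l | Fin.<-cmp i l
... | tri≈ _ i≡j _ | _            | _            = contradiction i≡j i≢j
... | _            | tri≈ _ j≡l _ | _            = contradiction j≡l j≢l
... | _            | _            | tri≈ _ i≡l _ = contradiction i≡l i≢l
... | tri< i<j _ _ | tri< j<l _ _ | _            = (i , j , l) , (i<j , j<l) , λ t → refl
... | tri< i<j _ _ | tri> _ _ l<j | tri< i<l _ _ = (i , l , j) , (i<l , l<j) , λ t → ≡.sym (exchange₂₃ i j l t)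
... | tri< i<j _ _ | tri> _ _ l<j | tri> _ _ l<i = (l , i , j) , (l<i , i<j) , λ t →
  ≡.trans (≡.sym (exchange₂₃ i j l t)) (≡.sym (exchange₁₂ i l j t))
... | tri> _ _ j<i | tri< j<l _ _ | tri< i<l _ _ = (j , i , l) , (j<i , i<l) , λ t → ≡.sym (exchange₁₂ i j l t)
... | tri> _ _ j<i | tri< j<l _ _ | tri> _ _ l<i = (j , l , i) , (j<l , l<i) , λ t →
  ≡.trans (≡.sym (exchange₁₂ i j l t)) (≡.sym (exchange₂₃ j i l t))
... | tri> _ _ j<i | tri> _ _ l<j | _            = (l , j , i) , (l<j , j<i) , λ t →
  ≡.trans (≡.sym (exchange₁₂ i j l t)) (≡.trans (≡.sym (exchange₂₃ j i l t)) (≡.sym (exchange₁₂ j l i t)))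

-- Maximal three-distance sets

module Maximality (R : CompleteOrderedField) where
  open CompleteOrderedField R hiding (zero; refl; sym; trans)
  open Euclidean R
  open IntegerEmbedding R
  open Coordinates R
  open Arrangements R
  open PairwiseDistances R
  open Classification R
  open DistanceSets R
  private module R = CommutativeRing commutativeRing
  open Subset

  resp-∈ : ∀ {n} (A : Subset n) {x y} → x ≋ y → y ∈ A → x ∈ A
  resp-∈ A x≋y = resp A (≋-sym x≋y)

  distanceSet-resp : ∀ {n s} {A B : Subset n} → A ≐ B → IsDistanceSet s A → IsDistanceSet s B
  distanceSet-resp (A⊆B , B⊆A) ((xs , xs! , A⇔) , ds , (ds! , D⇔) , |ds|) =
    (xs , xs! , λ x → mk⇔ (λ x∈ → Equivalence.to (A⇔ x) (B⊆A x∈)) (λ x∈ → A⊆B (Equivalence.from (A⇔ x) x∈))) ,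
    ds , (ds! , λ d → mk⇔
      (λ (x , y , x∈ , y∈ , rest) → Equivalence.to (D⇔ d) (x , y , B⊆A x∈ , B⊆A y∈ , rest))
      (λ d∈ → let x , y , x∈ , y∈ , rest = Equivalence.from (D⇔ d) d∈ in x , y , A⊆B x∈ , A⊆B y∈ , rest)) , |ds|

  maximal-resp : ∀ {n s} {E A B : Subset n} → A ≐ B → IsMaximalDistanceSet s E A → IsMaximalDistanceSet s E B
  maximal-resp {A = A} {B} A≐B@(A⊆B , B⊆A) (A⊆E , distanceSet , maximal) =
    (λ x∈ → A⊆E (B⊆A x∈)) , distanceSet-resp {A = A} {B} A≐B distanceSet ,
    λ C C⊆E dC B⊆C x∈ → A⊆B (maximal C C⊆E dC (λ y∈ → B⊆C (A⊆B y∈)) x∈)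

  tripleSum∈H : ∀ {n} (i j l : Fin n) → tripleSum i j l ∈ H n 3
  tripleSum∈H = sum-tripleSum

  lowered∈H : ∀ p → lowered p ∈ H 8 3
  lowered∈H p = R.trans (sum-twoOff ½ -1ℤ p 0ℤ p) ½-sum

  shifted∈H : ∀ p q → shifted p q ∈ H 9 3
  shifted∈H p q = R.trans (sum-twoOff ⅓ 1ℤ p -1ℤ q) ⅓-sum

  x₀∈H : x₀ ∈ H 9 3
  x₀∈H = resp (H 9 3) (x₀≋ 0F 0F) (R.trans (sum-twoOff {n = 9} ⅓ 0ℤ 0F 0ℤ 0F) ⅓-sum)

  tripleSum-injective : ∀ {n} {i j l a b c : Fin n} → Increasing (i , j , l) → Increasing (a , b , c) →
                        tripleSum i j l ≋ tripleSum a b c → (i , j , l) ≡ (a , b , c)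
  tripleSum-injective {n} {i} {j} {l} {a} {b} {c} ijl abc eq =
    increasing-unique ijl abc (transfer i (inj₁ refl)) (transfer j (inj₂ (inj₁ refl))) (transfer l (inj₂ (inj₂ refl)))
    where
    transfer : ∀ t → t ∈₃ (i , j , l) → t ∈₃ (a , b , c)
    transfer t t∈ with indicator (increasing⇒distinct abc) t | indicator (increasing⇒distinct ijl) t
    ... | inside t∈abc _       | _                      = t∈abc
    ... | outside _ _ _ _      | outside t≢i t≢j t≢l _  = ⊥-elim ([ t≢i , [ t≢j , t≢l ]′ ]′ t∈)
    ... | outside _ _ _ abc≡0  | inside _ ijl≡1
      with () ← ≡.trans (≡.sym ijl≡1) (≡.trans (ι-injective (eq t)) abc≡0)

  module _ {m : ℕ} where
    private
      n = 6 ℕ.+ m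

    increasingSums : List (Point n)
    increasingSums = map (λ (i , j , l) → tripleSum i j l) (increasingTriples n)

    J̃-enumerated : Enumerates (points n) increasingSums (member (J̃ n 3))
    J̃-enumerated = enumerates-map (points n) (λ (i , j , l) → tripleSum i j l) (increasingTriples-unique n)
      (λ c∈ c′∈ → tripleSum-injective (∈-increasingTriples⁻ c∈) (∈-increasingTriples⁻ c′∈))
      (λ c∈ x≋ → resp-∈ (J̃ n 3) x≋ (tripleSum∈J̃ (increasing⇒distinct (∈-increasingTriples⁻ c∈))))
      (λ x∈ → let i , j , l , ijl , x≋ = ∈J̃⇒tripleSum x∈ ; t , inc , δ≡ = sorted ijl in
        t , ∈-increasingTriples⁺ inc , ≋-trans x≋ (λ u → ≡⇒ι≈ (δ≡ u)))

    J̃⊆H : J̃ n 3 ⊆ H n 3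
    J̃⊆H x∈ with i , j , l , _ , x≋ ← ∈J̃⇒tripleSum x∈ = resp-∈ (H n 3) x≋ (tripleSum∈H i j l)

    allowed-J̃ : ∀ {x y : Point n} → (∀ {i j l} → Distinct₃ i j l → AllowedPair y (tripleSum i j l)) →
                x ∈ J̃ n 3 → AllowedPair x y
    allowed-J̃ {x} {y} allowed x∈ = let i , j , l , ijl , x≋ = ∈J̃⇒tripleSum x∈ in
      allowed-sym {x = y} {x} (allowed-resp {x = y} ≋-refl (≋-sym x≋) (allowed ijl))

    J̃-compatible : ∀ {x y} → x ∈ J̃ n 3 → y ∈ J̃ n 3 → Compatible x y
    J̃-compatible x∈ y∈ =
      let _ , _ , _ , ijl , x≋ = ∈J̃⇒tripleSum x∈ ; _ , _ , _ , abc , y≋ = ∈J̃⇒tripleSum y∈ in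
      compatible-resp (≋-sym x≋) (≋-sym y≋) (triple-triple ijl abc)

    -- Comparing x with the finitely many vertices shows that it equals one of them or is at an
    -- allowed distance from all; in the second case `exceptional` applies.
    classify : ∀ {B : Subset n} → B ⊆ H n 3 → IsDistanceSet 3 B → J̃ n 3 ⊆ B →
               ∀ {x} → x ∈ B → x ∈ J̃ n 3 ⊎ Exceptional n x
    classify {B} B⊆H distanceSet J⊆B {x} x∈ =
      [ (λ (y , y∈ , x≋y) → inj₁ (resp-∈ (J̃ n 3) x≋y y∈)) ,
        (λ allowed → inj₂ (exceptional (ℕ.m≤m+n 6 m) (B⊆H x∈) λ ijl → allowed (tripleSum∈J̃ ijl))) ]′
      (enumerated-any-or-all (points n) J̃-enumerated (allowed-resp {x = x} ≋-refl)
        (λ y∈ → distanceSet⇒compatible {B = B} distanceSet J⊆B x∈ (J⊆B y∈)))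

    J̃-distanceSet : IsDistanceSet 3 (J̃ n 3)
    J̃-distanceSet = compatible⇒distanceSet {B = J̃ n 3} (_ , J̃-enumerated) (λ x∈ → x∈) J̃-compatible

    J̃-maximal : n ≢ 8 → n ≢ 9 → IsMaximalDistanceSet 3 (H n 3) (J̃ n 3)
    J̃-maximal n≢8 n≢9 = J̃⊆H , J̃-distanceSet , λ B B⊆H dB J⊆B x∈ →
      [ (λ x∈J → x∈J) , (λ exceptional → contradiction exceptional ordinary) ]′ (classify {B} B⊆H dB J⊆B x∈)
      where
      dimension : ∀ {k} {x : Point k} → Exceptional k x → k ≡ 8 ⊎ k ≡ 9
      dimension (low _ _)  = inj₁ refl
      dimension (mid _)    = inj₂ refl
      dimension (high _ _) = inj₂ refl
      ordinary : ∀ {x} → ¬ Exceptional n x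
      ordinary exceptional = [ n≢8 , n≢9 ]′ (dimension exceptional)

  -- The case n = 8

  module Dimension8 where

    M : Subset 8
    M = J̃ 8 3 ∪ W

    lowered-injective : ∀ {p q} → lowered p ≋ lowered q → p ≡ q
    lowered-injective {p} {q} eq with p ≟ᶠ q
    ... | yes p≡q = p≡q
    ... | no p≢q  = contradiction eq (allowed⇒≉ {x = lowered p} {lowered q} (lowered-lowered p≢q))

    W-enumerated : Enumerates (points 8) (map lowered (allFin 8)) (member W)
    W-enumerated = enumerates-map (points 8) lowered (Unique≡.allFin⁺ 8) (λ _ _ → lowered-injective)
      (λ {p} _ x≋ → resp-∈ W x≋ (lowered∈W p))
      (λ x∈ → let p , x≋ = ∈W⇒lowered x∈ in p , ∈-allFin p , x≋)

    J̃-W-allowed : ∀ {x y} → x ∈ J̃ 8 3 → y ∈ W → AllowedPair x y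
    J̃-W-allowed {x} x∈ y∈ = let p , y≋ = ∈W⇒lowered y∈ in
      allowed-resp {x = x} ≋-refl (≋-sym y≋) (allowed-J̃ {m = 2} {x} {lowered p} (lowered-triple p) x∈)

    W-compatible : ∀ {x y} → x ∈ W → y ∈ W → Compatible x y
    W-compatible x∈ y∈ with p , x≋ ← ∈W⇒lowered x∈ | q , y≋ ← ∈W⇒lowered y∈ =
      compatible-resp (≋-sym x≋) (≋-sym y≋) (lowered-compatible p q)
      where
      lowered-compatible : ∀ p q → Compatible (lowered p) (lowered q)
      lowered-compatible p q with p ≟ᶠ q
      ... | yes refl = inj₁ ≋-refl
      ... | no p≢q   = inj₂ (lowered-lowered p≢q)

    M-enumerated : Enumerates (points 8) (increasingSums ++ map lowered (allFin 8)) (member M)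
    M-enumerated = enumerates-⊎ (points 8) J̃-enumerated W-enumerated
      λ {x} {y} x∈ y∈ → allowed⇒≉ {x = x} {y} (J̃-W-allowed x∈ y∈)

    -- The list consists of 56 triples and 8 further vectors; its length is computed.
    M-size : ∣ M ∣≡ 64
    M-size = _ , M-enumerated , refl

    M-compatible : ∀ {x y} → x ∈ M → y ∈ M → Compatible x y
    M-compatible         (inj₁ x∈) (inj₁ y∈) = J̃-compatible x∈ y∈
    M-compatible         (inj₁ x∈) (inj₂ y∈) = inj₂ (J̃-W-allowed x∈ y∈)
    M-compatible {x} {y} (inj₂ x∈) (inj₁ y∈) = inj₂ (allowed-sym {x = y} {x} (J̃-W-allowed y∈ x∈))
    M-compatible         (inj₂ x∈) (inj₂ y∈) = W-compatible x∈ y∈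

    M⊆H : M ⊆ H 8 3
    M⊆H (inj₁ x∈) = J̃⊆H x∈
    M⊆H (inj₂ x∈) = let p , x≋ = ∈W⇒lowered x∈ in resp-∈ (H 8 3) x≋ (lowered∈H p)

    M-distanceSet : IsDistanceSet 3 M
    M-distanceSet = compatible⇒distanceSet {B = M} (_ , M-enumerated) inj₁ M-compatible

    -- The extra vectors are compatible with each other, so `M` is the greatest three-distance set
    -- above `J̃`; being greatest gives maximality and uniqueness at once.
    ⊆M : ∀ {B} → B ⊆ H 8 3 → IsDistanceSet 3 B → J̃ 8 3 ⊆ B → B ⊆ M
    ⊆M {B} B⊆H dB J⊆B x∈ = Sum.map₂ (λ { (low p x≋) → resp-∈ W x≋ (lowered∈W p) }) (classify {B = B} B⊆H dB J⊆B x∈)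

    M-maximal : IsMaximalDistanceSet 3 (H 8 3) M
    M-maximal = M⊆H , M-distanceSet , λ B B⊆H dB M⊆B → ⊆M {B} B⊆H dB (λ x∈ → M⊆B (inj₁ x∈))

    maximal⇔M : ∀ X → (IsMaximalDistanceSet 3 (H 8 3) X × J̃ 8 3 ⊆ X) ⇔ X ≐ M
    maximal⇔M X = mk⇔
      (λ ((X⊆H , dX , maximal) , J⊆X) →
        let X⊆M = ⊆M {X} X⊆H dX J⊆X in (λ {x} → X⊆M {x}) , λ {x} → maximal M M⊆H M-distanceSet X⊆M {x})
      (λ (X⊆M , M⊆X) → maximal-resp {s = 3} {E = H 8 3} {A = M} {X} (M⊆X , X⊆M) M-maximal , λ x∈ → M⊆X (inj₁ x∈))

  -- The case n = 9

  module Dimension9 where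

    σ : Point 9 → Point 9
    σ = reflect x₀

    reflect-cong : ∀ {x y} → x ≋ y → σ x ≋ σ y
    reflect-cong x≋y t = R.+-congˡ (R.-‿cong (x≋y t))

    reflect-shifted : ∀ p q → σ (shifted p q) ≋ shifted q p
    reflect-shifted p q t = R.trans (R.+-congʳ (R.*-congˡ 1/3≈⅓))
      (R.trans (solve 2 (λ a u → con (+ 2) :* a :- (a :+ u) := a :- u) R.refl ⅓ (ι u))
        (R.+-congˡ (R.trans (R.sym (ι-neg u)) (≡⇒ι≈ opposite))))
      where
      u : ℤ
      u = 1ℤ ℤ.* δ p t ℤ.+ -1ℤ ℤ.* δ q t
      opposite : ℤ.- u ≡ 1ℤ ℤ.* δ q t ℤ.+ -1ℤ ℤ.* δ p t
      opposite = solveℤ 2 (λ u v → ⊝ (conℤ 1ℤ ⊗ u ⊕ conℤ -1ℤ ⊗ v) ⊜ conℤ 1ℤ ⊗ v ⊕ conℤ -1ℤ ⊗ u) refl (δ p t) (δ q t)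
        where
        open +-*-Solver renaming (solve to solveℤ; con to conℤ; _:*_ to _⊗_; _:+_ to _⊕_; _:=_ to _⊜_; :-_ to ⊝_)

    reflect-≋ : ∀ {y} p q → y ≋ shifted p q → σ y ≋ shifted q p
    reflect-≋ p q y≋ = ≋-trans (reflect-cong y≋) (reflect-shifted p q)

    reflection : ∀ {y} → y ∈ Y → σ y ∈ Y × ¬ (σ y ≋ y) × σ (σ y) ≋ y
    reflection y∈ = let p , q , p≢q , y≋ = ∈Y⇒shifted y∈ in
      resp-∈ Y (reflect-≋ p q y≋) (shifted∈Y (≢-sym p≢q)) ,
      (λ σy≋y → antipodal-≉ p≢q (≋-trans (≋-sym y≋) (≋-trans (≋-sym σy≋y) (reflect-≋ p q y≋)))) ,
      ≋-trans (reflect-≋ q p (reflect-≋ p q y≋)) (≋-sym y≋)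

    shifted-injective : ∀ {p q r s} → p ≢ q → r ≢ s → shifted p q ≋ shifted r s → p ≡ r × q ≡ s
    shifted-injective {p} {q} {r} {s} p≢q r≢s eq with shifted-shifted p≢q r≢s
    ... | inj₁ equal                  = equal
    ... | inj₂ (inj₁ allowed)         = contradiction eq (allowed⇒≉ {x = shifted p q} {shifted r s} allowed)
    ... | inj₂ (inj₂ (refl , refl)) = contradiction eq (antipodal-≉ p≢q)

    antipodal-incompatible : ∀ {p q} → p ≢ q → ¬ Compatible (shifted p q) (shifted q p)
    antipodal-incompatible p≢q = [ antipodal-≉ p≢q , antipodal-disallowed p≢q ]′

    IsShifted : Point 9 → Set
    IsShifted x = ∃[ p ] ∃[ q ] p ≢ q × x ≋ shifted p q

    J̃-x₀-allowed : ∀ {x y} → x ∈ J̃ 9 3 → y ≋ x₀ → AllowedPair x y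
    J̃-x₀-allowed {x} x∈ y≋ = allowed-resp {x = x} ≋-refl (≋-sym y≋) (allowed-J̃ {m = 3} {x} {x₀} x₀-triple x∈)

    J̃-Y-allowed : ∀ {x y} → x ∈ J̃ 9 3 → IsShifted y → AllowedPair x y
    J̃-Y-allowed {x} x∈ (p , q , p≢q , y≋) =
      allowed-resp {x = x} ≋-refl (≋-sym y≋) (allowed-J̃ {m = 3} {x} {shifted p q} (shifted-triple p≢q) x∈)

    x₀-Y-allowed : ∀ {x y} → x ≋ x₀ → IsShifted y → AllowedPair x y
    x₀-Y-allowed x≋ (p , q , p≢q , y≋) =
      allowed-resp (≋-sym x≋) (≋-sym y≋) (x₀-shifted p≢q)

    classify₉ : ∀ {X} → X ⊆ H 9 3 → IsDistanceSet 3 X → J̃ 9 3 ⊆ X →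
                ∀ {x} → x ∈ X → x ∈ J̃ 9 3 ⊎ x ≋ x₀ ⊎ IsShifted x
    classify₉ {X} X⊆H dX J⊆X x∈ =
      Sum.map₂ (λ { (mid x≋) → inj₁ x≋ ; (high p≢q x≋) → inj₂ (_ , _ , p≢q , x≋) })
               (classify {B = X} X⊆H dX J⊆X x∈)

    module _ {Y′ : Subset 9} (Y′-shifted : ∀ {x} → x ∈ Y′ → IsShifted x)
             (¬both : ∀ {p q} → p ≢ q → shifted p q ∈ Y′ → ¬ (shifted q p ∈ Y′))
             (either : ∀ {p q} → p ≢ q → shifted p q ∈ Y′ ⊎ shifted q p ∈ Y′) where

      U : Subset 9
      U = J̃ 9 3 ∪ ｛ x₀ ｝ ∪ Y′

      -- The diagonal value is a dummy: only pairs with p < q are enumerated, one for each antipodal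
      -- pair.
      chosen : Fin 9 × Fin 9 → Point 9
      chosen (p , q) with p ≟ᶠ q
      ... | yes _   = shifted p q
      ... | no p≢q = [ (λ _ → shifted p q) , (λ _ → shifted q p) ]′ (either p≢q)

      -- Keeps the membership proof found by `either` next to the vector, so that later case
      -- distinctions see both.
      data Chosen (p q : Fin 9) : Point 9 → Set where
        forward  : shifted p q ∈ Y′ → Chosen p q (shifted p q)
        backward : shifted q p ∈ Y′ → Chosen p q (shifted q p)

      chosen-spec : ∀ {p q} → p ≢ q → Chosen p q (chosen (p , q))
      chosen-spec {p} {q} p≢q with p ≟ᶠ q
      ... | yes p≡q = contradiction p≡q p≢q
      ... | no p≢q′ with either p≢q′
      ...   | inj₁ pq∈ = forward pq∈
      ...   | inj₂ qp∈ = backward qp∈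

      chosen∈ : ∀ {p q y} → Chosen p q y → y ∈ Y′
      chosen∈ (forward pq∈)  = pq∈
      chosen∈ (backward qp∈) = qp∈

      chosen-injective : ∀ {p q r s y z} → p <ᶠ q → r <ᶠ s → Chosen p q y → Chosen r s z → y ≋ z → (p , q) ≡ (r , s)
      chosen-injective p<q r<s (forward _) (forward _) eq
        with refl , refl ← shifted-injective (Fin.<⇒≢ p<q) (Fin.<⇒≢ r<s) eq = refl
      chosen-injective p<q r<s (forward _) (backward _) eq
        with refl , refl ← shifted-injective (Fin.<⇒≢ p<q) (≢-sym (Fin.<⇒≢ r<s)) eq = contradiction (Fin.<-trans p<q r<s) (Fin.<-irrefl refl)
      chosen-injective p<q r<s (backward _) (forward _) eq
        with refl , refl ← shifted-injective (≢-sym (Fin.<⇒≢ p<q)) (Fin.<⇒≢ r<s) eq = contradiction (Fin.<-trans p<q r<s) (Fin.<-irrefl refl)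
      chosen-injective p<q r<s (backward _) (backward _) eq
        with refl , refl ← shifted-injective (≢-sym (Fin.<⇒≢ p<q)) (≢-sym (Fin.<⇒≢ r<s)) eq = refl

      chosen-forward : ∀ {p q y} → p ≢ q → shifted p q ∈ Y′ → Chosen p q y → shifted p q ≋ y
      chosen-forward p≢q pq∈ (forward _)    = ≋-refl
      chosen-forward p≢q pq∈ (backward qp∈) = ⊥-elim (¬both p≢q pq∈ qp∈)

      chosen-backward : ∀ {p q y} → p ≢ q → shifted q p ∈ Y′ → Chosen p q y → shifted q p ≋ y
      chosen-backward p≢q qp∈ (forward pq∈) = ⊥-elim (¬both p≢q pq∈ qp∈)
      chosen-backward p≢q qp∈ (backward _)  = ≋-refl

      chosen-complete : ∀ {x} → x ∈ Y′ → ∃[ c ] c List.∈ increasingPairs 9 × x ≋ chosen c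
      chosen-complete {x} x∈ = locate (Y′-shifted x∈)
        where
        locate : IsShifted x → ∃[ c ] c List.∈ increasingPairs 9 × x ≋ chosen c
        locate (p , q , p≢q , x≋) with Fin.<-cmp p q
        ... | tri< p<q _ _ = (p , q) , ∈-increasingPairs⁺ p<q ,
          ≋-trans x≋ (chosen-forward p≢q (resp Y′ x≋ x∈) (chosen-spec p≢q))
        ... | tri≈ _ p≡q _ = contradiction p≡q p≢q
        ... | tri> _ _ q<p = (q , p) , ∈-increasingPairs⁺ q<p ,
          ≋-trans x≋ (chosen-backward (≢-sym p≢q) (resp Y′ x≋ x∈) (chosen-spec (≢-sym p≢q)))

      Y′-enumerated : Enumerates (points 9) (map chosen (increasingPairs 9)) (member Y′)
      Y′-enumerated = enumerates-map (points 9) chosen (increasingPairs-unique 9)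
        (λ c∈ c′∈ → let p<q = ∈-increasingPairs⁻ c∈ ; r<s = ∈-increasingPairs⁻ c′∈ in
          chosen-injective p<q r<s (chosen-spec (Fin.<⇒≢ p<q)) (chosen-spec (Fin.<⇒≢ r<s)))
        (λ c∈ x≋ → resp-∈ Y′ x≋ (chosen∈ (chosen-spec (Fin.<⇒≢ (∈-increasingPairs⁻ c∈)))))
        chosen-complete

      U-enumerated : Enumerates (points 9) (increasingSums ++ x₀ ∷ map chosen (increasingPairs 9)) (member U)
      U-enumerated = enumerates-⊎ (points 9) J̃-enumerated
        (enumerates-⊎ (points 9) (enumerates-singleton (points 9) x₀) Y′-enumerated
          λ {x} {y} x≋ y∈ → allowed⇒≉ {x = x} {y} (x₀-Y-allowed x≋ (Y′-shifted y∈)))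
        λ { {x} {y} x∈ (inj₁ y≋) → allowed⇒≉ {x = x} {y} (J̃-x₀-allowed x∈ y≋)
          ; {x} {y} x∈ (inj₂ y∈) → allowed⇒≉ {x = x} {y} (J̃-Y-allowed x∈ (Y′-shifted y∈)) }

      -- The count is 84 triples, the centre, and 36 antipodal pairs with one vector each.
      U-size : ∣ U ∣≡ 121
      U-size = _ , U-enumerated , refl

      Y′-compatible : ∀ {x y} → x ∈ Y′ → y ∈ Y′ → Compatible x y
      Y′-compatible {x} {y} x∈ y∈ = compare (Y′-shifted x∈) (Y′-shifted y∈)
        where
        compare : IsShifted x → IsShifted y → Compatible x y
        compare (p , q , p≢q , x≋) (r , s , r≢s , y≋) with shifted-shifted p≢q r≢s
        ... | inj₁ (refl , refl)          = inj₁ (≋-trans x≋ (≋-sym y≋))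
        ... | inj₂ (inj₁ allowed)         = inj₂ (allowed-resp (≋-sym x≋) (≋-sym y≋) allowed)
        ... | inj₂ (inj₂ (refl , refl)) = ⊥-elim (¬both p≢q (resp Y′ x≋ x∈) (resp Y′ y≋ y∈))

      U-compatible : ∀ {x y} → x ∈ U → y ∈ U → Compatible x y
      U-compatible         (inj₁ x∈)        (inj₁ y∈)        = J̃-compatible x∈ y∈
      U-compatible         (inj₁ x∈)        (inj₂ (inj₁ y≋)) = inj₂ (J̃-x₀-allowed x∈ y≋)
      U-compatible         (inj₁ x∈)        (inj₂ (inj₂ y∈)) = inj₂ (J̃-Y-allowed x∈ (Y′-shifted y∈))
      U-compatible {x} {y} (inj₂ (inj₁ x≋)) (inj₁ y∈)        = inj₂ (allowed-sym {x = y} {x} (J̃-x₀-allowed y∈ x≋))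
      U-compatible         (inj₂ (inj₁ x≋)) (inj₂ (inj₁ y≋)) = inj₁ (≋-trans x≋ (≋-sym y≋))
      U-compatible         (inj₂ (inj₁ x≋)) (inj₂ (inj₂ y∈)) = inj₂ (x₀-Y-allowed x≋ (Y′-shifted y∈))
      U-compatible {x} {y} (inj₂ (inj₂ x∈)) (inj₁ y∈)        = inj₂ (allowed-sym {x = y} {x} (J̃-Y-allowed y∈ (Y′-shifted x∈)))
      U-compatible {x} {y} (inj₂ (inj₂ x∈)) (inj₂ (inj₁ y≋)) = inj₂ (allowed-sym {x = y} {x} (x₀-Y-allowed y≋ (Y′-shifted x∈)))
      U-compatible         (inj₂ (inj₂ x∈)) (inj₂ (inj₂ y∈)) = Y′-compatible x∈ y∈

      Y′⊆H : ∀ {x} → x ∈ Y′ → x ∈ H 9 3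
      Y′⊆H x∈ = let p , q , _ , x≋ = Y′-shifted x∈ in resp-∈ (H 9 3) x≋ (shifted∈H p q)

      U⊆H : U ⊆ H 9 3
      U⊆H (inj₁ x∈)        = J̃⊆H x∈
      U⊆H (inj₂ (inj₁ x≋)) = resp-∈ (H 9 3) x≋ x₀∈H
      U⊆H (inj₂ (inj₂ x∈)) = Y′⊆H x∈

      U-maximal : IsMaximalDistanceSet 3 (H 9 3) U
      U-maximal = U⊆H , compatible⇒distanceSet {B = U} (_ , U-enumerated) inj₁ U-compatible , maximal
        where
        maximal : ∀ B → B ⊆ H 9 3 → IsDistanceSet 3 B → U ⊆ B → B ⊆ U
        maximal B B⊆H dB U⊆B {x} x∈ = Sum.map₂ (Sum.map₂ inY) (classify₉ {B} B⊆H dB (λ x∈ → U⊆B (inj₁ x∈)) x∈)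
          where
          inY : IsShifted x → x ∈ Y′
          inY (p , q , p≢q , x≋) = [ (λ pq∈ → resp-∈ Y′ x≋ pq∈) , conflict ]′ (either p≢q)
            where
            -- If the partner is the chosen vector, it lies in `B` as well, at the forbidden
            -- distance √8 from x.
            conflict : shifted q p ∈ Y′ → x ∈ Y′
            conflict qp∈ = ⊥-elim (antipodal-incompatible p≢q (compatible-resp x≋ ≋-refl
              (distanceSet⇒compatible {B = B} dB (λ x∈ → U⊆B (inj₁ x∈)) x∈ (U⊆B (inj₂ (inj₂ qp∈))))))

    module _ {Y′ : Subset 9} (transversal : IsTransversal x₀ Y Y′) where

      transversal-shifted : ∀ {x} → x ∈ Y′ → IsShifted x
      transversal-shifted x∈ = ∈Y⇒shifted (proj₁ transversal x∈)

      transversal-¬both : ∀ {p q} → p ≢ q → shifted p q ∈ Y′ → ¬ (shifted q p ∈ Y′)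
      transversal-¬both {p} {q} p≢q pq∈ qp∈ =
        [ (λ (_ , σ∉) → σ∉ (resp-∈ Y′ (reflect-shifted p q) qp∈)) , (λ (pq∉ , _) → pq∉ pq∈) ]′
        (proj₂ transversal (shifted∈Y p≢q))

      transversal-either : ∀ {p q} → p ≢ q → shifted p q ∈ Y′ ⊎ shifted q p ∈ Y′
      transversal-either {p} {q} p≢q =
        Sum.map proj₁ (λ (_ , σ∈) → resp Y′ (reflect-shifted p q) σ∈) (proj₂ transversal (shifted∈Y p≢q))

      transversal-maximal : IsMaximalDistanceSet 3 (H 9 3) (J̃ 9 3 ∪ ｛ x₀ ｝ ∪ Y′)
      transversal-maximal = U-maximal {Y′} transversal-shifted transversal-¬both transversal-either

      transversal-size : ∣ J̃ 9 3 ∪ ｛ x₀ ｝ ∪ Y′ ∣≡ 121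
      transversal-size = U-size {Y′} transversal-shifted transversal-¬both transversal-either

    module _ {X : Subset 9} (X-maximal : IsMaximalDistanceSet 3 (H 9 3) X) (J⊆X : J̃ 9 3 ⊆ X) where

      private
        X⊆H : X ⊆ H 9 3
        X⊆H = proj₁ X-maximal

        dX : IsDistanceSet 3 X
        dX = proj₁ (proj₂ X-maximal)

        X-enumerated : Enumerates (points 9) (proj₁ (proj₁ dX)) (member X)
        X-enumerated = proj₂ (proj₁ dX)

      X-classify : ∀ {x} → x ∈ X → x ∈ J̃ 9 3 ⊎ x ≋ x₀ ⊎ IsShifted x
      X-classify = classify₉ {X} X⊆H dX J⊆X

      -- The transversal can be read off from `X` itself.
      Y∩X : Subset 9
      Y∩X .member x = x ∈ X × x ∈ Y
      Y∩X .resp x≋y (x∈X , x∈Y) = resp X x≋y x∈X , resp Y x≋y x∈Y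

      -- The centre is compatible with every kind of point that `X` can contain, so maximality
      -- forces it in.
      x₀∈X : x₀ ∈ X
      x₀∈X = maximal-contains {X = X} X-maximal J⊆X x₀∈H λ {x} x∈ →
        [ (λ x∈J → inj₂ (J̃-x₀-allowed x∈J ≋-refl)) ,
          [ inj₁ , (λ x∈Y → inj₂ (allowed-sym {x = x₀} {x} (x₀-Y-allowed ≋-refl x∈Y))) ]′ ]′ (X-classify x∈)

      -- The antipode is the only obstruction to adding a vector of `Y`. Searching the enumeration
      -- of `X` finds one of the two, or shows that `shifted p q` is at an allowed distance from all
      -- of `X` and thus belongs to it by maximality.
      one-of-pair : ∀ {p q} → p ≢ q → shifted p q ∈ X ⊎ shifted q p ∈ X
      one-of-pair {p} {q} p≢q =
        [ (λ (x , x∈ , x≋) → Sum.map (λ x≋ → resp X x≋ x∈) (λ x≋ → resp X x≋ x∈) x≋) ,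
          (λ allowed → inj₁ (maximal-contains {X = X} X-maximal J⊆X (shifted∈H p q) λ x∈ → inj₂ (allowed x∈))) ]′
        (enumerated-any-or-all (points 9) X-enumerated (λ x≋y → allowed-resp {y = shifted p q} x≋y ≋-refl) compare)
        where
        compare : ∀ {x} → x ∈ X → (x ≋ shifted p q ⊎ x ≋ shifted q p) ⊎ AllowedPair x (shifted p q)
        compare {x} x∈ =
          [ (λ x∈J → inj₂ (J̃-Y-allowed x∈J (p , q , p≢q , ≋-refl))) ,
            [ (λ x≋ → inj₂ (x₀-Y-allowed x≋ (p , q , p≢q , ≋-refl))) ,
              (λ (r , s , r≢s , x≋) → fromShifted x≋ (shifted-shifted r≢s p≢q)) ]′ ]′ (X-classify x∈)
          where
          fromShifted : ∀ {r s} → x ≋ shifted r s →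
            (r ≡ p × s ≡ q) ⊎ AllowedPair (shifted r s) (shifted p q) ⊎ (r ≡ q × s ≡ p) →
            (x ≋ shifted p q ⊎ x ≋ shifted q p) ⊎ AllowedPair x (shifted p q)
          fromShifted x≋ (inj₁ (refl , refl))         = inj₁ (inj₁ x≋)
          fromShifted x≋ (inj₂ (inj₁ allowed))        = inj₂ (allowed-resp {y = shifted p q} (≋-sym x≋) ≋-refl allowed)
          fromShifted x≋ (inj₂ (inj₂ (refl , refl))) = inj₁ (inj₂ x≋)

      ¬both-of-pair : ∀ {p q} → p ≢ q → shifted p q ∈ X → ¬ (shifted q p ∈ X)
      ¬both-of-pair p≢q pq∈ qp∈ = antipodal-incompatible p≢q (distanceSet⇒compatible {B = X} dX J⊆X pq∈ qp∈)

      Y∩X-transversal : IsTransversal x₀ Y Y∩X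
      Y∩X-transversal = proj₂ , λ y∈ → choose y∈ (∈Y⇒shifted y∈)
        where
        choose : ∀ {y} → y ∈ Y → IsShifted y →
                 (y ∈ Y∩X × σ y ∉ Y∩X) ⊎ (y ∉ Y∩X × σ y ∈ Y∩X)
        choose y∈ (p , q , p≢q , y≋) = Sum.map
          (λ pq∈ → (resp-∈ X y≋ pq∈ , y∈) , λ (σy∈ , _) → ¬both-of-pair p≢q pq∈ (resp X (reflect-≋ p q y≋) σy∈))
          (λ qp∈ → (λ (y∈X , _) → ¬both-of-pair p≢q (resp X y≋ y∈X) qp∈) ,
                   (resp-∈ X (reflect-≋ p q y≋) qp∈ , proj₁ (reflection y∈)))
          (one-of-pair p≢q)

      X≐ : X ≐ (J̃ 9 3 ∪ ｛ x₀ ｝ ∪ Y∩X)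
      X≐ = (λ x∈ → Sum.map₂ (Sum.map₂ (λ (p , q , p≢q , x≋) → x∈ , resp-∈ Y x≋ (shifted∈Y p≢q))) (X-classify x∈)) ,
           [ J⊆X , [ (λ x≋ → resp-∈ X x≋ x₀∈X) , proj₁ ]′ ]′

    maximal⇔ : ∀ X → (IsMaximalDistanceSet 3 (H 9 3) X × J̃ 9 3 ⊆ X)
                     ⇔ (∃[ Y′ ] IsTransversal x₀ Y Y′ × X ≐ (J̃ 9 3 ∪ ｛ x₀ ｝ ∪ Y′))
    maximal⇔ X = mk⇔
      (λ (X-maximal , J⊆X) → Y∩X {X} X-maximal J⊆X , Y∩X-transversal {X} X-maximal J⊆X , X≐ {X} X-maximal J⊆X)
      (λ (Y′ , transversal , X⊆U , U⊆X) →
        maximal-resp {s = 3} {E = H 9 3} {A = J̃ 9 3 ∪ ｛ x₀ ｝ ∪ Y′} {X} (U⊆X , X⊆U) (transversal-maximal {Y′} transversal) , λ x∈ → U⊆X (inj₁ x∈))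

open import Data.Nat.Base using (_≤_)

mainTheorem3 : (R : CompleteOrderedField) →
    let open CompleteOrderedField R using (-_)
        open Euclidean R
    in
    ((n : ℕ) → 6 ≤ n → n ≢ 8 → n ≢ 9 → IsMaximalDistanceSet 3 (H n 3) (J̃ n 3))
    ×
    (let M : Subset 8
         M = J̃ 8 3 ∪ ((1 / 2 , 7) ∷ (- (1 / 2) , 1) ∷ []) ᴾ
     in
     (∀ X → (IsMaximalDistanceSet 3 (H 8 3) X × J̃ 8 3 ⊆ X) ⇔ X ≐ M)
     × ∣ M ∣≡ 64)
    ×
    (let x₀ : Point 9
         x₀ = λ _ → 1 / 3
         Y : Subset 9
         Y = ((4 / 3 , 1) ∷ (1 / 3 , 7) ∷ (- (2 / 3) , 1) ∷ []) ᴾ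
         σ : Point 9 → Point 9
         σ = reflect x₀
     in
     (∀ {y} → y ∈ Y → σ y ∈ Y × ¬ (σ y ≋ y) × σ (σ y) ≋ y)
     × (∀ X → (IsMaximalDistanceSet 3 (H 9 3) X × J̃ 9 3 ⊆ X)
              ⇔ (∃[ Y' ] IsTransversal x₀ Y Y' × X ≐ (J̃ 9 3 ∪ ｛ x₀ ｝ ∪ Y')))
     × (∀ Y' → IsTransversal x₀ Y Y' → ∣ J̃ 9 3 ∪ ｛ x₀ ｝ ∪ Y' ∣≡ 121))
mainTheorem3 R = part₁ , (maximal⇔M , M-size) , (reflection , maximal⇔ , λ Y′ → transversal-size {Y′})
  where
  open Euclidean R
  open Maximality R
  open Dimension8
  open Dimension9
  part₁ : (n : ℕ) → 6 ≤ n → n ≢ 8 → n ≢ 9 → IsMaximalDistanceSet 3 (H n 3) (J̃ n 3)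
  part₁ n 6≤n with m , refl ← ℕ.m≤n⇒∃[o]m+o≡n 6≤n = J̃-maximal {m}
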